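{- Let $n$ and $d$ be positive integers with $d\geq 3$ and $\gcd(n,d)=1$, and let $a,b$ be indeterminates. Then \[ \sum_{k=0}^{n-1}[2dk+1]\frac{(aq,q/a,bq,q/b;q^d)_k(q;q^d)_k^2}{(aq^d,q^d/a,bq^d,q^d/b;q^d)_k(q^d;q^d)_k^2}q^{(2d-3)k} \equiv\begin{cases}0 \pmod{[n]\Phi_n(q)}, &\text{if }n\equiv -1\pmod{d},\\[5pt] 0 \pmod{[n]},&\text{otherwise}. \end{cases} \]
   Context: For an integer $m$, $[m]=[m]_q=(1-q^m)/(1-q)$ denotes the $q$-integer. The $q$-shifted factorial is $(x;q)_0=1$ and $(x;q)_k=(1-x)(1-xq)\cdots(1-xq^{k-1})$ for $k\geq1$, with $(x_1,\dots,x_m;q)_k=(x_1;q)_k\cdots(x_m;q)_k$. $\Phi_n(q)$ is the $n$-th cyclotomic polynomial in $q$. For rational functions $A,B$ in $q$ (with coefficients involving the indeterminates $a,b$) and a polynomial $P(q)$, $A\equiv B\pmod{P(q)}$ means that the numerator of $A-B$ (in reduced form) is divisible by $P(q)$ and its denominator is coprime to $P(q)$. -}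

module Defs where

open import Data.Nat as ℕ using (ℕ; zero; suc; _∸_; _≤_)
open import Data.Integer as ℤ using (ℤ; 0ℤ; 1ℤ)
open import Data.Nat.Divisibility using (_∣?_)
open import Relation.Nullary using (¬_; yes; no)
open import Relation.Binary.PropositionalEquality using (_≡_; _≢_)
open import Data.Product using (Σ; _×_)

-- Polynomials in ℤ[a, b, q], given by syntax; equality is equality of
-- all coefficients (so this is exactly the polynomial ring).

infixl 6 _⊕_ _⊖_
infixl 7 _⊗_
infix 4 _≈_

data Poly : Set where
  con : ℤ → Poly
  𝕒 𝕓 𝕢 : Poly
  _⊕_ _⊗_ : Poly → Poly → Poly
  ⊝_ : Poly → Poly

_⊖_ : Poly → Poly → Poly
p ⊖ r = p ⊕ (⊝ r)

sumTo : ℕ → (ℕ → ℤ) → ℤ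
sumTo zero f = f 0
sumTo (suc n) f = sumTo n f ℤ.+ f (suc n)

coeff : Poly → ℕ → ℕ → ℕ → ℤ
coeff (con c) 0 0 0 = c
coeff (con c) _ _ _ = 0ℤ
coeff 𝕒 1 0 0 = 1ℤ
coeff 𝕒 _ _ _ = 0ℤ
coeff 𝕓 0 1 0 = 1ℤ
coeff 𝕓 _ _ _ = 0ℤ
coeff 𝕢 0 0 1 = 1ℤ
coeff 𝕢 _ _ _ = 0ℤ
coeff (p ⊕ r) i j k = coeff p i j k ℤ.+ coeff r i j k
coeff (p ⊗ r) i j k =
  sumTo i λ i' → sumTo j λ j' → sumTo k λ k' →
    coeff p i' j' k' ℤ.* coeff r (i ∸ i') (j ∸ j') (k ∸ k')
coeff (⊝ p) i j k = ℤ.- coeff p i j k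

_≈_ : Poly → Poly → Set
p ≈ r = ∀ i j k → coeff p i j k ≡ coeff r i j k

𝟘 𝟙 : Poly
𝟘 = con 0ℤ
𝟙 = con 1ℤ

pow : Poly → ℕ → Poly
pow p zero = 𝟙
pow p (suc n) = p ⊗ pow p n

FreeOfQ : Poly → Set
FreeOfQ c = ∀ i j k → k ≢ 0 → coeff c i j k ≡ 0ℤ

record Frac : Set where
  constructor _//_
  field
    num den : Poly
open Frac public

fromPoly : Poly → Frac
fromPoly p = p // 𝟙

zeroF oneF : Frac
zeroF = fromPoly 𝟘
oneF = fromPoly 𝟙

infixl 6 _+F_ _-F_
infixl 7 _*F_ _/F_

_+F_ _-F_ _*F_ _/F_ : Frac → Frac → Frac
(n₁ // d₁) +F (n₂ // d₂) = (n₁ ⊗ d₂ ⊕ n₂ ⊗ d₁) // (d₁ ⊗ d₂)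
(n₁ // d₁) -F (n₂ // d₂) = (n₁ ⊗ d₂ ⊖ n₂ ⊗ d₁) // (d₁ ⊗ d₂)
(n₁ // d₁) *F (n₂ // d₂) = (n₁ ⊗ n₂) // (d₁ ⊗ d₂)
(n₁ // d₁) /F (n₂ // d₂) = (n₁ ⊗ d₂) // (d₁ ⊗ n₂)

sumF : ℕ → (ℕ → Frac) → Frac
sumF zero f = zeroF
sumF (suc n) f = sumF n f +F f n

-- Congruence A ≡ B (mod P) for P ∈ ℤ[q], in the ring K[q], K = ℚ(a,b):
-- the reduced numerator of A - B is divisible by P and the reduced
-- denominator is coprime to P.  Equivalently (clearing denominators in
-- K): A - B = P·M / D₁ with M, D₁ ∈ ℤ[a,b,q], D₁ ≠ 0, and D₁ coprime to
-- P in K[q], i.e. U·D₁ + V·P = c for some U, V and nonzero c ∈ ℤ[a,b].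

_≡F_mod_ : Frac → Frac → Poly → Set
A ≡F B mod P =
  Σ Poly λ M → Σ Poly λ D₁ → Σ Poly λ U → Σ Poly λ V → Σ Poly λ c →
    (¬ (D₁ ≈ 𝟘)) ×
    (num (A -F B) ⊗ D₁ ≈ P ⊗ M ⊗ den (A -F B)) ×
    FreeOfQ c × (¬ (c ≈ 𝟘)) ×
    (U ⊗ D₁ ⊕ V ⊗ P ≈ c)

qint : ℕ → Frac
qint m = (𝟙 ⊖ pow 𝕢 m) // (𝟙 ⊖ 𝕢)

qintPoly : ℕ → Poly
qintPoly zero = 𝟘
qintPoly (suc m) = qintPoly m ⊕ pow 𝕢 m

poch : Frac → ℕ → ℕ → Frac
poch x d zero = oneF
poch x d (suc k) = poch x d k *F (oneF -F x *F fromPoly (pow 𝕢 (d ℕ.* k)))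

prodDiv : ℕ → (ℕ → Poly) → Poly
prodDiv m F = go m
  where
  go : ℕ → Poly
  go zero = 𝟙
  go (suc e) with suc e ∣? m
  ... | yes _ = go e ⊗ F (suc e)
  ... | no _ = go e

-- Φ 1, ..., Φ n are the cyclotomic polynomials: ∏_{e ∣ m} Φ_e(q) = q^m - 1
-- for all 1 ≤ m ≤ n (this determines Φ 1, ..., Φ n uniquely).
IsCyclotomicUpTo : ℕ → (ℕ → Poly) → Set
IsCyclotomicUpTo n Φ = ∀ m → 1 ≤ m → m ≤ n → prodDiv m Φ ≈ pow 𝕢 m ⊖ 𝟙

qd : ℕ → Poly
qd d = pow 𝕢 d

summand : ℕ → ℕ → Frac
summand d k =
  qint (2 ℕ.* d ℕ.* k ℕ.+ 1)
  *F ((poch (fromPoly (𝕒 ⊗ 𝕢)) d k *F poch (𝕢 // 𝕒) d k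
       *F poch (fromPoly (𝕓 ⊗ 𝕢)) d k *F poch (𝕢 // 𝕓) d k
       *F poch (fromPoly 𝕢) d k *F poch (fromPoly 𝕢) d k)
     /F (poch (fromPoly (𝕒 ⊗ qd d)) d k *F poch (qd d // 𝕒) d k
       *F poch (fromPoly (𝕓 ⊗ qd d)) d k *F poch (qd d // 𝕓) d k
       *F poch (fromPoly (qd d)) d k *F poch (fromPoly (qd d)) d k))
  *F fromPoly (pow 𝕢 ((2 ℕ.* d ∸ 3) ℕ.* k))

S : ℕ → ℕ → Frac
S n d = sumF n (summand d)

{-# OPTIONS --safe #-}

-- Put Q = q^d, h(z) = (1 − a z)(a − z)(1 − b z)(b − z)(1 − z)², and let w_k be the weight of the k-th
-- term, so that the term is (1 − q Q^{2k}) w_k and w_{k+1} / w_k = g h(q Q^k) / h(Q^{k+1}) with g q³ = Q².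
-- Since h(z) = z⁶ h(1/z), there is a closed form of w_k in which the reflection k ↦ M − k is visible,
-- where q Q^M ≡ 1 (mod Φ_m).  For m ∣ n, m > 1, the terms k and M − k of each block of m consecutive terms
-- cancel modulo Φ_m and those with k > M vanish.  The resulting congruences are combined by the Chinese
-- remainder theorem.
--
-- If d t = n + 1, then q ≡ Q^t (mod Φ_n), so modulo Φ_n the terms are, up to a constant, the values at
-- z = Q^k of a Laurent polynomial P with exponents of absolute value at most 3t − 2 < n.  With M = n − t and v = q Q^M ≡ 1
-- (mod Φ_n), the sum of the k-th and (M − k)-th terms is, up to a constant, P(Q^k) − P(Q^k / v) modulo Φ_n²,
-- and P has double zeros at the other Q^k.  The sum of z^j over z = Q^k, k < n, is divisible by Φ_n for
-- 0 < |j| < n, so it does not change modulo Φ_n² when z is replaced by z / v; hence twice the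
-- sum of the terms vanishes modulo Φ_n².
module Submission where

open import Algebra.Bundles using (CommutativeRing; RawRing)
open import Algebra.Morphism.Structures using (module RingMorphisms)
import Algebra.Morphism.RingMonomorphism as RingMonomorphism
open import Data.Integer as ℤ using (ℤ; 0ℤ; 1ℤ; +_; -[1+_])
import Data.Integer.Properties as ℤP
open import Data.Maybe using (Maybe; just; nothing)
open import Data.Nat as ℕ using (ℕ; zero; suc; _∸_; _≤_; _<_; s≤s; z≤n)
open import Data.Nat.Coprimality using (Coprime; coprime-divisor; coprime-Bézout; gcd≡1⇒coprime)
open import Data.Nat.Divisibility using (_∣_; _∣?_; divides; ∣-refl; ∣-trans; ∣⇒≤; n∣m*n; ∣n⇒∣m*n; ∣m+n∣m⇒∣n; 1∣_)
open import Data.Nat.DivMod using (_%_; _/_; m≡m%n+[m/n]*n; m%n<n)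
open import Data.Nat.GCD using (gcd; gcd-GCD; gcd[m,n]∣m; gcd[m,n]∣n; module Bézout)
import Data.Nat.Properties as ℕP
open import Data.Nat.Solver using (module +-*-Solver)
open import Data.Product using (Σ; ∃; _×_; _,_; proj₁; proj₂)
import Data.Sign as Sign
open import Data.Sum using (inj₁; inj₂; [_,_]′)
open import Level using (0ℓ)
open import Relation.Binary.Definitions using (tri<; tri≈; tri>)
open import Relation.Binary.PropositionalEquality as ≡ using (_≡_; _≢_)
open import Relation.Nullary using (¬_; yes; no; Dec; contradiction)

-- The obstacle modulo Φ_n² is that the weights are values of a Laurent polynomial only modulo Φ_n.
-- Yet the ratio of the two weights of a pair is computable modulo Φ_n², because to first order h
-- behaves multiplicatively under scalings of its argument by elements congruent to 1. The sum of
-- the pair then has a factor that is visibly divisible by Φ_n, so the remaining factor matters only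
-- modulo Φ_n. The exponent 3t - 2 comes from g Q^(3t-2) ≡ 1 (mod Φ_n), and d ≥ 3 keeps it below n,
-- as 3t ≤ dt = n + 1. Coprimality over ℚ(a,b) is expressed by identities U D + V P = c with c a
-- nonzero polynomial in a and b, and the congruences become equations in the localization at all
-- such D, modulo P. As a and b are free, only the factor (1 - z)² of h can be singular there. At
-- the start of a later block the numerator and the denominator of the weight both vanish modulo
-- Φ_m; therefore values are attached to pairs (numerator, denominator) that may share a factor
-- which is not a unit.

module IntegerSolver (R : CommutativeRing 0ℓ 0ℓ) where
  open CommutativeRing R
  open import Algebra.Properties.Ring ring
  open import Algebra.Properties.AbelianGroup +-abelianGroup using (⁻¹-∙-comm)
  open import Algebra.Properties.Monoid.Mult +-monoid using (×-homo-+) renaming (_×_ to _·_)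
  open import Algebra.Properties.Semiring.Mult semiring using (×1-homo-*)
  open import Algebra.Solver.Ring.AlmostCommutativeRing
  open import Data.Integer using (_⊖_; _◃_)
  open import Relation.Binary.Reasoning.Setoid setoid

  -- Unlike n · 1#, this sends 1 to 1# definitionally, so that the solver reads con 1 as 1#.
  nat : ℕ → Carrier
  nat zero = 0#
  nat (suc zero) = 1#
  nat (suc (suc n)) = 1# + nat (suc n)

  nat-suc : ∀ n → nat (suc n) ≈ 1# + nat n
  nat-suc zero = sym (+-identityʳ 1#)
  nat-suc (suc n) = refl

  nat≈× : ∀ n → nat n ≈ n · 1#
  nat≈× zero = refl
  nat≈× (suc n) = trans (nat-suc n) (+-congˡ (nat≈× n))

  nat-+ : ∀ m n → nat (m ℕ.+ n) ≈ nat m + nat n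
  nat-+ m n = trans (nat≈× (m ℕ.+ n)) (trans (×-homo-+ 1# m n) (sym (+-cong (nat≈× m) (nat≈× n))))

  nat-* : ∀ m n → nat (m ℕ.* n) ≈ nat m * nat n
  nat-* m n = trans (nat≈× (m ℕ.* n)) (trans (×1-homo-* m n) (sym (*-cong (nat≈× m) (nat≈× n))))

  int : ℤ → Carrier
  int (+ n) = nat n
  int -[1+ n ] = - nat (suc n)

  int-⊖ : ∀ m n → int (m ⊖ n) ≈ nat m - nat n
  int-⊖ m zero = sym (trans (+-congˡ -0#≈0#) (+-identityʳ _))
  int-⊖ zero (suc n) = sym (+-identityˡ _)
  int-⊖ (suc m) (suc n) = begin
    int (suc m ⊖ suc n) ≡⟨ ≡.cong int (ℤP.[1+m]⊖[1+n]≡m⊖n m n) ⟩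
    int (m ⊖ n) ≈⟨ int-⊖ m n ⟩
    nat m - nat n ≈⟨ +-congʳ (trans (sym (+-identityˡ _)) (+-congʳ (sym (-‿inverseʳ 1#)))) ⟩
    ((1# - 1#) + nat m) - nat n ≈⟨ +-congʳ (trans (+-assoc _ _ _) (trans (+-congˡ (+-comm _ _)) (sym (+-assoc _ _ _)))) ⟩
    ((1# + nat m) - 1#) - nat n ≈⟨ +-assoc _ _ _ ⟩
    (1# + nat m) + (- 1# - nat n) ≈⟨ +-congˡ (⁻¹-∙-comm _ _) ⟩
    (1# + nat m) - (1# + nat n) ≈⟨ +-cong (nat-suc m) (-‿cong (nat-suc n)) ⟨
    nat (suc m) - nat (suc n) ∎

  int-+ : ∀ i j → int (i ℤ.+ j) ≈ int i + int j
  int-+ (+ m) (+ n) = nat-+ m n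
  int-+ (+ m) -[1+ n ] = int-⊖ m (suc n)
  int-+ -[1+ m ] (+ n) = trans (int-⊖ n (suc m)) (+-comm _ _)
  int-+ -[1+ m ] -[1+ n ] = begin
    - nat (suc (suc (m ℕ.+ n))) ≡⟨ ≡.cong (λ k → - nat (suc k)) (≡.sym (ℕP.+-suc m n)) ⟩
    - nat (suc m ℕ.+ suc n) ≈⟨ -‿cong (nat-+ (suc m) (suc n)) ⟩
    - (nat (suc m) + nat (suc n)) ≈⟨ ⁻¹-∙-comm _ _ ⟨
    - nat (suc m) - nat (suc n) ∎

  int-neg : ∀ i → int (ℤ.- i) ≈ - int i
  int-neg (+ zero) = sym -0#≈0#
  int-neg (+ suc n) = refl
  int-neg -[1+ n ] = sym (-‿involutive _)

  int-+◃ : ∀ n → int (Sign.+ ◃ n) ≈ nat n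
  int-+◃ n = reflexive (≡.cong int (ℤP.+◃n≡+n n))

  int--◃ : ∀ n → int (Sign.- ◃ n) ≈ - nat n
  int--◃ n = trans (reflexive (≡.cong int (ℤP.-◃n≡-n n))) (int-neg (+ n))

  int-* : ∀ i j → int (i ℤ.* j) ≈ int i * int j
  int-* (+ m) (+ n) = trans (int-+◃ (m ℕ.* n)) (nat-* m n)
  int-* (+ m) -[1+ n ] = trans (int--◃ (m ℕ.* suc n))
    (trans (-‿cong (nat-* m (suc n))) (-‿distribʳ-* _ _))
  int-* -[1+ m ] (+ n) = trans (int--◃ (suc m ℕ.* n))
    (trans (-‿cong (nat-* (suc m) n)) (-‿distribˡ-* _ _))
  int-* -[1+ m ] -[1+ n ] = trans (int-+◃ (suc m ℕ.* suc n)) (trans (nat-* (suc m) (suc n))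
    (trans (sym (-‿involutive _)) (trans (-‿cong (-‿distribˡ-* _ _)) (-‿distribʳ-* _ _))))

  intMorphism : CommutativeRing.rawRing ℤP.+-*-commutativeRing -Raw-AlmostCommutative⟶ fromCommutativeRing R
  intMorphism = record
    { ⟦_⟧ = int ; +-homo = int-+ ; *-homo = int-* ; -‿homo = int-neg
    ; 0-homo = refl ; 1-homo = refl }

  int-≟ : ∀ i j → Maybe (int i ≈ int j)
  int-≟ i j with i ℤ.≟ j
  ... | yes ≡.refl = just refl
  ... | no _ = nothing

  open import Algebra.Solver.Ring (CommutativeRing.rawRing ℤP.+-*-commutativeRing)
    (fromCommutativeRing R) intMorphism int-≟ public using (solve; _:=_; _:+_; _:*_; _:-_; :-_; _:^_; con)

  open import Algebra.Properties.CommutativeSemiring.Exp commutativeSemiring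

-- Units, finite sums and products, the geometric sum

module RingTools (R : CommutativeRing 0ℓ 0ℓ) where
  open CommutativeRing R public
  open IntegerSolver R public
  open import Algebra.Properties.CommutativeSemiring.Exp commutativeSemiring public
    using (_^_; ^-homo-*; ^-assocʳ; ^-distrib-*; ^-congˡ; ^-congʳ)
  open import Relation.Binary.Reasoning.Setoid setoid public

  x-x≈0 : ∀ {x y} → x ≈ y → x - y ≈ 0#
  x-x≈0 {x} {y} x≈y = trans (+-congʳ x≈y) (-‿inverseʳ y)

  x-y≈0⇒x≈y : ∀ {x y} → x - y ≈ 0# → x ≈ y
  x-y≈0⇒x≈y {x} {y} e = begin
    x ≈⟨ solve 2 (λ x y → x := (x :- y) :+ y) refl x y ⟩
    (x - y) + y ≈⟨ +-congʳ e ⟩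
    0# + y ≈⟨ +-identityˡ y ⟩
    y ∎

  multiple⇒≈ : ∀ {x y c s t} → s ≈ t → x - y ≈ c * (s - t) → x ≈ y
  multiple⇒≈ s≈t e = x-y≈0⇒x≈y (trans e (trans (*-congˡ (x-x≈0 s≈t)) (zeroʳ _)))

  multiple₂⇒≈ : ∀ {x y c s t c′ s′ t′} → s ≈ t → s′ ≈ t′ →
    x - y ≈ c * (s - t) + c′ * (s′ - t′) → x ≈ y
  multiple₂⇒≈ s≈t s′≈t′ e = x-y≈0⇒x≈y (trans e (trans
    (+-cong (trans (*-congˡ (x-x≈0 s≈t)) (zeroʳ _)) (trans (*-congˡ (x-x≈0 s′≈t′)) (zeroʳ _)))
    (+-identityˡ 0#)))

  Unit : Carrier → Set
  Unit x = ∃ λ y → x * y ≈ 1#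

  Unit-resp : ∀ {x y} → x ≈ y → Unit x → Unit y
  Unit-resp x≈y (z , xz) = z , trans (*-congʳ (sym x≈y)) xz

  Unit-1 : Unit 1#
  Unit-1 = 1# , *-identityˡ 1#

  Unit-* : ∀ {x y} → Unit x → Unit y → Unit (x * y)
  Unit-* {x} {y} (x′ , xx′) (y′ , yy′) = x′ * y′ , (begin
    (x * y) * (x′ * y′) ≈⟨ solve 4 (λ x y x′ y′ → (x :* y) :* (x′ :* y′) := (x :* x′) :* (y :* y′)) refl x y x′ y′ ⟩
    (x * x′) * (y * y′) ≈⟨ *-cong xx′ yy′ ⟩
    1# * 1# ≈⟨ *-identityˡ 1# ⟩
    1# ∎)

  Unit-^ : ∀ {x} → Unit x → ∀ n → Unit (x ^ n)
  Unit-^ u zero = Unit-1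
  Unit-^ u (suc n) = Unit-* u (Unit-^ u n)

  Unit-factorˡ : ∀ {x y} → Unit (x * y) → Unit x
  Unit-factorˡ {x} {y} (z , e) = y * z , trans (sym (*-assoc x y z)) e

  Unit-factorʳ : ∀ {x y} → Unit (x * y) → Unit y
  Unit-factorʳ u = Unit-factorˡ (Unit-resp (*-comm _ _) u)

  Unit-cancel : ∀ {u x y} → Unit u → u * x ≈ u * y → x ≈ y
  Unit-cancel {u} {x} {y} (u′ , uu′) e = begin
    x ≈⟨ *-identityˡ x ⟨
    1# * x ≈⟨ *-congʳ uu′ ⟨
    (u * u′) * x ≈⟨ solve 3 (λ u u′ x → (u :* u′) :* x := u′ :* (u :* x)) refl u u′ x ⟩
    u′ * (u * x) ≈⟨ *-congˡ e ⟩
    u′ * (u * y) ≈⟨ solve 3 (λ u u′ x → u′ :* (u :* x) := (u :* u′) :* x) refl u u′ y ⟩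
    (u * u′) * y ≈⟨ *-congʳ uu′ ⟩
    1# * y ≈⟨ *-identityˡ y ⟩
    y ∎

  Unit-cancel-0 : ∀ {u x} → Unit u → u * x ≈ 0# → x ≈ 0#
  Unit-cancel-0 {u} U e = Unit-cancel U (trans e (sym (zeroʳ u)))

  1^ : ∀ n → 1# ^ n ≈ 1#
  1^ zero = refl
  1^ (suc n) = trans (*-identityˡ _) (1^ n)

  ^-inv : ∀ {x y} → x * y ≈ 1# → ∀ n → x ^ n * y ^ n ≈ 1#
  ^-inv {x} {y} xy n = trans (sym (^-distrib-* x y n)) (trans (^-congˡ n xy) (1^ n))

  ^-swap : ∀ x m n → (x ^ m) ^ n ≈ (x ^ n) ^ m
  ^-swap x m n = trans (^-assocʳ x m n) (trans (^-congʳ x (ℕP.*-comm m n)) (sym (^-assocʳ x n m)))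

  sum prod : (ℕ → Carrier) → ℕ → Carrier
  sum f zero = 0#
  sum f (suc n) = sum f n + f n
  prod f zero = 1#
  prod f (suc n) = prod f n * f n

  sum-cong : ∀ {f g} n → (∀ i → i < n → f i ≈ g i) → sum f n ≈ sum g n
  sum-cong zero e = refl
  sum-cong (suc n) e = +-cong (sum-cong n λ i i<n → e i (ℕP.m<n⇒m<1+n i<n)) (e n ℕP.≤-refl)

  sum-0 : ∀ {f} n → (∀ i → i < n → f i ≈ 0#) → sum f n ≈ 0#
  sum-0 zero e = refl
  sum-0 (suc n) e = trans (+-cong (sum-0 n λ i i<n → e i (ℕP.m<n⇒m<1+n i<n)) (e n ℕP.≤-refl)) (+-identityˡ 0#)

  sum-+ : ∀ f g n → sum (λ i → f i + g i) n ≈ sum f n + sum g n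
  sum-+ f g zero = sym (+-identityˡ 0#)
  sum-+ f g (suc n) = trans (+-congʳ (sum-+ f g n))
    (solve 4 (λ a b c d → (a :+ b) :+ (c :+ d) := (a :+ c) :+ (b :+ d)) refl _ _ _ _)

  sum-*ˡ : ∀ c f n → sum (λ i → c * f i) n ≈ c * sum f n
  sum-*ˡ c f zero = sym (zeroʳ c)
  sum-*ˡ c f (suc n) = trans (+-congʳ (sum-*ˡ c f n)) (sym (distribˡ c _ _))

  sum-first : ∀ f n → sum f (suc n) ≈ f 0 + sum (λ i → f (suc i)) n
  sum-first f zero = +-comm _ _
  sum-first f (suc n) = trans (+-congʳ (sum-first f n)) (+-assoc _ _ _)

  sum-reverse : ∀ f n → sum f (suc n) ≈ sum (λ i → f (n ∸ i)) (suc n)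
  sum-reverse f zero = refl
  sum-reverse f (suc n) = trans (+-comm _ _) (trans (+-congˡ (sum-reverse f n))
    (sym (sum-first (λ i → f (suc n ∸ i)) (suc n))))

  sum-split : ∀ f m n → sum f (m ℕ.+ n) ≈ sum f m + sum (λ i → f (m ℕ.+ i)) n
  sum-split f m zero = trans (reflexive (≡.cong (sum f) (ℕP.+-identityʳ m))) (sym (+-identityʳ _))
  sum-split f m (suc n) = trans (reflexive (≡.cong (sum f) (ℕP.+-suc m n)))
    (trans (+-congʳ (sum-split f m n)) (+-assoc _ _ _))

  prod-cong : ∀ {f g} n → (∀ i → i < n → f i ≈ g i) → prod f n ≈ prod g n
  prod-cong zero e = refl
  prod-cong (suc n) e = *-cong (prod-cong n λ i i<n → e i (ℕP.m<n⇒m<1+n i<n)) (e n ℕP.≤-refl)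

  prod-split : ∀ f m n → prod f (m ℕ.+ n) ≈ prod f m * prod (λ i → f (m ℕ.+ i)) n
  prod-split f m zero = trans (reflexive (≡.cong (prod f) (ℕP.+-identityʳ m))) (sym (*-identityʳ _))
  prod-split f m (suc n) = trans (reflexive (≡.cong (prod f) (ℕP.+-suc m n)))
    (trans (*-congʳ (prod-split f m n)) (*-assoc _ _ _))

  prod-Unit : ∀ {f} n → (∀ i → i < n → Unit (f i)) → Unit (prod f n)
  prod-Unit zero u = Unit-1
  prod-Unit (suc n) u = Unit-* (prod-Unit n λ i i<n → u i (ℕP.m<n⇒m<1+n i<n)) (u n ℕP.≤-refl)

  factor-of-prod : ∀ f {i n} → i < n → ∃ λ c → prod f n ≈ f i * c
  factor-of-prod f {i} {suc n} (s≤s i≤n) with ℕP.m≤n⇒m<n∨m≡n i≤n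
  ... | inj₂ ≡.refl = prod f n , *-comm _ _
  ... | inj₁ i<n with factor-of-prod f i<n
  ...   | c , e = c * f n , trans (*-congʳ e) (*-assoc _ _ _)

  geometric : ∀ x n → (1# - x) * sum (x ^_) n ≈ 1# - x ^ n
  geometric x zero = trans (zeroʳ _) (sym (-‿inverseʳ 1#))
  geometric x (suc n) = begin
    (1# - x) * (sum (x ^_) n + x ^ n) ≈⟨ distribˡ _ _ _ ⟩
    (1# - x) * sum (x ^_) n + (1# - x) * x ^ n ≈⟨ +-congʳ (geometric x n) ⟩
    (1# - x ^ n) + (1# - x) * x ^ n ≈⟨ solve 3 (λ o x p → (o :- p) :+ (con (+ 1) :- x) :* p := o :- x :* p) refl 1# x (x ^ n) ⟩
    1# - x * x ^ n ∎

-- Reflection symmetry of a well-poised series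

module WellPoised (R : CommutativeRing 0ℓ 0ℓ) where
  open RingTools R

  record Reflective (h : Carrier → Carrier) : Set where
    field
      h-cong : ∀ {x y} → x ≈ y → h x ≈ h y
      h-reflect : ∀ {x y} → x * y ≈ 1# → h x ≈ x ^ 6 * h y

  -- `v` is kept apart from 1 because the record serves two moduli: modulo Φ_m it equals 1, modulo
  -- Φ_n² it is only congruent to 1 modulo Φ_n.
  record Series : Set where
    field
      q Q g v v⁻ : Carrier
      h : Carrier → Carrier
      reflective : Reflective h
      M m : ℕ
      M<m : M < m
      qQ^M≈v : q * Q ^ M ≈ v
      vv⁻≈1 : v * v⁻ ≈ 1#
      gq³≈Q² : g * q ^ 3 ≈ Q ^ 2
      Q-Unit : Unit Q
      h-Unit : ∀ i → 0 < i → i < m → Unit (h (Q ^ i))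
      h-v-vanish : h v ≈ 0#
      w : ℕ → Carrier
      w-step : ∀ k → suc k < m → w (suc k) * h (Q ^ suc k) ≈ g * h (q * Q ^ k) * w k

    open Reflective reflective public

    H H⁻ : ℕ → Carrier
    H = prod λ i → h (Q ^ suc i)
    H⁻ = prod λ i → h (v⁻ * Q ^ suc i)

    term : ℕ → Carrier
    term r = (1# - q * (Q ^ r * Q ^ r)) * w r

    H-Unit : ∀ r → r < m → Unit (H r)
    H-Unit r r<m = prod-Unit r λ i i<r → h-Unit (suc i) ℕ.z<s (ℕP.≤-<-trans i<r r<m)

    qQ^rQ^s≈v : ∀ r s → r ℕ.+ s ≡ M → q * (Q ^ r * Q ^ s) ≈ v
    qQ^rQ^s≈v r s r+s≡M = trans (*-congˡ (trans (sym (^-homo-* Q r s)) (^-congʳ Q r+s≡M))) qQ^M≈v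

    -- Reflection turns the upper factor `h (q * Q ^ r)` into a power times `h (v⁻ * Q ^ suc s)`,
    -- since the two arguments are inverse to each other. The upper product thus becomes `H⁻ M` over
    -- `H⁻ s`, and for `v ≈ 1` the reflection r ↔ s only exchanges `H r` and `H s`.
    closed-form : ∀ r s → r ℕ.+ s ≡ M →
      w r * (Q ^ r * (Q ^ 3) ^ (r ℕ.* s)) * (H r * H⁻ s) ≈ (v ^ 3) ^ r * (w 0 * H⁻ M)
    closed-form zero s ≡.refl = solve 2 (λ x y → x :* (con (+ 1) :* con (+ 1)) :* (con (+ 1) :* y) := con (+ 1) :* (x :* y)) refl _ _
    closed-form (suc r) s r+s≡M = begin
      w (suc r) * (Q ^ suc r * (Q ^ 3) ^ (suc r ℕ.* s)) * (H r * h (Q ^ suc r) * H⁻ s)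
        ≈⟨ *-congʳ (*-congˡ (*-congˡ (trans (^-homo-* (Q ^ 3) s (r ℕ.* s)) (*-congʳ (^-swap Q 3 s))))) ⟩
      w (suc r) * (Q ^ suc r * ((Q ^ s) ^ 3 * T)) * (H r * h (Q ^ suc r) * H⁻ s)
        ≈⟨ solve 8 (λ w Q X Y T H h H′ → w :* (Q :* X :* (Y :^ 3 :* T)) :* (H :* h :* H′)
             := (w :* h) :* (Q :* X :* (Y :^ 3 :* T)) :* (H :* H′)) refl _ _ _ _ _ _ _ _ ⟩
      (w (suc r) * h (Q ^ suc r)) * (Q ^ suc r * ((Q ^ s) ^ 3 * T)) * (H r * H⁻ s)
        ≈⟨ *-congʳ (*-congʳ (trans (w-step r (ℕP.≤-<-trans (ℕP.≤-trans (ℕP.m≤m+n (suc r) s) (ℕP.≤-reflexive r+s≡M)) M<m)) (*-congʳ (*-congˡ step-h)))) ⟩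
      (g * ((q * Q ^ r) ^ 6 * h (v⁻ * Q ^ suc s)) * w r) * (Q ^ suc r * ((Q ^ s) ^ 3 * T)) * (H r * H⁻ s)
        ≈⟨ solve 10 (λ g q X h w Q Y T H H′ →
             (g :* ((q :* X) :^ 6 :* h) :* w) :* (Q :* X :* (Y :^ 3 :* T)) :* (H :* H′)
             := ((g :* q :^ 3) :* (q :^ 3 :* X :^ 6 :* Q :* Y :^ 3)) :* ((w :* X :* T) :* (H :* (H′ :* h)))) refl _ _ _ _ _ _ _ _ _ _ ⟩
      ((g * q ^ 3) * (q ^ 3 * (Q ^ r) ^ 6 * Q * (Q ^ s) ^ 3)) * ((w r * Q ^ r * T) * (H r * H⁻ (suc s)))
        ≈⟨ *-congʳ (*-congʳ gq³≈Q²) ⟩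
      -- The powers of q and Q form the cube of q Q^r Q^(s+1), which is v³, and leave Q^(3r), which
      -- raises the exponent r s of Q³ to r (s + 1).
      (Q ^ 2 * (q ^ 3 * (Q ^ r) ^ 6 * Q * (Q ^ s) ^ 3)) * ((w r * Q ^ r * T) * (H r * H⁻ (suc s)))
        ≈⟨ solve 8 (λ q Q X Y w T H H′ →
             (Q :^ 2 :* (q :^ 3 :* X :^ 6 :* Q :* Y :^ 3)) :* ((w :* X :* T) :* (H :* H′))
             := (q :* (X :* (Q :* Y))) :^ 3 :* (w :* (X :* (X :^ 3 :* T)) :* (H :* H′))) refl _ _ _ _ _ _ _ _ ⟩
      (q * (Q ^ r * Q ^ suc s)) ^ 3 * (w r * (Q ^ r * ((Q ^ r) ^ 3 * T)) * (H r * H⁻ (suc s)))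
        ≈⟨ *-cong (^-congˡ 3 (qQ^rQ^s≈v r (suc s) r+s′≡M)) (*-congʳ (*-congˡ (*-congˡ (trans (*-congʳ (^-swap Q r 3))
             (trans (sym (^-homo-* (Q ^ 3) r (r ℕ.* s))) (^-congʳ _ (≡.sym (ℕP.*-suc r s)))))))) ⟩
      v ^ 3 * (w r * (Q ^ r * (Q ^ 3) ^ (r ℕ.* suc s)) * (H r * H⁻ (suc s)))
        ≈⟨ *-congˡ (closed-form r (suc s) r+s′≡M) ⟩
      v ^ 3 * ((v ^ 3) ^ r * (w 0 * H⁻ M)) ≈⟨ *-assoc _ _ _ ⟨
      (v ^ 3) ^ suc r * (w 0 * H⁻ M) ∎
      where
      T = (Q ^ 3) ^ (r ℕ.* s)
      r+s′≡M : r ℕ.+ suc s ≡ M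
      r+s′≡M = ≡.trans (ℕP.+-suc r s) r+s≡M
      step-h : h (q * Q ^ r) ≈ (q * Q ^ r) ^ 6 * h (v⁻ * Q ^ suc s)
      step-h = h-reflect (begin
        (q * Q ^ r) * (v⁻ * Q ^ suc s) ≈⟨ solve 4 (λ q X v Y → (q :* X) :* (v :* Y) := (q :* (X :* Y)) :* v) refl _ _ _ _ ⟩
        (q * (Q ^ r * Q ^ suc s)) * v⁻ ≈⟨ *-congʳ (qQ^rQ^s≈v r (suc s) r+s′≡M) ⟩
        v * v⁻ ≈⟨ vv⁻≈1 ⟩
        1# ∎)

    -- The zero of h at v is the upper factor of the step from M to M + 1; the recurrence, whose
    -- lower factors are units, passes it on.
    w-vanish : ∀ k → M < k → k < m → w k ≈ 0#
    w-vanish (suc k) (s≤s M≤k) k<m with ℕP.m≤n⇒m<n∨m≡n M≤k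
    ... | inj₂ ≡.refl = Unit-cancel-0 (h-Unit (suc k) ℕ.z<s k<m) (trans (*-comm _ _) (trans (w-step k k<m)
          (trans (*-congʳ (trans (*-congˡ (trans (h-cong qQ^M≈v) h-v-vanish)) (zeroʳ g))) (zeroˡ _))))
    ... | inj₁ M<k = Unit-cancel-0 (h-Unit (suc k) ℕ.z<s k<m) (trans (*-comm _ _) (trans (w-step k k<m)
          (trans (*-congˡ (w-vanish k M<k (ℕP.<-trans (ℕP.n<1+n k) k<m))) (zeroʳ _))))

    sum-term-truncate : sum term m ≈ sum term (suc M)
    sum-term-truncate with ℕP.m≤n⇒∃[o]m+o≡n M<m
    ... | o , e = trans (reflexive (≡.cong (sum term) (≡.sym e))) (trans (sum-split term (suc M) o)
          (trans (+-congˡ (sum-0 o λ i i<o → trans (*-congˡ (w-vanish (suc M ℕ.+ i) (s≤s (ℕP.m≤m+n M i))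
            (≡.subst (suc M ℕ.+ i <_) e (ℕP.+-monoʳ-< (suc M) i<o)))) (zeroʳ _))) (+-identityʳ _)))

    2sum≈paired : sum term (suc M) + sum term (suc M) ≈ sum (λ r → term r + term (M ∸ r)) (suc M)
    2sum≈paired = trans (+-congˡ (sum-reverse term M)) (sym (sum-+ term _ (suc M)))

    module _ (v≈1 : v ≈ 1#) where
      private
        v⁻≈1 : v⁻ ≈ 1#
        v⁻≈1 = trans (sym (*-identityˡ v⁻)) (trans (*-congʳ (sym v≈1)) vv⁻≈1)

        H⁻≈H : ∀ r → H⁻ r ≈ H r
        H⁻≈H r = prod-cong r λ i _ → h-cong (trans (*-congʳ v⁻≈1) (*-identityˡ _))

        v³^r≈1 : ∀ r → (v ^ 3) ^ r ≈ 1#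
        v³^r≈1 r = trans (^-congˡ r (trans (^-congˡ 3 v≈1) (1^ 3))) (1^ r)

        symmetric-form : ∀ r s → r ℕ.+ s ≡ M →
          w r * (Q ^ r * (Q ^ 3) ^ (r ℕ.* s)) * (H r * H s) ≈ w 0 * H⁻ M
        symmetric-form r s e = trans (*-congˡ (*-congˡ (sym (H⁻≈H s))))
          (trans (closed-form r s e) (trans (*-congʳ (v³^r≈1 r)) (*-identityˡ _)))

      -- For `v ≈ 1` the closed form says that Q^r w_r times a symmetric unit is a constant. Since q
      -- Q^(r+s) is 1, the remaining factor (1 - q Q^(2r)) Q^s equals Q^s - Q^r, which changes sign
      -- under r ↔ s.
      term-antisymmetric : ∀ r s → r ℕ.+ s ≡ M → term r + term s ≈ 0#
      term-antisymmetric r s r+s≡M = Unit-cancel-0 unit (begin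
        (Q ^ r * Q ^ s * T * (H r * H s)) * (term r + term s)
          ≈⟨ solve 7 (λ X Y T H H′ e e′ → (X :* Y :* T :* (H :* H′)) :* (e :+ e′)
               := (X :* Y :* T :* (H :* H′)) :* e :+ (Y :* X :* T :* (H′ :* H)) :* e′) refl _ _ _ _ _ _ _ ⟩
        (Q ^ r * Q ^ s * T * (H r * H s)) * term r + (Q ^ s * Q ^ r * T * (H s * H r)) * term s
          ≈⟨ +-cong (half r s r+s≡M refl) (half s r (≡.trans (ℕP.+-comm s r) r+s≡M) (^-congʳ _ (ℕP.*-comm r s))) ⟩
        (Q ^ s - Q ^ r) * (w 0 * H⁻ M) + (Q ^ r - Q ^ s) * (w 0 * H⁻ M)
          ≈⟨ solve 3 (λ X Y K → (Y :- X) :* K :+ (X :- Y) :* K := con (+ 0)) refl _ _ _ ⟩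
        0# ∎)
        where
        T = (Q ^ 3) ^ (r ℕ.* s)
        r<m : r < m
        r<m = ℕP.≤-<-trans (ℕP.≤-trans (ℕP.m≤m+n r s) (ℕP.≤-reflexive r+s≡M)) M<m
        s<m : s < m
        s<m = ℕP.≤-<-trans (ℕP.≤-trans (ℕP.m≤n+m s r) (ℕP.≤-reflexive r+s≡M)) M<m
        unit : Unit (Q ^ r * Q ^ s * T * (H r * H s))
        unit = Unit-* (Unit-* (Unit-* (Unit-^ Q-Unit r) (Unit-^ Q-Unit s)) (Unit-^ (Unit-^ Q-Unit 3) (r ℕ.* s)))
          (Unit-* (H-Unit r r<m) (H-Unit s s<m))
        half : ∀ r s → r ℕ.+ s ≡ M → T ≈ (Q ^ 3) ^ (r ℕ.* s) →
          (Q ^ r * Q ^ s * T * (H r * H s)) * term r ≈ (Q ^ s - Q ^ r) * (w 0 * H⁻ M)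
        half r s e T≈ = begin
          (Q ^ r * Q ^ s * T * (H r * H s)) * ((1# - q * (Q ^ r * Q ^ r)) * w r)
            ≈⟨ *-congʳ (*-congʳ (*-congˡ T≈)) ⟩
          (Q ^ r * Q ^ s * T′ * (H r * H s)) * ((1# - q * (Q ^ r * Q ^ r)) * w r)
            ≈⟨ solve 7 (λ X Y T H q w H′ → (X :* Y :* T :* (H :* H′)) :* ((con (+ 1) :- q :* (X :* X)) :* w)
                 := (Y :- (q :* (X :* Y)) :* X) :* (w :* (X :* T) :* (H :* H′))) refl _ _ _ _ _ _ _ ⟩
          (Q ^ s - (q * (Q ^ r * Q ^ s)) * Q ^ r) * (w r * (Q ^ r * T′) * (H r * H s))
            ≈⟨ *-cong (+-congˡ (-‿cong (trans (*-congʳ (trans (qQ^rQ^s≈v r s e) v≈1)) (*-identityˡ _)))) (symmetric-form r s e) ⟩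
          (Q ^ s - Q ^ r) * (w 0 * H⁻ M) ∎
          where T′ = (Q ^ 3) ^ (r ℕ.* s)

      -- Adding the sum to its reversal treats a middle term r = M - r like the others, at the price
      -- of a division by 2.
      sum-term≈0 : Unit (1# + 1#) → sum term m ≈ 0#
      sum-term≈0 2-Unit = trans sum-term-truncate (Unit-cancel-0 2-Unit (trans (distribʳ _ _ _)
        (trans (+-cong (*-identityˡ _) (*-identityˡ _)) (trans 2sum≈paired (sum-0 (suc M) λ r r≤M →
          term-antisymmetric r (M ∸ r) (ℕP.m+[n∸m]≡n (ℕP.≤-pred r≤M)))))))

-- Congruence modulo a square-zero element and the second-order cancellation

module SquareZero (R : CommutativeRing 0ℓ 0ℓ) where
  open RingTools R

  module Congruence (π : Carrier) (π²≈0 : π * π ≈ 0#) where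
    infix 4 _≋_
    _≋_ : Carrier → Carrier → Set
    x ≋ y = ∃ λ c → x - y ≈ π * c

    ≈⇒≋ : ∀ {x y} → x ≈ y → x ≋ y
    ≈⇒≋ e = 0# , trans (x-x≈0 e) (sym (zeroʳ π))

    ≋-trans : ∀ {x y z} → x ≋ y → y ≋ z → x ≋ z
    ≋-trans {x} {y} {z} (c , e) (d , f) = c + d , (begin
      x - z ≈⟨ solve 3 (λ x y z → x :- z := (x :- y) :+ (y :- z)) refl x y z ⟩
      (x - y) + (y - z) ≈⟨ +-cong e f ⟩
      π * c + π * d ≈⟨ distribˡ π c d ⟨
      π * (c + d) ∎)

    ≋-sym : ∀ {x y} → x ≋ y → y ≋ x
    ≋-sym {x} {y} (c , e) = - c , (begin
      y - x ≈⟨ solve 2 (λ x y → y :- x := :- (x :- y)) refl x y ⟩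
      - (x - y) ≈⟨ -‿cong e ⟩
      - (π * c) ≈⟨ solve 2 (λ p c → :- (p :* c) := p :* (:- c)) refl π c ⟩
      π * - c ∎)

    *-≋ : ∀ {x x′ y y′} → x ≋ x′ → y ≋ y′ → x * y ≋ x′ * y′
    *-≋ {x} {x′} {y} {y′} (c , e) (d , f) = c * y + x′ * d , (begin
      x * y - x′ * y′ ≈⟨ solve 4 (λ x x′ y y′ → x :* y :- x′ :* y′ := (x :- x′) :* y :+ x′ :* (y :- y′)) refl x x′ y y′ ⟩
      (x - x′) * y + x′ * (y - y′) ≈⟨ +-cong (*-congʳ e) (*-congˡ f) ⟩
      π * c * y + x′ * (π * d) ≈⟨ solve 5 (λ p c y x d → p :* c :* y :+ x :* (p :* d) := p :* (c :* y :+ x :* d)) refl π c y x′ d ⟩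
      π * (c * y + x′ * d) ∎)

    -≋ : ∀ {x x′ y y′} → x ≋ x′ → y ≋ y′ → x - y ≋ x′ - y′
    -≋ {x} {x′} {y} {y′} (c , e) (d , f) = c - d , (begin
      (x - y) - (x′ - y′) ≈⟨ solve 4 (λ x x′ y y′ → (x :- y) :- (x′ :- y′) := (x :- x′) :- (y :- y′)) refl x x′ y y′ ⟩
      (x - x′) - (y - y′) ≈⟨ +-cong e (-‿cong f) ⟩
      π * c - π * d ≈⟨ solve 3 (λ p c d → p :* c :- p :* d := p :* (c :- d)) refl π c d ⟩
      π * (c - d) ∎)

    ^-≋ : ∀ {x y} n → x ≋ y → x ^ n ≋ y ^ n
    ^-≋ zero e = ≈⇒≋ refl
    ^-≋ (suc n) e = *-≋ e (^-≋ n e)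

    ^-≋1 : ∀ {x} n → x ≋ 1# → x ^ n ≋ 1#
    ^-≋1 n e = ≋-trans (^-≋ n e) (≈⇒≋ (1^ n))

    *-≋1 : ∀ {x y} → x ≋ 1# → y ≋ 1# → x * y ≋ 1#
    *-≋1 e f = ≋-trans (*-≋ e f) (≈⇒≋ (*-identityˡ 1#))

    inverse-≋1 : ∀ {x y} → x * y ≈ 1# → x ≋ 1# → y ≋ 1#
    inverse-≋1 {x} {y} xy e = ≋-trans (≈⇒≋ (sym (*-identityˡ y)))
      (≋-trans (*-≋ (≋-sym e) (≈⇒≋ refl)) (≈⇒≋ xy))

    prod-≋ : ∀ {f g} n → (∀ i → i < n → f i ≋ g i) → prod f n ≋ prod g n
    prod-≋ zero e = ≈⇒≋ refl
    prod-≋ (suc n) e = *-≋ (prod-≋ n λ i i<n → e i (ℕP.m<n⇒m<1+n i<n)) (e n ℕP.≤-refl)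

    π-≋ : ∀ {x y} → x ≋ y → π * x ≈ π * y
    π-≋ {x} {y} (c , e) = x-y≈0⇒x≈y (begin
      π * x - π * y ≈⟨ solve 3 (λ p x y → p :* x :- p :* y := p :* (x :- y)) refl π x y ⟩
      π * (x - y) ≈⟨ *-congˡ e ⟩
      π * (π * c) ≈⟨ *-assoc π π c ⟨
      π * π * c ≈⟨ *-congʳ π²≈0 ⟩
      0# * c ≈⟨ zeroˡ c ⟩
      0# ∎)

    ≋-differences : ∀ {x x′ y y′} → x ≋ x′ → y ≋ y′ → (x - x′) * (y - y′) ≈ 0#
    ≋-differences {x} {x′} {y} {y′} (c , e) (d , f) = begin
      (x - x′) * (y - y′) ≈⟨ *-cong e f ⟩
      (π * c) * (π * d) ≈⟨ solve 3 (λ p c d → (p :* c) :* (p :* d) := (p :* p) :* (c :* d)) refl π c d ⟩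
      (π * π) * (c * d) ≈⟨ *-congʳ π²≈0 ⟩
      0# * (c * d) ≈⟨ zeroˡ _ ⟩
      0# ∎

    -- Units lift along a square-zero ideal: the inverse is the geometric series in (y - x) z, cut
    -- off after its linear term.
    Unit-≋ : ∀ {x y} → Unit x → y ≋ x → Unit y
    Unit-≋ {x} {y} (z , xz) y≋x@(c , e) = z * (1# - (y - x) * z) , (begin
      y * (z * (1# - (y - x) * z)) ≈⟨ solve 3 (λ x y z → y :* (z :* (con (+ 1) :- (y :- x) :* z))
         := x :* z :+ (y :- x) :* z :* (con (+ 1) :- x :* z) :- (y :- x) :* (y :- x) :* (z :* z)) refl x y z ⟩
      x * z + (y - x) * z * (1# - x * z) - (y - x) * (y - x) * (z * z)
        ≈⟨ +-cong (+-cong xz (*-congˡ (x-x≈0 (sym xz)))) (-‿cong (*-congʳ (≋-differences y≋x y≋x))) ⟩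
      1# + (y - x) * z * 0# - 0# * (z * z) ≈⟨ solve 3 (λ x y z → con (+ 1) :+ (y :- x) :* z :* con (+ 0) :- con (+ 0) :* (z :* z) := con (+ 1)) refl x y z ⟩
      1# ∎)

  -- A polynomial of degree at most D, known as a function only. `sum-invariant` needs no more than
  -- some decomposition into monomials, so an inductive predicate takes the place of a list of
  -- coefficients.
  data PolynomialMap (D : ℕ) : (Carrier → Carrier) → Set where
    monomial : ∀ c {j} → j ≤ D → PolynomialMap D (λ z → c * z ^ j)
    plus : ∀ {f g} → PolynomialMap D f → PolynomialMap D g → PolynomialMap D (λ z → f z + g z)
    resp : ∀ {f g} → (∀ z → f z ≈ g z) → PolynomialMap D f → PolynomialMap D g

  poly-times-monomial : ∀ {D f} c k → PolynomialMap D f → PolynomialMap (k ℕ.+ D) (λ z → c * z ^ k * f z)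
  poly-times-monomial c k (monomial c′ {j} j≤D) = resp (λ z → trans (*-congˡ (^-homo-* z k j))
    (solve 4 (λ c d x y → (c :* d) :* (x :* y) := c :* x :* (d :* y)) refl c c′ (z ^ k) (z ^ j)))
    (monomial (c * c′) (ℕP.+-monoʳ-≤ k j≤D))
  poly-times-monomial c k (plus p p′) = resp (λ z → sym (distribˡ _ _ _))
    (plus (poly-times-monomial c k p) (poly-times-monomial c k p′))
  poly-times-monomial c k (resp e p) = resp (λ z → *-congˡ (e z)) (poly-times-monomial c k p)

  poly-weaken : ∀ {D E f} → D ≤ E → PolynomialMap D f → PolynomialMap E f
  poly-weaken D≤E (monomial c j≤D) = monomial c (ℕP.≤-trans j≤D D≤E)
  poly-weaken D≤E (plus p p′) = plus (poly-weaken D≤E p) (poly-weaken D≤E p′)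
  poly-weaken D≤E (resp e p) = resp e (poly-weaken D≤E p)

  poly-times-linear : ∀ {D f} α β → PolynomialMap D f → PolynomialMap (suc D) (λ z → f z * (α + β * z))
  poly-times-linear {D} {f} α β p = resp
    (λ z → solve 4 (λ a b z x → a :* con (+ 1) :* x :+ b :* (z :* con (+ 1)) :* x := x :* (a :+ b :* z)) refl α β z (f z))
    (plus (poly-weaken (ℕP.n≤1+n D) (poly-times-monomial α 0 p)) (poly-times-monomial β 1 p))

  module W = WellPoised R

  -- `suc s₀` is the t of the case d t = n + 1, with m = n. Equality is taken modulo Φ_n², and `≋`
  -- is congruence modulo the square-zero element `π`.
  record SecondOrder (series : W.Series) : Set where
    open W.Series series public
    field
      π : Carrier
      π²≈0 : π * π ≈ 0#
    open Congruence π π²≈0 public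
    field
      s₀ : ℕ
      M+s₀+1≡m : M ℕ.+ suc s₀ ≡ m
      e<m : suc (3 ℕ.* s₀) < m
      2-Unit : Unit (1# + 1#)
      Q⁻ : Carrier
      QQ⁻≈1 : Q * Q⁻ ≈ 1#
      v≋1 : v ≋ 1#
      Q^m≋1 : Q ^ m ≋ 1#
      Q^t≋q : Q ^ suc s₀ ≋ q
      1-Q^-Unit : ∀ i → 0 < i → i < m → Unit (1# - Q ^ i)
      h-≋ : ∀ {x y} → x ≋ y → h x ≋ h y
      -- Where `h z` is a unit, this says that h (x z) / h z is multiplicative in x ≋ 1.
      h-cross : ∀ {x y} z → x ≋ 1# → y ≋ 1# → h (x * z) * h (y * z) ≈ h (x * y * z) * h z
      h-double-zero : ∀ {x} → x ≋ 1# → h x ≈ 0#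
      h-poly : ∀ {D f} c → PolynomialMap D f → PolynomialMap (6 ℕ.+ D) (λ z → f z * h (c * z))

    e : ℕ
    e = suc (3 ℕ.* s₀)

    u : Carrier
    u = v ^ 3

    v⁻≋1 : v⁻ ≋ 1#
    v⁻≋1 = inverse-≋1 vv⁻≈1 v≋1

    u≋1 : u ≋ 1#
    u≋1 = ^-≋1 3 v≋1

    v-Unit : Unit v
    v-Unit = v⁻ , vv⁻≈1

    v^e≈ : v ^ e ≈ v * u ^ s₀
    v^e≈ = *-congˡ (sym (^-assocʳ v 3 s₀))

    v⁻x≋x : ∀ x → v⁻ * x ≋ x
    v⁻x≋x x = ≋-trans (*-≋ v⁻≋1 (≈⇒≋ refl)) (≈⇒≋ (*-identityˡ x))

    H⁻≋H : ∀ r → H⁻ r ≋ H r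
    H⁻≋H r = prod-≋ r λ i _ → h-≋ (v⁻x≋x _)

    H⁻-Unit : ∀ r → r < m → Unit (H⁻ r)
    H⁻-Unit r r<m = Unit-≋ (H-Unit r r<m) (H⁻≋H r)

    h⁻-Unit : ∀ i → 0 < i → i < m → Unit (h (v⁻ * Q ^ i))
    h⁻-Unit i 0<i i<m = Unit-≋ (h-Unit i 0<i i<m) (h-≋ (v⁻x≋x _))

    -- z^(-e) F z is the Laurent polynomial P: F has degree 6 s₀ + 2 = 2 e, so the exponents of P
    -- run from -e to e.
    G F : Carrier → Carrier
    G z = prod (λ i → h (Q ^ suc i * z)) s₀
    F z = (1# - q * (z * z)) * G z

    -- The geometric sum times 1 - ρ is 1 - ρ^m, a multiple of π, and so is x - 1; their product
    -- vanishes, and the unit 1 - ρ cancels.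
    geometric-invariant : ∀ ρ → ρ ^ m ≋ 1# → Unit (1# - ρ) → ∀ {x} → x ≋ 1# → sum (ρ ^_) m ≈ x * sum (ρ ^_) m
    geometric-invariant ρ ρ^m≋1 U {x} x≋1 = Unit-cancel U (sym (x-y≈0⇒x≈y (begin
      (1# - ρ) * (x * σ) - (1# - ρ) * σ ≈⟨ solve 3 (λ o x s → o :* (x :* s) :- o :* s := (x :- con (+ 1)) :* (o :* s)) refl (1# - ρ) x σ ⟩
      (x - 1#) * ((1# - ρ) * σ) ≈⟨ *-congˡ (geometric ρ m) ⟩
      (x - 1#) * (1# - ρ ^ m) ≈⟨ ≋-differences x≋1 (≋-sym ρ^m≋1) ⟩
      0# ∎)))
      where σ = sum (ρ ^_) m

    Q^m⁻≋1 : (Q⁻ ^ e) ^ m ≋ 1#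
    Q^m⁻≋1 = ≋-trans (≈⇒≋ (^-swap Q⁻ e m)) (^-≋1 e (inverse-≋1 (^-inv QQ⁻≈1 m) Q^m≋1))

    -- Q^(j - e), without a negative exponent.
    ratio : ℕ → Carrier
    ratio j = Q⁻ ^ e * Q ^ j

    ratio^m≋1 : ∀ j → ratio j ^ m ≋ 1#
    ratio^m≋1 j = ≋-trans (≈⇒≋ (^-distrib-* _ _ m))
      (*-≋1 Q^m⁻≋1 (≋-trans (≈⇒≋ (^-swap Q j m)) (^-≋1 j Q^m≋1)))

    1-ratio-Unit> : ∀ i → 0 < i → i ≤ e → Unit (1# - ratio (e ℕ.+ i))
    1-ratio-Unit> i 0<i i≤e = Unit-resp (+-congˡ (-‿cong (sym (begin
      Q⁻ ^ e * Q ^ (e ℕ.+ i) ≈⟨ *-congˡ (^-homo-* Q e i) ⟩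
      Q⁻ ^ e * (Q ^ e * Q ^ i) ≈⟨ solve 3 (λ x y z → x :* (y :* z) := (y :* x) :* z) refl _ _ _ ⟩
      (Q ^ e * Q⁻ ^ e) * Q ^ i ≈⟨ *-congʳ (^-inv QQ⁻≈1 e) ⟩
      1# * Q ^ i ≈⟨ *-identityˡ _ ⟩
      Q ^ i ∎)))) (1-Q^-Unit i 0<i (ℕP.≤-<-trans i≤e e<m))

    1-ratio-Unit< : ∀ j i → 0 < i → j ℕ.+ i ≡ e → Unit (1# - ratio j)
    1-ratio-Unit< j i 0<i j+i≡e = Unit-factorʳ {Q ^ i} (Unit-resp (begin
      - 1# * (1# - Q ^ i) ≈⟨ solve 1 (λ x → :- con (+ 1) :* (con (+ 1) :- x) := x :- con (+ 1)) refl _ ⟩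
      Q ^ i - 1# ≈⟨ +-congˡ (-‿cong (^-inv QQ⁻≈1 e)) ⟨
      Q ^ i - Q ^ e * Q⁻ ^ e ≈⟨ +-congˡ (-‿cong (*-congʳ (trans (^-congʳ Q (≡.sym j+i≡e)) (^-homo-* Q j i)))) ⟩
      Q ^ i - (Q ^ j * Q ^ i) * Q⁻ ^ e ≈⟨ solve 3 (λ x y z → x :- (y :* x) :* z := x :* (con (+ 1) :- z :* y)) refl _ _ _ ⟩
      Q ^ i * (1# - ratio j) ∎)
      (Unit-* (- 1# , solve 0 (:- con (+ 1) :* :- con (+ 1) := con (+ 1)) refl)
        (1-Q^-Unit i 0<i (ℕP.≤-<-trans (≡.subst (i ≤_) j+i≡e (ℕP.m≤n+m i j)) e<m))))

    -- For j = e the powers of v cancel exactly. Otherwise 0 < |j - e| ≤ e < m, which makes 1 - Q^(j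
    -- - e) a unit.
    power-sum-invariant : ∀ j → j ≤ e ℕ.+ e → sum (ratio j ^_) m ≈ v ^ e * v⁻ ^ j * sum (ratio j ^_) m
    power-sum-invariant j j≤2e with ℕP.<-cmp j e
    ... | tri≈ _ ≡.refl _ = sym (trans (*-congʳ (^-inv vv⁻≈1 e)) (*-identityˡ _))
    ... | tri< j<e _ _ with ℕP.m≤n⇒∃[o]m+o≡n (ℕP.<⇒≤ j<e)
    ...   | i , j+i≡e = geometric-invariant (ratio j) (ratio^m≋1 j)
              (1-ratio-Unit< j i (ℕP.+-cancelˡ-< j 0 i (≡.subst₂ _<_ (≡.sym (ℕP.+-identityʳ j)) (≡.sym j+i≡e) j<e)) j+i≡e)
              (*-≋1 (^-≋1 e v≋1) (^-≋1 j v⁻≋1))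
    power-sum-invariant j j≤2e | tri> _ _ e<j with ℕP.m≤n⇒∃[o]m+o≡n (ℕP.<⇒≤ e<j)
    ...   | i , ≡.refl = geometric-invariant (ratio j) (ratio^m≋1 j)
              (1-ratio-Unit> i (ℕP.+-cancelˡ-< e 0 i (≡.subst (_< e ℕ.+ i) (≡.sym (ℕP.+-identityʳ e)) e<j)) (ℕP.+-cancelˡ-≤ e i e j≤2e))
              (*-≋1 (^-≋1 e v≋1) (^-≋1 j v⁻≋1))

    ratio-power : ∀ j k → (Q⁻ ^ e) ^ k * (Q ^ k) ^ j ≈ ratio j ^ k
    ratio-power j k = trans (*-congˡ (^-swap Q k j)) (sym (^-distrib-* _ _ k))

    -- This is the substitution z ↦ z / v in the sum of z^(-e) f z over z = Q^k; the factor `v ^ e`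
    -- is what z^(-e) contributes.
    sum-invariant : ∀ {f} → PolynomialMap (e ℕ.+ e) f →
      sum (λ k → (Q⁻ ^ e) ^ k * f (Q ^ k)) m ≈ sum (λ k → v ^ e * ((Q⁻ ^ e) ^ k * f (v⁻ * Q ^ k))) m
    sum-invariant (monomial c {j} j≤2e) = begin
      sum (λ k → (Q⁻ ^ e) ^ k * (c * (Q ^ k) ^ j)) m
        ≈⟨ sum-cong m (λ k _ → trans (solve 3 (λ x c y → x :* (c :* y) := c :* (x :* y)) refl _ c _) (*-congˡ (ratio-power j k))) ⟩
      sum (λ k → c * ratio j ^ k) m ≈⟨ sum-*ˡ c _ m ⟩
      c * sum (ratio j ^_) m ≈⟨ *-congˡ (power-sum-invariant j j≤2e) ⟩
      c * (v ^ e * v⁻ ^ j * sum (ratio j ^_) m) ≈⟨ *-assoc _ _ _ ⟨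
      c * (v ^ e * v⁻ ^ j) * sum (ratio j ^_) m ≈⟨ sum-*ˡ _ _ m ⟨
      sum (λ k → c * (v ^ e * v⁻ ^ j) * ratio j ^ k) m
        ≈⟨ sum-cong m (λ k _ → trans (*-congˡ (sym (ratio-power j k))) (trans
             (solve 5 (λ c a b x y → c :* (a :* b) :* (x :* y) := a :* (x :* (c :* (b :* y)))) refl c _ _ _ _)
             (*-congˡ (*-congˡ (*-congˡ (sym (^-distrib-* v⁻ (Q ^ k) j))))))) ⟩
      sum (λ k → v ^ e * ((Q⁻ ^ e) ^ k * (c * (v⁻ * Q ^ k) ^ j))) m ∎
    sum-invariant (plus p p′) = trans (sum-cong m λ k _ → distribˡ _ _ _) (trans (sum-+ _ _ m)
      (trans (+-cong (sum-invariant p) (sum-invariant p′)) (trans (sym (sum-+ _ _ m))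
      (sum-cong m λ k _ → trans (sym (distribˡ _ _ _)) (*-congˡ (sym (distribˡ _ _ _)))))))
    sum-invariant (resp f≈g p) = trans (sum-cong m λ k _ → *-congˡ (sym (f≈g _)))
      (trans (sum-invariant p) (sum-cong m λ k _ → *-congˡ (*-congˡ (f≈g _))))

    G-poly : ∀ k → PolynomialMap (6 ℕ.* k) (λ z → prod (λ i → h (Q ^ suc i * z)) k)
    G-poly zero = resp (λ z → *-identityˡ 1#) (monomial 1# z≤n)
    G-poly (suc k) = ≡.subst (λ D → PolynomialMap D (λ z → prod (λ i → h (Q ^ suc i * z)) (suc k))) (≡.sym (ℕP.*-suc 6 k)) (h-poly (Q ^ suc k) (G-poly k))

    2e≡ : 2 ℕ.+ 6 ℕ.* s₀ ≡ e ℕ.+ e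
    2e≡ = ≡.cong suc (≡.trans (≡.cong suc (ℕP.*-distribʳ-+ s₀ 3 3)) (≡.sym (ℕP.+-suc (3 ℕ.* s₀) (3 ℕ.* s₀))))

    F-poly : PolynomialMap (e ℕ.+ e) F
    F-poly = ≡.subst (λ D → PolynomialMap D F) 2e≡ (resp
      (λ z → solve 3 (λ q z G → con (+ 1) :* con (+ 1) :* G :+ :- q :* (z :* (z :* con (+ 1))) :* G := (con (+ 1) :- q :* (z :* z)) :* G) refl q z (G z))
      (plus (poly-weaken (ℕP.m≤n+m _ 2) (poly-times-monomial 1# 0 (G-poly s₀))) (poly-times-monomial (- q) 2 (G-poly s₀))))

    G-cong : ∀ {x y} → x ≈ y → G x ≈ G y
    G-cong e = prod-cong s₀ λ i _ → h-cong (*-congˡ e)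

    G-≋ : ∀ {x y} → x ≋ y → G x ≋ G y
    G-≋ e = prod-≋ s₀ λ i _ → h-≋ (*-≋ (≈⇒≋ refl) e)

    F-≋ : ∀ {x y} → x ≋ y → F x ≋ F y
    F-≋ e = *-≋ (-≋ (≈⇒≋ refl) (*-≋ (≈⇒≋ refl) (*-≋ e e))) (G-≋ e)

    Q^-shift : ∀ r i → Q ^ suc (r ℕ.+ i) ≈ Q ^ suc i * Q ^ r
    Q^-shift r i = trans (^-congʳ Q (≡.cong suc (ℕP.+-comm r i))) (^-homo-* Q (suc i) r)

    H-shift : ∀ r → H (r ℕ.+ s₀) ≈ H r * G (Q ^ r)
    H-shift r = trans (prod-split _ r s₀) (*-congˡ (prod-cong s₀ λ i _ → h-cong (Q^-shift r i)))

    H⁻-shift : ∀ r → H⁻ (r ℕ.+ s₀) ≈ H⁻ r * G (v⁻ * Q ^ r)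
    H⁻-shift r = trans (prod-split _ r s₀) (*-congˡ (prod-cong s₀ λ i _ → h-cong
      (trans (*-congˡ (Q^-shift r i)) (solve 3 (λ v x y → v :* (x :* y) := x :* (v :* y)) refl _ _ _))))

    N : ℕ
    N = M ℕ.+ s₀

    1+N≡m : suc N ≡ m
    1+N≡m = ≡.trans (≡.sym (ℕP.+-suc M s₀)) M+s₀+1≡m

    r+s₀<m : ∀ {r} → r ≤ M → r ℕ.+ s₀ < m
    r+s₀<m r≤M = ≡.subst (_ <_) 1+N≡m (s≤s (ℕP.+-monoˡ-≤ s₀ r≤M))

    ≤M⇒<m : ∀ {r} → r ≤ M → r < m
    ≤M⇒<m r≤M = ℕP.≤-<-trans r≤M M<m

    ≤N⇒<m : ∀ {r} → r ≤ N → r < m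
    ≤N⇒<m r≤N = ≡.subst (_ <_) 1+N≡m (s≤s r≤N)

    -- Reflecting the factor at l′ brings its argument to v Q^(-m) Q^l. There `h-cross` merges the
    -- scalings v⁻ and v Q^(-m), so that v disappears except for the v^(-6) of the reflection, which
    -- `u * u` compensates.
    h-pair : ∀ l l′ → l ℕ.+ l′ ≡ m →
      h (v⁻ * Q ^ l) * h (v⁻ * Q ^ l′) * (u * u) ≈ h (Q ^ l) * h (Q ^ l′)
    h-pair l l′ l+l′≡m = begin
      h (v⁻ * Q ^ l) * h (v⁻ * Q ^ l′) * (u * u) ≈⟨ *-congʳ (*-congˡ (h-reflect inv⁻)) ⟩
      h (v⁻ * Q ^ l) * ((v⁻ * Q ^ l′) ^ 6 * h ((v * η⁻) * Q ^ l)) * (u * u)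
        ≈⟨ solve 5 (λ A v w Y B → A :* ((w :* Y) :^ 6 :* B) :* (v :^ 3 :* v :^ 3) := (v :* w) :^ 6 :* (Y :^ 6 :* (A :* B))) refl _ _ _ _ _ ⟩
      (v * v⁻) ^ 6 * ((Q ^ l′) ^ 6 * (h (v⁻ * Q ^ l) * h ((v * η⁻) * Q ^ l)))
        ≈⟨ *-cong (trans (^-congˡ 6 vv⁻≈1) (1^ 6)) (*-congˡ (h-cross (Q ^ l) v⁻≋1 (*-≋1 v≋1 η⁻≋1))) ⟩
      1# * ((Q ^ l′) ^ 6 * (h (v⁻ * (v * η⁻) * Q ^ l) * h (Q ^ l)))
        ≈⟨ *-congˡ (*-congˡ (*-congʳ (h-cong (*-congʳ (trans (solve 3 (λ v w n → w :* (v :* n) := (v :* w) :* n) refl v v⁻ η⁻)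
             (trans (*-congʳ vv⁻≈1) (*-identityˡ _))))))) ⟩
      1# * ((Q ^ l′) ^ 6 * (h (η⁻ * Q ^ l) * h (Q ^ l)))
        ≈⟨ solve 3 (λ y a b → con (+ 1) :* (y :* (a :* b)) := b :* (y :* a)) refl _ _ _ ⟩
      h (Q ^ l) * ((Q ^ l′) ^ 6 * h (η⁻ * Q ^ l)) ≈⟨ *-congˡ (h-reflect inv) ⟨
      h (Q ^ l) * h (Q ^ l′) ∎
      where
      η⁻ = Q⁻ ^ m
      η⁻≋1 : η⁻ ≋ 1#
      η⁻≋1 = inverse-≋1 (^-inv QQ⁻≈1 m) Q^m≋1
      inv : Q ^ l′ * (η⁻ * Q ^ l) ≈ 1#
      inv = trans (solve 3 (λ x y z → x :* (y :* z) := (z :* x) :* y) refl _ _ _)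
        (trans (*-congʳ (trans (sym (^-homo-* Q l l′)) (^-congʳ Q l+l′≡m))) (^-inv QQ⁻≈1 m))
      inv⁻ : (v⁻ * Q ^ l′) * ((v * η⁻) * Q ^ l) ≈ 1#
      inv⁻ = trans (solve 5 (λ w x v y z → (w :* x) :* ((v :* y) :* z) := (v :* w) :* (x :* (y :* z))) refl _ _ _ _ _)
        (trans (*-cong vv⁻≈1 inv) (*-identityˡ 1#))

    -- Induction moves one index from i to j. The two factors affected have indices i + 1 and j + 1,
    -- whose sum is m, so `h-pair` applies and contributes `u * u`.
    H-complement : ∀ j i → i ℕ.+ j ≡ N → H⁻ N * H⁻ j * (u ^ j * u ^ j) * H i ≈ H N * H j * H⁻ i
    H-complement zero i i+0≡N with ≡.trans (≡.sym (ℕP.+-identityʳ i)) i+0≡N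
    ... | ≡.refl = solve 2 (λ x y → x :* con (+ 1) :* (con (+ 1) :* con (+ 1)) :* y := y :* con (+ 1) :* x) refl _ _
    H-complement (suc j) i i+1+j≡N = Unit-cancel
      (Unit-* (h-Unit (suc i) ℕ.z<s (≤N⇒<m 1+i≤N)) (h⁻-Unit (suc i) ℕ.z<s (≤N⇒<m 1+i≤N))) (begin
      (a * a⁻) * (H⁻ N * (H⁻ j * b⁻) * ((u * u ^ j) * (u * u ^ j)) * H i)
        ≈⟨ solve 8 (λ a a⁻ K k b⁻ u x y → (a :* a⁻) :* (K :* (k :* b⁻) :* ((u :* x) :* (u :* x)) :* y)
             := (K :* k :* (x :* x) :* (y :* a)) :* (a⁻ :* b⁻ :* (u :* u))) refl _ _ _ _ _ _ _ _ ⟩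
      (H⁻ N * H⁻ j * (u ^ j * u ^ j) * (H i * a)) * (a⁻ * b⁻ * (u * u))
        ≈⟨ *-cong (H-complement j (suc i) 1+i+j≡N) (h-pair (suc i) (suc j) (≡.trans (≡.cong suc i+1+j≡N) 1+N≡m)) ⟩
      (H N * H j * (H⁻ i * a⁻)) * (a * b)
        ≈⟨ solve 6 (λ a a⁻ K k b x → (K :* k :* (x :* a⁻)) :* (a :* b) := (a :* a⁻) :* (K :* (k :* b) :* x)) refl _ _ _ _ _ _ ⟩
      (a * a⁻) * (H N * (H j * b) * H⁻ i) ∎)
      where
      a = h (Q ^ suc i)
      a⁻ = h (v⁻ * Q ^ suc i)
      b = h (Q ^ suc j)
      b⁻ = h (v⁻ * Q ^ suc j)
      1+i+j≡N : suc i ℕ.+ j ≡ N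
      1+i+j≡N = ≡.trans (≡.sym (ℕP.+-suc i j)) i+1+j≡N
      1+i≤N : suc i ≤ N
      1+i≤N = ≡.subst (suc i ≤_) 1+i+j≡N (ℕP.m≤m+n (suc i) j)

    -- A Y ≈ B X and A X ≈ B Y give (A + B)(X - Y) ≈ 0, and A + B is a unit because A ≋ B.
    H-balance : ∀ i j → i ℕ.+ j ≡ N → u ^ i * (H⁻ i * H j) ≈ u ^ j * (H⁻ j * H i)
    H-balance i j i+j≡N = x-y≈0⇒x≈y (Unit-cancel-0 A+B-Unit (begin
      (A + B) * (X - Y) ≈⟨ solve 4 (λ A B X Y → (A :+ B) :* (X :- Y) := (A :* X :- B :* Y) :- (A :* Y :- B :* X)) refl A B X Y ⟩
      (A * X - B * Y) - (A * Y - B * X) ≈⟨ +-cong (x-x≈0 (half i j i+j≡N)) (-‿cong (x-x≈0 (half j i (≡.trans (ℕP.+-comm j i) i+j≡N)))) ⟩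
      0# - 0# ≈⟨ -‿inverseʳ 0# ⟩
      0# ∎))
      where
      A = H⁻ N * u ^ N
      B = H N
      X = u ^ i * (H⁻ i * H j)
      Y = u ^ j * (H⁻ j * H i)
      A+B-Unit : Unit (A + B)
      A+B-Unit = Unit-≋ (Unit-* 2-Unit (H-Unit N (≤N⇒<m ℕP.≤-refl)))
        (≋-trans (≈⇒≋ (solve 2 (λ A B → A :+ B := A :- (:- B)) refl A B))
        (≋-trans (-≋ (≋-trans (*-≋ (H⁻≋H N) (^-≋1 N u≋1)) (≈⇒≋ (*-identityʳ _))) (≈⇒≋ refl))
        (≈⇒≋ (solve 1 (λ B → B :- (:- B) := con (+ 2) :* B) refl B))))
      half : ∀ i j → i ℕ.+ j ≡ N → A * (u ^ i * (H⁻ i * H j)) ≈ B * (u ^ j * (H⁻ j * H i))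
      half i j e = begin
        H⁻ N * u ^ N * (u ^ i * (H⁻ i * H j)) ≈⟨ *-congʳ (*-congˡ (trans (^-congʳ u (≡.sym e)) (^-homo-* u i j))) ⟩
        H⁻ N * (u ^ i * u ^ j) * (u ^ i * (H⁻ i * H j))
          ≈⟨ solve 5 (λ K x y a b → K :* (x :* y) :* (x :* (a :* b)) := y :* (K :* a :* (x :* x) :* b)) refl _ _ _ _ _ ⟩
        u ^ j * (H⁻ N * H⁻ i * (u ^ i * u ^ i) * H j) ≈⟨ *-congˡ (H-complement i j (≡.trans (ℕP.+-comm j i) e)) ⟩
        u ^ j * (H N * H i * H⁻ j) ≈⟨ solve 4 (λ x K a b → x :* (K :* a :* b) := K :* (x :* (b :* a))) refl _ _ _ _ ⟩
        H N * (u ^ j * (H⁻ j * H i)) ∎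

    -- The coefficient left over when the factor 1 - q z² of the s-th term, at z = Q^s, is rewritten
    -- at z = v⁻ Q^r.
    reflected : ℕ → ℕ → Carrier
    reflected r s = v * (Q ^ s * Q⁻ ^ r) * w s

    -- As q Q^(r+s) = v, the factor is 1 - v Q^(s-r) = -v Q^(s-r) (1 - v⁻ Q^(r-s)), and v⁻ Q^(r-s) =
    -- q (v⁻ Q^r)².
    term-reflected : ∀ r s → r ℕ.+ s ≡ M →
      term s ≈ - ((1# - q * ((v⁻ * Q ^ r) * (v⁻ * Q ^ r))) * reflected r s)
    term-reflected r s r+s≡M = begin
      (1# - q * (Y * Y)) * w s ≈⟨ *-congʳ (+-congˡ (-‿cong (begin
        q * (Y * Y) ≈⟨ *-congˡ (trans (sym (*-identityˡ _)) (*-congʳ (sym XX⁻))) ⟩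
        q * (X * X⁻ * (Y * Y)) ≈⟨ solve 4 (λ q X X⁻ Y → q :* (X :* X⁻ :* (Y :* Y)) := (q :* (X :* Y)) :* (Y :* X⁻)) refl q X X⁻ Y ⟩
        (q * (X * Y)) * (Y * X⁻) ≈⟨ *-congʳ qXY ⟩
        v * (Y * X⁻) ∎))) ⟩
      (1# - v * (Y * X⁻)) * w s ≈⟨ *-congʳ (+-congʳ (sym (begin
        v⁻ * v⁻ * (q * (X * Y)) * (X * X⁻) * v ≈⟨ *-congʳ (*-cong (*-congˡ qXY) XX⁻) ⟩
        v⁻ * v⁻ * v * 1# * v ≈⟨ solve 2 (λ v w → w :* w :* v :* con (+ 1) :* v := (v :* w) :* (v :* w)) refl v v⁻ ⟩
        (v * v⁻) * (v * v⁻) ≈⟨ *-cong vv⁻≈1 vv⁻≈1 ⟩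
        1# * 1# ≈⟨ *-identityˡ 1# ⟩
        1# ∎))) ⟩
      (v⁻ * v⁻ * (q * (X * Y)) * (X * X⁻) * v - v * (Y * X⁻)) * w s
        ≈⟨ solve 7 (λ q v w X X⁻ Y y → (w :* w :* (q :* (X :* Y)) :* (X :* X⁻) :* v :- v :* (Y :* X⁻)) :* y
             := :- ((con (+ 1) :- q :* ((w :* X) :* (w :* X))) :* (v :* (Y :* X⁻) :* y))) refl _ _ _ _ _ _ _ ⟩
      - ((1# - q * ((v⁻ * X) * (v⁻ * X))) * (v * (Y * X⁻) * w s)) ∎
      where
      X = Q ^ r
      Y = Q ^ s
      X⁻ = Q⁻ ^ r
      XX⁻ : X * X⁻ ≈ 1#
      XX⁻ = ^-inv QQ⁻≈1 r
      qXY : q * (X * Y) ≈ v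
      qXY = qQ^rQ^s≈v r s r+s≡M

    -- The quotient of the closed forms at s and r contains H r · H⁻ s over H s · H⁻ r. The factors
    -- G extend the index r to r + s₀, which is complementary to s in N, so `H-balance` evaluates
    -- the quotient. This holds modulo π², not merely modulo π.
    reflected-ratio : ∀ r s → r ℕ.+ s ≡ M → reflected r s * G (Q ^ r) ≈ w r * v ^ e * G (v⁻ * Q ^ r)
    reflected-ratio r s r+s≡M = Unit-cancel Ω-Unit (begin
      Ω * (v * (Y * X⁻) * w s * G (Q ^ r))
        ≈⟨ solve 9 (λ X T R x v Y X⁻ w g → (X :* T :* R :* x) :* (v :* (Y :* X⁻) :* w :* g)
             := (X :* X⁻) :* (v :* (w :* (Y :* T))) :* (R :* x :* g)) refl X T (H r * H⁻ r * (H s * H⁻ s)) (u ^ r) v Y X⁻ (w s) (G (Q ^ r)) ⟩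
      (X * X⁻) * (v * (w s * (Y * T))) * ((H r * H⁻ r * (H s * H⁻ s)) * u ^ r * G (Q ^ r))
        ≈⟨ solve 9 (λ Z v W a a⁻ b b⁻ x g → Z :* (v :* W) :* ((a :* a⁻ :* (b :* b⁻)) :* x :* g)
             := Z :* (v :* (W :* (b :* a⁻))) :* (a :* g) :* b⁻ :* x) refl _ _ _ _ _ _ _ _ _ ⟩
      (X * X⁻) * (v * (w s * (Y * T) * (H s * H⁻ r))) * (H r * G (Q ^ r)) * H⁻ s * u ^ r
        ≈⟨ *-congʳ (*-congʳ (*-cong (*-cong (^-inv QQ⁻≈1 r) (*-congˡ (trans (*-congʳ (*-congˡ (*-congˡ (^-congʳ _ (ℕP.*-comm r s)))))
             (closed-form s r (≡.trans (ℕP.+-comm s r) r+s≡M))))) (sym (H-shift r)))) ⟩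
      1# * (v * (u ^ s * K)) * H (r ℕ.+ s₀) * H⁻ s * u ^ r
        ≈⟨ solve 6 (λ v x K a b y → con (+ 1) :* (v :* (x :* K)) :* a :* b :* y := (x :* (b :* a)) :* (v :* K :* y)) refl _ _ _ _ _ _ ⟩
      (u ^ s * (H⁻ s * H (r ℕ.+ s₀))) * (v * K * u ^ r)
        ≈⟨ *-congʳ (sym (H-balance (r ℕ.+ s₀) s N-split)) ⟩
      (u ^ (r ℕ.+ s₀) * (H⁻ (r ℕ.+ s₀) * H s)) * (v * K * u ^ r)
        ≈⟨ *-congʳ (*-cong (^-homo-* u r s₀) (*-congʳ (H⁻-shift r))) ⟩
      ((u ^ r * u ^ s₀) * ((H⁻ r * G (v⁻ * Q ^ r)) * H s)) * (v * K * u ^ r)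
        ≈⟨ solve 7 (λ x y a g b v K → ((x :* y) :* ((a :* g) :* b)) :* (v :* K :* x) := (x :* K) :* (x :* a :* b :* (v :* y) :* g)) refl _ _ _ _ _ _ _ ⟩
      (u ^ r * K) * (u ^ r * H⁻ r * H s * (v * u ^ s₀) * G (v⁻ * Q ^ r))
        ≈⟨ *-cong (closed-form r s r+s≡M) (*-congʳ (*-congˡ v^e≈)) ⟨
      (w r * (X * T) * (H r * H⁻ s)) * (u ^ r * H⁻ r * H s * v ^ e * G (v⁻ * Q ^ r))
        ≈⟨ solve 9 (λ w Z a b⁻ x a⁻ b y g → (w :* Z :* (a :* b⁻)) :* (x :* a⁻ :* b :* y :* g)
             := (Z :* (a :* a⁻ :* (b :* b⁻)) :* x) :* (w :* y :* g)) refl _ _ _ _ _ _ _ _ _ ⟩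
      Ω * (w r * v ^ e * G (v⁻ * Q ^ r)) ∎)
      where
      X = Q ^ r
      Y = Q ^ s
      X⁻ = Q⁻ ^ r
      T = (Q ^ 3) ^ (r ℕ.* s)
      K = w 0 * H⁻ M
      Ω = X * T * (H r * H⁻ r * (H s * H⁻ s)) * u ^ r
      r<m : r < m
      r<m = ≤M⇒<m (≡.subst (r ≤_) r+s≡M (ℕP.m≤m+n r s))
      s<m : s < m
      s<m = ≤M⇒<m (≡.subst (s ≤_) r+s≡M (ℕP.m≤n+m s r))
      Ω-Unit : Unit Ω
      Ω-Unit = Unit-* (Unit-* (Unit-* (Unit-^ Q-Unit r) (Unit-^ (Unit-^ Q-Unit 3) (r ℕ.* s)))
        (Unit-* (Unit-* (H-Unit r r<m) (H⁻-Unit r r<m)) (Unit-* (H-Unit s s<m) (H⁻-Unit s s<m)))) (Unit-^ (Unit-^ v-Unit 3) r)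
      N-split : r ℕ.+ s₀ ℕ.+ s ≡ N
      N-split = ≡.trans (ℕP.+-assoc r s₀ s) (≡.trans (≡.cong (r ℕ.+_) (ℕP.+-comm s₀ s))
        (≡.trans (≡.sym (ℕP.+-assoc r s s₀)) (≡.cong (ℕ._+ s₀) r+s≡M)))

    G-step : ∀ r → r < m → G (Q ^ suc r) * h (Q ^ suc r) ≈ h (Q ^ suc s₀ * Q ^ r) * G (Q ^ r)
    G-step r r<m = Unit-cancel (H-Unit r r<m) (begin
      H r * (G (Q ^ suc r) * h (Q ^ suc r)) ≈⟨ solve 3 (λ a g x → a :* (g :* x) := (a :* x) :* g) refl _ _ _ ⟩
      H (suc r) * G (Q ^ suc r) ≈⟨ H-shift (suc r) ⟨
      H (r ℕ.+ s₀) * h (Q ^ suc (r ℕ.+ s₀)) ≈⟨ *-cong (H-shift r) (h-cong (Q^-shift r s₀)) ⟩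
      (H r * G (Q ^ r)) * h (Q ^ suc s₀ * Q ^ r) ≈⟨ solve 3 (λ a g x → (a :* g) :* x := a :* (x :* g)) refl _ _ _ ⟩
      H r * (h (Q ^ suc s₀ * Q ^ r) * G (Q ^ r)) ∎)

    -- The origin of e = 3t - 2: Q² · g Q^e = g (Q^t)³, which is congruent to g q³ = Q².
    πgQ^e≈π : π * (g * Q ^ e) ≈ π
    πgQ^e≈π = Unit-cancel (Unit-^ Q-Unit 2) (begin
      Q ^ 2 * (π * (g * Q ^ e)) ≈⟨ *-congˡ (*-congˡ (*-congˡ (*-congˡ (trans (sym (^-assocʳ Q 3 s₀)) (^-swap Q 3 s₀))))) ⟩
      Q ^ 2 * (π * (g * (Q * (Q ^ s₀) ^ 3))) ≈⟨ solve 4 (λ Q p g x → Q :^ 2 :* (p :* (g :* (Q :* x :^ 3))) := g :* (p :* (Q :* x) :^ 3)) refl Q π g (Q ^ s₀) ⟩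
      g * (π * (Q ^ suc s₀) ^ 3) ≈⟨ *-congˡ (π-≋ (^-≋ 3 Q^t≋q)) ⟩
      g * (π * q ^ 3) ≈⟨ solve 3 (λ g p q → g :* (p :* q) := (g :* q) :* p) refl _ _ _ ⟩
      (g * q ^ 3) * π ≈⟨ *-congʳ gq³≈Q² ⟩
      Q ^ 2 * π ∎)

    -- Modulo π the upper factors may be read as h (Q^(t+r)), so the quotient of the products of h
    -- telescopes to G (Q^r) over G 1 = H s₀. Multiplication by π allows congruent factors to be
    -- exchanged inside an equation.
    w-mod-π : ∀ r → r ≤ M → π * (w r * (Q ^ e) ^ r * H s₀) ≈ π * (G (Q ^ r) * w 0)
    w-mod-π zero _ = *-congˡ (trans (solve 2 (λ w k → w :* con (+ 1) :* k := k :* w) refl _ _)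
      (*-congʳ (prod-cong s₀ λ i _ → h-cong (sym (*-identityʳ _)))))
    w-mod-π (suc r) r<M = Unit-cancel (h-Unit (suc r) ℕ.z<s (≤M⇒<m r<M)) (begin
      h (Q ^ suc r) * (π * (w (suc r) * (Q ^ e * (Q ^ e) ^ r) * H s₀))
        ≈⟨ solve 6 (λ h p w x y k → h :* (p :* (w :* (x :* y) :* k)) := (w :* h) :* (p :* x :* (y :* k))) refl _ _ _ _ _ _ ⟩
      (w (suc r) * h (Q ^ suc r)) * (π * Q ^ e * ((Q ^ e) ^ r * H s₀))
        ≈⟨ *-congʳ (w-step r (≤M⇒<m r<M)) ⟩
      (g * h (q * Q ^ r) * w r) * (π * Q ^ e * ((Q ^ e) ^ r * H s₀))
        ≈⟨ solve 7 (λ g h w p x y k → (g :* h :* w) :* (p :* x :* (y :* k)) := (p :* (g :* x)) :* (h :* (w :* y :* k))) refl _ _ _ _ _ _ _ ⟩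
      (π * (g * Q ^ e)) * (h (q * Q ^ r) * (w r * (Q ^ e) ^ r * H s₀)) ≈⟨ *-congʳ πgQ^e≈π ⟩
      π * (h (q * Q ^ r) * (w r * (Q ^ e) ^ r * H s₀)) ≈⟨ solve 3 (λ p h x → p :* (h :* x) := h :* (p :* x)) refl _ _ _ ⟩
      h (q * Q ^ r) * (π * (w r * (Q ^ e) ^ r * H s₀)) ≈⟨ *-congˡ (w-mod-π r (ℕP.<⇒≤ r<M)) ⟩
      h (q * Q ^ r) * (π * (G (Q ^ r) * w 0)) ≈⟨ solve 4 (λ h p g w → h :* (p :* (g :* w)) := (p :* h) :* (g :* w)) refl _ _ _ _ ⟩
      (π * h (q * Q ^ r)) * (G (Q ^ r) * w 0) ≈⟨ *-congʳ (π-≋ (h-≋ (*-≋ Q^t≋q (≈⇒≋ refl)))) ⟨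
      (π * h (Q ^ suc s₀ * Q ^ r)) * (G (Q ^ r) * w 0) ≈⟨ solve 4 (λ h p g w → (p :* h) :* (g :* w) := p :* ((h :* g) :* w)) refl _ _ _ _ ⟩
      π * ((h (Q ^ suc s₀ * Q ^ r) * G (Q ^ r)) * w 0) ≈⟨ *-congˡ (*-congʳ (G-step r (≤M⇒<m (ℕP.<⇒≤ r<M)))) ⟨
      π * ((G (Q ^ suc r) * h (Q ^ suc r)) * w 0) ≈⟨ solve 4 (λ h p g w → p :* ((g :* h) :* w) := h :* (p :* (g :* w))) refl _ _ _ _ ⟩
      h (Q ^ suc r) * (π * (G (Q ^ suc r) * w 0)) ∎)

    deviation : ℕ → Carrier
    deviation r = (Q⁻ ^ e) ^ r * F (Q ^ r) - v ^ e * ((Q⁻ ^ e) ^ r * F (v⁻ * Q ^ r))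

    -- Up to the unit G (Q^r), the two terms add up to w_r β, with β the difference of F at Q^r and
    -- v^e F at v⁻ Q^r. Since β is a multiple of π, it suffices to know w_r modulo π.
    term-pair : ∀ r s → r ℕ.+ s ≡ M → H s₀ * (term r + term s) ≈ w 0 * deviation r
    term-pair r s r+s≡M = Unit-cancel G-Unit (begin
      G₊ * (H s₀ * (term r + term s)) ≈⟨ *-congˡ (*-congˡ (+-congˡ (term-reflected r s r+s≡M))) ⟩
      G₊ * (H s₀ * (a * w r - a⁻ * reflected r s))
        ≈⟨ solve 6 (λ g k a w b y → g :* (k :* (a :* w :- b :* y)) := k :* (a :* w :* g :- b :* (y :* g))) refl _ _ _ _ _ _ ⟩
      H s₀ * (a * w r * G₊ - a⁻ * (reflected r s * G₊)) ≈⟨ *-congˡ (+-congˡ (-‿cong (*-congˡ (reflected-ratio r s r+s≡M)))) ⟩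
      H s₀ * (a * w r * G₊ - a⁻ * (w r * v ^ e * G₋))
        ≈⟨ solve 7 (λ k a w g b x f → k :* (a :* w :* g :- b :* (w :* x :* f)) := w :* k :* (a :* g :- x :* (b :* f))) refl _ _ _ _ _ _ _ ⟩
      w r * H s₀ * β ≈⟨ *-cong (trans (*-congʳ (trans (sym (*-identityˡ _)) (*-congʳ (sym QeQ⁻e)))) refl) β≈πc ⟩
      ((Q ^ e) ^ r * (Q⁻ ^ e) ^ r * w r) * H s₀ * (π * c)
        ≈⟨ solve 6 (λ x y w k p c → (x :* y :* w) :* k :* (p :* c) := (p :* (w :* x :* k)) :* (y :* c)) refl _ _ _ _ _ _ ⟩
      (π * (w r * (Q ^ e) ^ r * H s₀)) * ((Q⁻ ^ e) ^ r * c) ≈⟨ *-congʳ (w-mod-π r r≤M) ⟩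
      (π * (G₊ * w 0)) * ((Q⁻ ^ e) ^ r * c) ≈⟨ solve 5 (λ p g w y c → (p :* (g :* w)) :* (y :* c) := g :* (w :* (y :* (p :* c)))) refl _ _ _ _ _ ⟩
      G₊ * (w 0 * ((Q⁻ ^ e) ^ r * (π * c))) ≈⟨ *-congˡ (*-congˡ (*-congˡ β≈πc)) ⟨
      G₊ * (w 0 * ((Q⁻ ^ e) ^ r * β))
        ≈⟨ *-congˡ (*-congˡ (solve 4 (λ y f x f′ → y :* (f :- x :* f′) := y :* f :- x :* (y :* f′)) refl _ _ _ _)) ⟩
      G₊ * (w 0 * deviation r) ∎)
      where
      G₊ = G (Q ^ r)
      G₋ = G (v⁻ * Q ^ r)
      a = 1# - q * (Q ^ r * Q ^ r)
      a⁻ = 1# - q * ((v⁻ * Q ^ r) * (v⁻ * Q ^ r))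
      β = F (Q ^ r) - v ^ e * F (v⁻ * Q ^ r)
      r≤M : r ≤ M
      r≤M = ≡.subst (r ≤_) r+s≡M (ℕP.m≤m+n r s)
      G-Unit : Unit G₊
      G-Unit = Unit-factorʳ (Unit-resp (H-shift r) (H-Unit (r ℕ.+ s₀) (r+s₀<m r≤M)))
      QeQ⁻e : (Q ^ e) ^ r * (Q⁻ ^ e) ^ r ≈ 1#
      QeQ⁻e = ^-inv (^-inv QQ⁻≈1 e) r
      β≋0 : β ≋ 0#
      β≋0 = ≋-trans (-≋ (≈⇒≋ refl) (≋-trans (*-≋ (^-≋1 e v≋1) (F-≋ (v⁻x≋x (Q ^ r)))) (≈⇒≋ (*-identityˡ _))))
        (≈⇒≋ (-‿inverseʳ (F (Q ^ r))))
      c : Carrier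
      c = proj₁ β≋0
      β≈πc : β ≈ π * c
      β≈πc = trans (solve 1 (λ x → x := x :- con (+ 0)) refl β) (proj₂ β≋0)

    -- The factor of G with i + 1 = m - k has argument x Q^m ≋ 1, where h has a double zero; k > M
    -- guarantees i < s₀.
    G-vanish : ∀ k → M < k → k < m → ∀ {x} → x ≋ 1# → G (x * Q ^ k) ≈ 0#
    G-vanish k M<k k<m {x} x≋1 with ℕP.m≤n⇒∃[o]m+o≡n k<m
    ... | i , 1+k+i≡m with factor-of-prod (λ i → h (Q ^ suc i * (x * Q ^ k))) i<s₀
      where
      i<s₀ : i < s₀
      i<s₀ = ℕP.+-cancelˡ-< M i s₀ (ℕP.<-≤-trans (ℕP.+-monoˡ-< i M<k)
        (ℕP.≤-reflexive (ℕP.suc-injective (≡.trans 1+k+i≡m (≡.sym 1+N≡m)))))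
    ...   | c , G≈ = trans G≈ (trans (*-congʳ (h-double-zero (≋-trans (≈⇒≋ (begin
      Q ^ suc i * (x * Q ^ k) ≈⟨ solve 3 (λ a x b → a :* (x :* b) := x :* (a :* b)) refl _ _ _ ⟩
      x * (Q ^ suc i * Q ^ k) ≈⟨ *-congˡ (Q^-shift k i) ⟨
      x * Q ^ suc (k ℕ.+ i) ≈⟨ *-congˡ (^-congʳ Q 1+k+i≡m) ⟩
      x * Q ^ m ∎)) (*-≋1 x≋1 Q^m≋1)))) (zeroˡ c))

    F-vanish : ∀ k → M < k → k < m → ∀ {x} → x ≋ 1# → F (x * Q ^ k) ≈ 0#
    F-vanish k M<k k<m x≋1 = trans (*-congˡ (G-vanish k M<k k<m x≋1)) (zeroʳ _)

    deviation-vanish : ∀ k → M < k → k < m → deviation k ≈ 0#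
    deviation-vanish k M<k k<m = trans (+-cong
      (trans (*-congˡ (trans (*-congˡ (trans (G-cong (sym (*-identityˡ _))) (G-vanish k M<k k<m (≈⇒≋ refl)))) (zeroʳ _))) (zeroʳ _))
      (-‿cong (trans (*-congˡ (trans (*-congˡ (F-vanish k M<k k<m v⁻≋1)) (zeroʳ _))) (zeroʳ _))))
      (-‿inverseʳ 0#)

    -- The invariance concerns the full range k < m, so the sum is first extended by terms that
    -- vanish.
    sum-deviation≈0 : sum deviation (suc M) ≈ 0#
    sum-deviation≈0 = begin
      sum deviation (suc M) ≈⟨ +-identityʳ _ ⟨
      sum deviation (suc M) + 0# ≈⟨ +-congˡ (sum-0 s₀ λ i i<s₀ → deviation-vanish (suc M ℕ.+ i) (s≤s (ℕP.m≤m+n M i))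
                                       (≡.subst (suc M ℕ.+ i <_) 1+N≡m (ℕP.+-monoʳ-< (suc M) i<s₀))) ⟨
      sum deviation (suc M) + sum (λ i → deviation (suc M ℕ.+ i)) s₀ ≈⟨ sum-split deviation (suc M) s₀ ⟨
      sum deviation (suc N) ≡⟨ ≡.cong (sum deviation) 1+N≡m ⟩
      sum deviation m ≈⟨ sum-+ _ _ m ⟩
      sum (λ k → (Q⁻ ^ e) ^ k * F (Q ^ k)) m + sum (λ k → - (v ^ e * ((Q⁻ ^ e) ^ k * F (v⁻ * Q ^ k)))) m
        ≈⟨ +-cong (sum-invariant F-poly) (trans (sum-cong m λ k _ → solve 1 (λ x → :- x := :- con (+ 1) :* x) refl _) (sum-*ˡ (- 1#) _ m)) ⟩
      σ + - 1# * σ ≈⟨ solve 1 (λ x → x :+ :- con (+ 1) :* x := con (+ 0)) refl σ ⟩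
      0# ∎
      where σ = sum (λ k → v ^ e * ((Q⁻ ^ e) ^ k * F (v⁻ * Q ^ k))) m

    sum-term≈0-mod-square : sum term m ≈ 0#
    sum-term≈0-mod-square = trans sum-term-truncate (Unit-cancel-0 (Unit-* (H-Unit s₀ (ℕP.≤-<-trans (ℕP.m≤n+m s₀ M) (≡.subst (N <_) 1+N≡m ℕP.≤-refl))) 2-Unit) (begin
      H s₀ * (1# + 1#) * sum term (suc M) ≈⟨ solve 2 (λ k x → k :* con (+ 2) :* x := k :* (x :+ x)) refl _ _ ⟩
      H s₀ * (sum term (suc M) + sum term (suc M)) ≈⟨ *-congˡ 2sum≈paired ⟩
      H s₀ * sum (λ r → term r + term (M ∸ r)) (suc M) ≈⟨ sum-*ˡ _ _ (suc M) ⟨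
      sum (λ r → H s₀ * (term r + term (M ∸ r))) (suc M)
        ≈⟨ sum-cong (suc M) (λ r r≤M → term-pair r (M ∸ r) (ℕP.m+[n∸m]≡n (ℕP.≤-pred r≤M))) ⟩
      sum (λ r → w 0 * deviation r) (suc M) ≈⟨ sum-*ˡ _ _ (suc M) ⟩
      w 0 * sum deviation (suc M) ≈⟨ *-congˡ sum-deviation≈0 ⟩
      w 0 * 0# ≈⟨ zeroʳ _ ⟩
      0# ∎))

-- The sextic h as a product of linear factors

module Factors (R : CommutativeRing 0ℓ 0ℓ) where
  open RingTools R
  open SquareZero R
  open WellPoised R

  -- c times (1 - c z)(1 - z / c), which needs no inverse of c.
  linearPair : Carrier → Carrier → Carrier
  linearPair c z = (1# - c * z) * (c - z)

  factor : Carrier → Carrier → Carrier → Carrier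
  factor a b z = linearPair a z * linearPair b z * linearPair 1# z

  linearPair-cong : ∀ {c c′ x y} → c ≈ c′ → x ≈ y → linearPair c x ≈ linearPair c′ y
  linearPair-cong c≈ x≈ = *-cong (+-congˡ (-‿cong (*-cong c≈ x≈))) (+-cong c≈ (-‿cong x≈))

  factor-cong : ∀ {a a′ b b′ x y} → a ≈ a′ → b ≈ b′ → x ≈ y → factor a b x ≈ factor a′ b′ y
  factor-cong a≈ b≈ x≈ = *-cong (*-cong (linearPair-cong a≈ x≈) (linearPair-cong b≈ x≈)) (linearPair-cong refl x≈)

  linearPair-reflect : ∀ c {x y} → x * y ≈ 1# → linearPair c x ≈ x ^ 2 * linearPair c y
  linearPair-reflect c {x} {y} xy = sym (begin
    x ^ 2 * ((1# - c * y) * (c - y)) ≈⟨ solve 3 (λ c x y → x :^ 2 :* ((con (+ 1) :- c :* y) :* (c :- y))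
      := (x :- c :* (x :* y)) :* (x :* c :- x :* y)) refl c x y ⟩
    (x - c * (x * y)) * (x * c - x * y) ≈⟨ *-cong (+-congˡ (-‿cong (*-congˡ xy))) (+-congˡ (-‿cong xy)) ⟩
    (x - c * 1#) * (x * c - 1#) ≈⟨ solve 2 (λ c x → (x :- c :* con (+ 1)) :* (x :* c :- con (+ 1)) := (con (+ 1) :- c :* x) :* (c :- x)) refl c x ⟩
    (1# - c * x) * (c - x) ∎)

  factor-reflective : ∀ a b → Reflective (factor a b)
  factor-reflective a b = record
    { h-cong = factor-cong refl refl
    ; h-reflect = λ {x} {y} xy → trans
        (*-cong (*-cong (linearPair-reflect a xy) (linearPair-reflect b xy)) (linearPair-reflect 1# xy))
        (solve 4 (λ x u v w → x :^ 2 :* u :* (x :^ 2 :* v) :* (x :^ 2 :* w) := x :^ 6 :* (u :* v :* w)) refl x _ _ _)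
    }

  factor-1 : ∀ a b {x} → x ≈ 1# → factor a b x ≈ 0#
  factor-1 a b {x} e = trans (*-congˡ (trans (*-congˡ (x-x≈0 (sym e))) (zeroʳ _))) (zeroʳ _)

  module _ {π : Carrier} (π²≈0 : π * π ≈ 0#) where
    open Congruence π π²≈0

    factor-≋ : ∀ a b {x y} → x ≋ y → factor a b x ≋ factor a b y
    factor-≋ a b e = *-≋ (*-≋ (pair a) (pair b)) (pair 1#)
      where
      pair : ∀ c → linearPair c _ ≋ linearPair c _
      pair c = *-≋ (-≋ (≈⇒≋ refl) (*-≋ (≈⇒≋ refl) e)) (-≋ (≈⇒≋ refl) e)

    linear-cross : ∀ α β {x y} z → x ≋ 1# → y ≋ 1# →
      (α - β * (x * z)) * (α - β * (y * z)) ≈ (α - β * (x * y * z)) * (α - β * z)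
    linear-cross α β {x} {y} z x≋1 y≋1 = x-y≈0⇒x≈y (begin
      (α - β * (x * z)) * (α - β * (y * z)) - (α - β * (x * y * z)) * (α - β * z)
        ≈⟨ solve 5 (λ α β x y z → (α :- β :* (x :* z)) :* (α :- β :* (y :* z)) :- (α :- β :* (x :* y :* z)) :* (α :- β :* z)
             := α :* β :* z :* ((x :- con (+ 1)) :* (y :- con (+ 1)))) refl α β x y z ⟩
      α * β * z * ((x - 1#) * (y - 1#)) ≈⟨ *-congˡ (≋-differences x≋1 y≋1) ⟩
      α * β * z * 0# ≈⟨ zeroʳ _ ⟩
      0# ∎)

    cross-* : ∀ {x y z t x′ y′ z′ t′} → x * y ≈ z * t → x′ * y′ ≈ z′ * t′ → (x * x′) * (y * y′) ≈ (z * z′) * (t * t′)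
    cross-* {x} {y} {z} {t} {x′} {y′} {z′} {t′} e e′ = begin
      (x * x′) * (y * y′) ≈⟨ interchange x x′ y y′ ⟩
      (x * y) * (x′ * y′) ≈⟨ *-cong e e′ ⟩
      (z * t) * (z′ * t′) ≈⟨ interchange z t z′ t′ ⟩
      (z * z′) * (t * t′) ∎
      where
      interchange : ∀ x y z t → (x * y) * (z * t) ≈ (x * z) * (y * t)
      interchange = solve 4 (λ x y z t → (x :* y) :* (z :* t) := (x :* z) :* (y :* t)) refl

    linearPair-cross : ∀ c {x y} z → x ≋ 1# → y ≋ 1# →
      linearPair c (x * z) * linearPair c (y * z) ≈ linearPair c (x * y * z) * linearPair c z
    linearPair-cross c {x} {y} z x≋1 y≋1 = cross-* (linear-cross 1# c z x≋1 y≋1) (begin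
      (c - x * z) * (c - y * z) ≈⟨ *-cong one one ⟩
      (c - 1# * (x * z)) * (c - 1# * (y * z)) ≈⟨ linear-cross c 1# z x≋1 y≋1 ⟩
      (c - 1# * (x * y * z)) * (c - 1# * z) ≈⟨ *-cong one one ⟨
      (c - x * y * z) * (c - z) ∎)
      where
      one : ∀ {t} → c - t ≈ c - 1# * t
      one = +-congˡ (-‿cong (sym (*-identityˡ _)))

    factor-cross : ∀ a b {x y} z → x ≋ 1# → y ≋ 1# →
      factor a b (x * z) * factor a b (y * z) ≈ factor a b (x * y * z) * factor a b z
    factor-cross a b z x≋1 y≋1 = cross-* (cross-* (linearPair-cross a z x≋1 y≋1) (linearPair-cross b z x≋1 y≋1))
      (linearPair-cross 1# z x≋1 y≋1)

    factor-double-zero : ∀ a b {x} → x ≋ 1# → factor a b x ≈ 0#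
    factor-double-zero a b {x} x≋1 = trans (*-congˡ (trans (*-congʳ (+-congˡ (-‿cong (*-identityˡ x))))
      (≋-differences (≋-sym x≋1) (≋-sym x≋1)))) (zeroʳ _)

  linearPair-poly : ∀ {D f} c c′ → PolynomialMap D f → PolynomialMap (2 ℕ.+ D) (λ z → f z * linearPair c′ (c * z))
  linearPair-poly {f = f} c c′ p = resp (λ z → solve 4 (λ c d z x →
      x :* (con (+ 1) :+ :- (d :* c) :* z) :* (d :+ :- c :* z) := x :* ((con (+ 1) :- d :* (c :* z)) :* (d :- c :* z))) refl c c′ z (f z))
    (poly-times-linear c′ (- c) (poly-times-linear 1# (- (c′ * c)) p))

  factor-poly : ∀ {D f} a b c → PolynomialMap D f → PolynomialMap (6 ℕ.+ D) (λ z → f z * factor a b (c * z))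
  factor-poly a b c p = resp (λ z → trans (*-congʳ (*-assoc _ _ _)) (*-assoc _ _ _))
    (linearPair-poly c 1# (linearPair-poly c b (linearPair-poly c a p)))

-- Comaximality up to constants, Chinese remaindering and localization

module Comaximality (R : CommutativeRing 0ℓ 0ℓ) (Const : CommutativeRing.Carrier R → Set)
  (Const-* : ∀ {x y} → Const x → Const y → Const (CommutativeRing._*_ R x y)) where
  open RingTools R

  -- Coprimality over the fraction field of the constants, with the denominators of the Bézout
  -- coefficients cleared into c.
  Comax : Carrier → Carrier → Set
  Comax D P = ∃ λ U → ∃ λ V → ∃ λ c → Const c × U * D + V * P ≈ c

  Comax-sym : ∀ {D P} → Comax D P → Comax P D
  Comax-sym (U , V , c , C , e) = V , U , c , C , trans (+-comm _ _) e

  Comax-resp : ∀ {D D′ P} → D ≈ D′ → Comax D P → Comax D′ P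
  Comax-resp D≈D′ (U , V , c , C , e) = U , V , c , C , trans (+-congʳ (*-congˡ (sym D≈D′))) e

  Comax-const : ∀ {D P} → Const D → Comax D P
  Comax-const {D} {P} C = 1# , 0# , D , C , solve 2 (λ D P → con (+ 1) :* D :+ con (+ 0) :* P := D) refl D P

  Comax-divisorʳ : ∀ {D P P′ T} → P′ ≈ P * T → Comax D P′ → Comax D P
  Comax-divisorʳ {D} {P} {P′} {T} P′≈PT (U , V , c , C , e) = U , V * T , c , C ,
    trans (+-congˡ (trans (solve 3 (λ V T P → V :* T :* P := V :* (P :* T)) refl V T P) (*-congˡ (sym P′≈PT)))) e

  Comax-divisorˡ : ∀ {D D′ P T} → D′ ≈ D * T → Comax D′ P → Comax D P
  Comax-divisorˡ e = λ x → Comax-sym (Comax-divisorʳ e (Comax-sym x))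

  Comax-* : ∀ {D D′ P} → Comax D P → Comax D′ P → Comax (D * D′) P
  Comax-* {D} {D′} {P} (U , V , c , C , e) (U′ , V′ , c′ , C′ , e′) =
    U * U′ , U * D * V′ + V * (U′ * D′ + V′ * P) , c * c′ , Const-* C C′ , (begin
    U * U′ * (D * D′) + (U * D * V′ + V * (U′ * D′ + V′ * P)) * P
      ≈⟨ solve 7 (λ U V U′ V′ D D′ P → U :* U′ :* (D :* D′) :+ (U :* D :* V′ :+ V :* (U′ :* D′ :+ V′ :* P)) :* P
           := (U :* D :+ V :* P) :* (U′ :* D′ :+ V′ :* P)) refl U V U′ V′ D D′ P ⟩
    (U * D + V * P) * (U′ * D′ + V′ * P) ≈⟨ *-cong e e′ ⟩
    c * c′ ∎)

  Comax-*ʳ : ∀ {D P P′} → Comax D P → Comax D P′ → Comax D (P * P′)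
  Comax-*ʳ e e′ = Comax-sym (Comax-* (Comax-sym e) (Comax-sym e′))

  Comax-+ : ∀ {D P} T → Comax D P → Comax (D + P * T) P
  Comax-+ {D} {P} T (U , V , c , C , e) = U , V - U * T , c , C , trans
    (solve 5 (λ D P T U V → U :* (D :+ P :* T) :+ (V :- U :* T) :* P := U :* D :+ V :* P) refl D P T U V) e

  module _ (n d : Carrier) where
    -- The fraction n / d lies in the multiples of P in the localization at the elements comaximal with P.
    Multiple : Carrier → Set
    Multiple P = ∃ λ D → Comax D P × ∃ λ M → n * D ≈ P * M * d

    Multiple-resp : ∀ {P P′} → P ≈ P′ → Multiple P → Multiple P′
    Multiple-resp P≈P′ (D , C , M , e) = D , Comax-divisorʳ (trans (sym (*-identityʳ _)) (*-congʳ P≈P′)) C ,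
      M , trans e (*-congʳ (*-congʳ P≈P′))

    -- Adding P′ times one relation to P times the other exposes the factor P P′. The new scale P′ D
    -- + P D′ is P′ D modulo P and P D′ modulo P′, hence comaximal with both.
    Multiple-* : ∀ {P P′} → Comax P P′ → Multiple P → Multiple P′ → Multiple (P * P′)
    Multiple-* {P} {P′} PP′ (D , C , M , e) (D′ , C′ , M′ , e′) = P′ * D + P * D′ ,
      Comax-*ʳ (Comax-+ D′ (Comax-* (Comax-sym PP′) C))
        (Comax-resp (+-comm _ _) (Comax-+ D (Comax-* PP′ C′))) , M + M′ , (begin
      n * (P′ * D + P * D′) ≈⟨ solve 5 (λ n P P′ D D′ → n :* (P′ :* D :+ P :* D′) := P′ :* (n :* D) :+ P :* (n :* D′)) refl n P P′ D D′ ⟩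
      P′ * (n * D) + P * (n * D′) ≈⟨ +-cong (*-congˡ e) (*-congˡ e′) ⟩
      P′ * (P * M * d) + P * (P′ * M′ * d) ≈⟨ solve 5 (λ P P′ M M′ d → P′ :* (P :* M :* d) :+ P :* (P′ :* M′ :* d) := P :* P′ :* (M :+ M′) :* d) refl P P′ M M′ d ⟩
      P * P′ * (M + M′) * d ∎)

  module Localize (Const-1 : Const 1#) (P : Carrier) where
    record Fraction : Set where
      no-eta-equality
      pattern
      constructor frac
      field
        top bottom : Carrier
        comax : Comax bottom P
    open Fraction public

    -- Equality in the localization modulo P. The explicit scale lets transitivity absorb the middle
    -- denominator instead of cancelling it.
    record _≃_ (x y : Fraction) : Set where
      no-eta-equality
      pattern
      constructor scaled
      field
        scale quotient : Carrier
        scale-comax : Comax scale P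
        eq : scale * (top x * bottom y - top y * bottom x) ≈ P * quotient
    infix 4 _≃_

    1-comax : Comax 1# P
    1-comax = Comax-const Const-1

    cross⇒≃ : ∀ {x y} → top x * bottom y ≈ top y * bottom x → x ≃ y
    cross⇒≃ e = scaled 1# 0# 1-comax (trans (*-congˡ (x-x≈0 e)) (trans (zeroʳ 1#) (sym (zeroʳ P))))

    ≃-sym : ∀ {x y} → x ≃ y → y ≃ x
    ≃-sym {frac n d _} {frac n′ d′ _} (scaled E T C e) = scaled E (- T) C (begin
      E * (n′ * d - n * d′) ≈⟨ solve 5 (λ E n d n′ d′ → E :* (n′ :* d :- n :* d′) := :- (E :* (n :* d′ :- n′ :* d))) refl E n d n′ d′ ⟩
      - (E * (n * d′ - n′ * d)) ≈⟨ -‿cong e ⟩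
      - (P * T) ≈⟨ solve 2 (λ P T → :- (P :* T) := P :* :- T) refl P T ⟩
      P * - T ∎)

    ≃-trans : ∀ {x y z} → x ≃ y → y ≃ z → x ≃ z
    ≃-trans {frac n d _} {frac n′ d′ C′} {frac n″ d″ _} (scaled E T CE e) (scaled F S CF f) =
      scaled (E * F * d′) (F * d″ * T + E * d * S) (Comax-* (Comax-* CE CF) C′) (begin
      E * F * d′ * (n * d″ - n″ * d)
        ≈⟨ solve 8 (λ E F n d n′ d′ n″ d″ → E :* F :* d′ :* (n :* d″ :- n″ :* d)
             := F :* d″ :* (E :* (n :* d′ :- n′ :* d)) :+ E :* d :* (F :* (n′ :* d″ :- n″ :* d′))) refl E F n d n′ d′ n″ d″ ⟩
      F * d″ * (E * (n * d′ - n′ * d)) + E * d * (F * (n′ * d″ - n″ * d′)) ≈⟨ +-cong (*-congˡ e) (*-congˡ f) ⟩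
      F * d″ * (P * T) + E * d * (P * S)
        ≈⟨ solve 7 (λ E F d d″ P T S → F :* d″ :* (P :* T) :+ E :* d :* (P :* S) := P :* (F :* d″ :* T :+ E :* d :* S)) refl E F d d″ P T S ⟩
      P * (F * d″ * T + E * d * S) ∎)

    infixl 7 _⊠_
    infixl 6 _⊞_
    _⊞_ _⊠_ : Fraction → Fraction → Fraction
    frac n d C ⊞ frac n′ d′ C′ = frac (n * d′ + n′ * d) (d * d′) (Comax-* C C′)
    frac n d C ⊠ frac n′ d′ C′ = frac (n * n′) (d * d′) (Comax-* C C′)

    ⊟_ : Fraction → Fraction
    ⊟ frac n d C = frac (- n) d C

    ι : Carrier → Fraction
    ι x = frac x 1# 1-comax

    ⊞-congʳ : ∀ z {x y} → x ≃ y → x ⊞ z ≃ y ⊞ z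
    ⊞-congʳ (frac m c _) {frac n d _} {frac n′ d′ _} (scaled E T CE e) = scaled E (c * c * T) CE (begin
      E * ((n * c + m * d) * (d′ * c) - (n′ * c + m * d′) * (d * c))
        ≈⟨ solve 7 (λ E m c n d n′ d′ → E :* ((n :* c :+ m :* d) :* (d′ :* c) :- (n′ :* c :+ m :* d′) :* (d :* c))
             := c :* c :* (E :* (n :* d′ :- n′ :* d))) refl E m c n d n′ d′ ⟩
      c * c * (E * (n * d′ - n′ * d)) ≈⟨ *-congˡ e ⟩
      c * c * (P * T) ≈⟨ solve 3 (λ c P T → c :* c :* (P :* T) := P :* (c :* c :* T)) refl c P T ⟩
      P * (c * c * T) ∎)

    ⊠-congʳ : ∀ z {x y} → x ≃ y → x ⊠ z ≃ y ⊠ z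
    ⊠-congʳ (frac m c _) {frac n d _} {frac n′ d′ _} (scaled E T CE e) = scaled E (m * c * T) CE (begin
      E * ((n * m) * (d′ * c) - (n′ * m) * (d * c))
        ≈⟨ solve 7 (λ E m c n d n′ d′ → E :* ((n :* m) :* (d′ :* c) :- (n′ :* m) :* (d :* c))
             := m :* c :* (E :* (n :* d′ :- n′ :* d))) refl E m c n d n′ d′ ⟩
      m * c * (E * (n * d′ - n′ * d)) ≈⟨ *-congˡ e ⟩
      m * c * (P * T) ≈⟨ solve 4 (λ m c P T → m :* c :* (P :* T) := P :* (m :* c :* T)) refl m c P T ⟩
      P * (m * c * T) ∎)

    ⊞-comm : ∀ x y → x ⊞ y ≃ y ⊞ x
    ⊞-comm (frac n d _) (frac n′ d′ _) = cross⇒≃ (solve 4 (λ n d n′ d′ →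
      (n :* d′ :+ n′ :* d) :* (d′ :* d) := (n′ :* d :+ n :* d′) :* (d :* d′)) refl n d n′ d′)

    ⊠-comm : ∀ x y → x ⊠ y ≃ y ⊠ x
    ⊠-comm (frac n d _) (frac n′ d′ _) = cross⇒≃ (solve 4 (λ n d n′ d′ →
      (n :* n′) :* (d′ :* d) := (n′ :* n) :* (d :* d′)) refl n d n′ d′)

    ⊟-cong : ∀ {x y} → x ≃ y → ⊟ x ≃ ⊟ y
    ⊟-cong {frac n d _} {frac n′ d′ _} (scaled E T CE e) = scaled E (- T) CE (begin
      E * (- n * d′ - - n′ * d) ≈⟨ solve 5 (λ E n d n′ d′ → E :* (:- n :* d′ :- :- n′ :* d) := :- (E :* (n :* d′ :- n′ :* d))) refl E n d n′ d′ ⟩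
      - (E * (n * d′ - n′ * d)) ≈⟨ -‿cong e ⟩
      - (P * T) ≈⟨ solve 2 (λ P T → :- (P :* T) := P :* :- T) refl P T ⟩
      P * - T ∎)

    ⊞-cong : ∀ {x y z t} → x ≃ y → z ≃ t → x ⊞ z ≃ y ⊞ t
    ⊞-cong {x} {y} {z} {t} e f = ≃-trans (⊞-congʳ z e) (≃-trans (⊞-comm y z) (≃-trans (⊞-congʳ y f) (⊞-comm t y)))

    ⊠-cong : ∀ {x y z t} → x ≃ y → z ≃ t → x ⊠ z ≃ y ⊠ t
    ⊠-cong {x} {y} {z} {t} e f = ≃-trans (⊠-congʳ z e) (≃-trans (⊠-comm y z) (≃-trans (⊠-congʳ y f) (⊠-comm t y)))

    ⊞-assoc : ∀ x y z → (x ⊞ y) ⊞ z ≃ x ⊞ (y ⊞ z)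
    ⊞-assoc (frac n d _) (frac n′ d′ _) (frac n″ d″ _) = cross⇒≃ (solve 6 (λ n d n′ d′ n″ d″ →
      ((n :* d′ :+ n′ :* d) :* d″ :+ n″ :* (d :* d′)) :* (d :* (d′ :* d″))
      := (n :* (d′ :* d″) :+ (n′ :* d″ :+ n″ :* d′) :* d) :* (d :* d′ :* d″)) refl n d n′ d′ n″ d″)

    ⊠-assoc : ∀ x y z → (x ⊠ y) ⊠ z ≃ x ⊠ (y ⊠ z)
    ⊠-assoc (frac n d _) (frac n′ d′ _) (frac n″ d″ _) = cross⇒≃ (solve 6 (λ n d n′ d′ n″ d″ →
      (n :* n′ :* n″) :* (d :* (d′ :* d″)) := (n :* (n′ :* n″)) :* (d :* d′ :* d″)) refl n d n′ d′ n″ d″)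

    ⊞-identityˡ : ∀ x → ι 0# ⊞ x ≃ x
    ⊞-identityˡ (frac n d _) = cross⇒≃ (solve 2 (λ n d → (con (+ 0) :* d :+ n :* con (+ 1)) :* d := n :* (con (+ 1) :* d)) refl n d)

    ⊠-identityˡ : ∀ x → ι 1# ⊠ x ≃ x
    ⊠-identityˡ (frac n d _) = cross⇒≃ (solve 2 (λ n d → (con (+ 1) :* n) :* d := n :* (con (+ 1) :* d)) refl n d)

    ⊟-inverseˡ : ∀ x → (⊟ x) ⊞ x ≃ ι 0#
    ⊟-inverseˡ (frac n d _) = cross⇒≃ (solve 2 (λ n d → (:- n :* d :+ n :* d) :* con (+ 1) := con (+ 0) :* (d :* d)) refl n d)

    ⊠-distribˡ : ∀ x y z → x ⊠ (y ⊞ z) ≃ (x ⊠ y) ⊞ (x ⊠ z)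
    ⊠-distribˡ (frac n d _) (frac n′ d′ _) (frac n″ d″ _) = cross⇒≃ (solve 6 (λ n d n′ d′ n″ d″ →
      (n :* (n′ :* d″ :+ n″ :* d′)) :* ((d :* d′) :* (d :* d″))
      := (n :* n′ :* (d :* d″) :+ n :* n″ :* (d :* d′)) :* (d :* (d′ :* d″))) refl n d n′ d′ n″ d″)

    ≃-refl : ∀ {x} → x ≃ x
    ≃-refl = cross⇒≃ refl

    ⊞-identityʳ : ∀ x → x ⊞ ι 0# ≃ x
    ⊞-identityʳ x = ≃-trans (⊞-comm x (ι 0#)) (⊞-identityˡ x)

    ⊠-identityʳ : ∀ x → x ⊠ ι 1# ≃ x
    ⊠-identityʳ x = ≃-trans (⊠-comm x (ι 1#)) (⊠-identityˡ x)

    ⊟-inverseʳ : ∀ x → x ⊞ (⊟ x) ≃ ι 0#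
    ⊟-inverseʳ x = ≃-trans (⊞-comm x (⊟ x)) (⊟-inverseˡ x)

    ⊠-distribʳ : ∀ x y z → (y ⊞ z) ⊠ x ≃ (y ⊠ x) ⊞ (z ⊠ x)
    ⊠-distribʳ x y z = ≃-trans (⊠-comm (y ⊞ z) x) (≃-trans (⊠-distribˡ x y z)
      (⊞-cong (⊠-comm x y) (⊠-comm x z)))

    localization : CommutativeRing 0ℓ 0ℓ
    localization = record
      { Carrier = Fraction ; _≈_ = _≃_ ; _+_ = _⊞_ ; _*_ = _⊠_ ; -_ = ⊟_ ; 0# = ι 0# ; 1# = ι 1#
      ; isCommutativeRing = record
        { isRing = record
          { +-isAbelianGroup = record
            { isGroup = record
              { isMonoid = record
                { isSemigroup = record
                  { isMagma = record
                    { isEquivalence = record { refl = ≃-refl ; sym = ≃-sym ; trans = ≃-trans }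
                    ; ∙-cong = ⊞-cong }
                  ; assoc = ⊞-assoc }
                ; identity = ⊞-identityˡ , ⊞-identityʳ }
              ; inverse = ⊟-inverseˡ , ⊟-inverseʳ
              ; ⁻¹-cong = ⊟-cong }
            ; comm = ⊞-comm }
          ; *-cong = ⊠-cong
          ; *-assoc = ⊠-assoc
          ; *-identity = ⊠-identityˡ , ⊠-identityʳ
          ; distrib = ⊠-distribˡ , ⊠-distribʳ
          }
        ; *-comm = ⊠-comm
        }
      }

  -- A homomorphism ι to a ring in which P vanishes and elements comaximal with P are invertible;
  -- Represents n d x says that the fraction n / d makes sense there and equals x.
  record Evaluation (P : Carrier) : Set₁ where
    field
      A : CommutativeRing 0ℓ 0ℓ
    module A = RingTools A
    field
      ι : Carrier → A.Carrier
      ι-cong : ∀ {x y} → x ≈ y → ι x A.≈ ι y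
      ι-+ : ∀ x y → ι (x + y) A.≈ ι x A.+ ι y
      ι-* : ∀ x y → ι (x * y) A.≈ ι x A.* ι y
      ι-neg : ∀ x → ι (- x) A.≈ A.- ι x
      ι-1 : ι 1# A.≈ A.1#
      ι-0 : ∀ T → ι (P * T) A.≈ A.0#
      ι-Unit : ∀ {x} → Comax x P → A.Unit (ι x)
      Represents : Carrier → Carrier → A.Carrier → Set
      Represents-resp : ∀ {n d n′ d′ x y} → n ≈ n′ → d ≈ d′ → x A.≈ y → Represents n d x → Represents n′ d′ y
      Represents-+ : ∀ {n d n′ d′ x y} → Represents n d x → Represents n′ d′ y → Represents (n * d′ + n′ * d) (d * d′) (x A.+ y)
      Represents-* : ∀ {n d n′ d′ x y} → Represents n d x → Represents n′ d′ y → Represents (n * n′) (d * d′) (x A.* y)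
      Represents-ι : ∀ x → Represents x 1# (ι x)
      Represents-inverse : ∀ {x} (C : Comax x P) → Represents 1# x (proj₁ (ι-Unit C))
      Represents-scale : ∀ c {n d x} → Represents n d x → Represents (c * n) (c * d) x
      Represents-0 : Represents 0# 1# A.0#
      Represents-0⇒Multiple : ∀ {n d} → Represents n d A.0# → Multiple n d P

  module _ (Const-1 : Const 1#) (P : Carrier) where
    open Localize Const-1 P

    private
      -- The denominator d need not be comaximal with P: n / d only has to be proportional to an
      -- admissible fraction, so n and d may share a factor that vanishes modulo P.
      Rep : Carrier → Carrier → Fraction → Set
      Rep n d x = ∃ λ y → y ≃ x × n * bottom y ≈ top y * d

      Rep-+ : ∀ {n d n′ d′ x y} → Rep n d x → Rep n′ d′ y → Rep (n * d′ + n′ * d) (d * d′) (x ⊞ y)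
      Rep-+ {n} {d} {n′} {d′} (y@(frac N D C) , e , f) (y′@(frac N′ D′ C′) , e′ , f′) = y ⊞ y′ , ⊞-cong e e′ , (begin
        (n * d′ + n′ * d) * (D * D′) ≈⟨ solve 6 (λ n d n′ d′ D D′ → (n :* d′ :+ n′ :* d) :* (D :* D′) := (n :* D) :* (d′ :* D′) :+ (n′ :* D′) :* (d :* D)) refl n d n′ d′ D D′ ⟩
        (n * D) * (d′ * D′) + (n′ * D′) * (d * D) ≈⟨ +-cong (*-congʳ f) (*-congʳ f′) ⟩
        (N * d) * (d′ * D′) + (N′ * d′) * (d * D) ≈⟨ solve 6 (λ N d N′ d′ D D′ → (N :* d) :* (d′ :* D′) :+ (N′ :* d′) :* (d :* D) := (N :* D′ :+ N′ :* D) :* (d :* d′)) refl N d N′ d′ D D′ ⟩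
        (N * D′ + N′ * D) * (d * d′) ∎)

      Rep-* : ∀ {n d n′ d′ x y} → Rep n d x → Rep n′ d′ y → Rep (n * n′) (d * d′) (x ⊠ y)
      Rep-* {n} {d} {n′} {d′} (y@(frac N D C) , e , f) (y′@(frac N′ D′ C′) , e′ , f′) = y ⊠ y′ , ⊠-cong e e′ , (begin
        (n * n′) * (D * D′) ≈⟨ solve 4 (λ n n′ D D′ → (n :* n′) :* (D :* D′) := (n :* D) :* (n′ :* D′)) refl n n′ D D′ ⟩
        (n * D) * (n′ * D′) ≈⟨ *-cong f f′ ⟩
        (N * d) * (N′ * d′) ≈⟨ solve 4 (λ N d N′ d′ → (N :* d) :* (N′ :* d′) := (N :* N′) :* (d :* d′)) refl N d N′ d′ ⟩
        (N * N′) * (d * d′) ∎)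

      Rep-resp : ∀ {n d n′ d′ x y} → n ≈ n′ → d ≈ d′ → x ≃ y → Rep n d x → Rep n′ d′ y
      Rep-resp n≈ d≈ x≃y (z , e , f) = z , ≃-trans e x≃y , trans (*-congʳ (sym n≈)) (trans f (*-congˡ d≈))

      Rep-0⇒Multiple : ∀ {n d} → Rep n d (ι 0#) → Multiple n d P
      Rep-0⇒Multiple {n} {d} (frac N D C , scaled E T CE e , f) = D * E , Comax-* C CE , T , (begin
        n * (D * E) ≈⟨ *-assoc _ _ _ ⟨
        n * D * E ≈⟨ *-congʳ f ⟩
        N * d * E ≈⟨ solve 4 (λ N d E D → N :* d :* E := (E :* (N :* con (+ 1) :- con (+ 0) :* D)) :* d) refl N d E D ⟩
        (E * (N * 1# - 0# * D)) * d ≈⟨ *-congʳ e ⟩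
        P * T * d ∎)

      ι-+ : ∀ x y → ι (x + y) ≃ ι x ⊞ ι y
      ι-+ x y = cross⇒≃ (solve 2 (λ x y → (x :+ y) :* (con (+ 1) :* con (+ 1)) := (x :* con (+ 1) :+ y :* con (+ 1)) :* con (+ 1)) refl x y)

      ι-* : ∀ x y → ι (x * y) ≃ ι x ⊠ ι y
      ι-* x y = cross⇒≃ (solve 2 (λ x y → (x :* y) :* (con (+ 1) :* con (+ 1)) := (x :* y) :* con (+ 1)) refl x y)

      ι-0 : ∀ T → ι (P * T) ≃ ι 0#
      ι-0 T = scaled 1# T 1-comax (solve 1 (λ x → con (+ 1) :* (x :* con (+ 1) :- con (+ 0) :* con (+ 1)) := x) refl (P * T))

      ι-inverse : ∀ {x} → Comax x P → Σ Fraction λ y → ι x ⊠ y ≃ ι 1#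
      ι-inverse {x} C = frac 1# x C , cross⇒≃ (solve 1 (λ x → (x :* con (+ 1)) :* con (+ 1) := con (+ 1) :* (con (+ 1) :* x)) refl x)

      Rep-scale : ∀ c {n d x} → Rep n d x → Rep (c * n) (c * d) x
      Rep-scale c (y , e , f) = y , e , trans (*-assoc c _ _) (trans (*-congˡ f) (solve 3 (λ c N d → c :* (N :* d) := N :* (c :* d)) refl c _ _))

    evaluation : Evaluation P
    evaluation = record
      { A = localization ; ι = ι ; ι-cong = λ e → cross⇒≃ (*-congʳ e) ; ι-+ = ι-+ ; ι-* = ι-*
      ; ι-neg = λ _ → ≃-refl ; ι-1 = ≃-refl ; ι-0 = ι-0 ; ι-Unit = ι-inverse
      ; Represents = Rep ; Represents-resp = Rep-resp ; Represents-+ = Rep-+ ; Represents-* = Rep-*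
      ; Represents-ι = λ x → ι x , ≃-refl , refl
      ; Represents-inverse = λ {x} C → frac 1# x C , ≃-refl , refl
      ; Represents-scale = Rep-scale
      ; Represents-0 = ι 0# , ≃-refl , refl
      ; Represents-0⇒Multiple = Rep-0⇒Multiple }

-- Cyclotomic factors and Bézout identities for binomials in q

record Ground (R : CommutativeRing 0ℓ 0ℓ) : Set₁ where
  open RingTools R
  field
    q a b : Carrier
    Const : Carrier → Set
    Const-* : ∀ {x y} → Const x → Const y → Const (x * y)
    Const-nat : ∀ n → Const (nat (suc n))
    Const-1-a^ : ∀ n → Const (1# - a ^ suc n)
    Const-a^-1 : ∀ n → Const (a ^ suc n - 1#)
    Const-1-b^ : ∀ n → Const (1# - b ^ suc n)
    Const-b^-1 : ∀ n → Const (b ^ suc n - 1#)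
    1-q^-cancel : ∀ g → 0 < g → ∀ {x y} → (1# - q ^ g) * x ≈ (1# - q ^ g) * y → x ≈ y

module CyclotomicFactors (R : CommutativeRing 0ℓ 0ℓ) (ground : Ground R) where
  open RingTools R
  open Ground ground public
  open Factors R public
  open Comaximality R Const Const-* public

  1-x^n≈ : ∀ x n → 1# - x ^ n ≈ (1# - x) * sum (x ^_) n
  1-x^n≈ x n = sym (geometric x n)

  -- Source of the positive integers that serve as Bézout constants.
  sum-mod-1-x : ∀ x n → ∃ λ B → sum (x ^_) n ≈ nat n + (1# - x) * B
  sum-mod-1-x x zero = 0# , solve 1 (λ y → con (+ 0) := con (+ 0) :+ y :* con (+ 0)) refl (1# - x)
  sum-mod-1-x x (suc n) = let B , e = sum-mod-1-x x n in B - sum (x ^_) n , (begin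
    sum (x ^_) n + x ^ n ≈⟨ +-cong e (solve 1 (λ y → y := con (+ 1) :- (con (+ 1) :- y)) refl (x ^ n)) ⟩
    nat n + (1# - x) * B + (1# - (1# - x ^ n)) ≈⟨ +-congˡ (+-congˡ (-‿cong (1-x^n≈ x n))) ⟩
    nat n + (1# - x) * B + (1# - (1# - x) * sum (x ^_) n)
      ≈⟨ solve 4 (λ k y B s → k :+ y :* B :+ (con (+ 1) :- y :* s) := (con (+ 1) :+ k) :+ y :* (B :- s)) refl (nat n) (1# - x) B _ ⟩
    (1# + nat n) + (1# - x) * (B - sum (x ^_) n) ≈⟨ +-congʳ (nat-suc n) ⟨
    nat (suc n) + (1# - x) * (B - sum (x ^_) n) ∎)

  power-difference : ∀ c z n → ∃ λ T → c ^ n - z ^ n ≈ (c - z) * T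
  power-difference c z zero = 0# , trans (-‿inverseʳ 1#) (sym (zeroʳ _))
  power-difference c z (suc n) = let T , e = power-difference c z n in c * T + z ^ n , (begin
    c * c ^ n - z * z ^ n ≈⟨ solve 4 (λ c z x y → c :* x :- z :* y := c :* (x :- y) :+ (c :- z) :* y) refl c z _ _ ⟩
    c * (c ^ n - z ^ n) + (c - z) * z ^ n ≈⟨ +-congʳ (*-congˡ e) ⟩
    c * ((c - z) * T) + (c - z) * z ^ n ≈⟨ solve 4 (λ c z T y → c :* ((c :- z) :* T) :+ (c :- z) :* y := (c :- z) :* (c :* T :+ y)) refl c z T _ ⟩
    (c - z) * (c * T + z ^ n) ∎)

  Comax-1-cq^ : ∀ {c} m i → Const (1# - c ^ m) → Comax (1# - c * q ^ i) (1# - q ^ m)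
  Comax-1-cq^ {c} m i C = sum ((c * q ^ i) ^_) m , - (c ^ m * sum ((q ^ m) ^_) i) , 1# - c ^ m , C , (begin
    sum ((c * q ^ i) ^_) m * (1# - c * q ^ i) + - (c ^ m * sum ((q ^ m) ^_) i) * (1# - q ^ m)
      ≈⟨ solve 5 (λ s y C t z → s :* y :+ :- (C :* t) :* z := y :* s :- C :* (z :* t)) refl _ _ _ _ _ ⟩
    (1# - c * q ^ i) * sum ((c * q ^ i) ^_) m - c ^ m * ((1# - q ^ m) * sum ((q ^ m) ^_) i)
      ≈⟨ +-cong (geometric _ m) (-‿cong (*-congˡ (trans (geometric _ i) (+-congˡ (-‿cong (^-swap q m i)))))) ⟩
    (1# - (c * q ^ i) ^ m) - c ^ m * (1# - (q ^ i) ^ m) ≈⟨ +-congʳ (+-congˡ (-‿cong (^-distrib-* c (q ^ i) m))) ⟩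
    (1# - c ^ m * (q ^ i) ^ m) - c ^ m * (1# - (q ^ i) ^ m)
      ≈⟨ solve 2 (λ C z → (con (+ 1) :- C :* z) :- C :* (con (+ 1) :- z) := con (+ 1) :- C) refl _ _ ⟩
    1# - c ^ m ∎)

  -- Modulo c - q^i the power c^m equals (q^i)^m, which is 1 modulo 1 - q^m; hence c^m - 1 is a
  -- combination of the two.
  Comax-c-q^ : ∀ {c} m i → Const (c ^ m - 1#) → Comax (c - q ^ i) (1# - q ^ m)
  Comax-c-q^ {c} m i C = let T , e = power-difference c (q ^ i) m in T , - sum ((q ^ m) ^_) i , c ^ m - 1# , C , (begin
    T * (c - q ^ i) + - sum ((q ^ m) ^_) i * (1# - q ^ m)
      ≈⟨ solve 4 (λ T y s z → T :* y :+ :- s :* z := y :* T :- z :* s) refl _ _ _ _ ⟩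
    (c - q ^ i) * T - (1# - q ^ m) * sum ((q ^ m) ^_) i
      ≈⟨ +-cong (sym e) (-‿cong (trans (geometric _ i) (+-congˡ (-‿cong (^-swap q m i))))) ⟩
    (c ^ m - (q ^ i) ^ m) - (1# - (q ^ i) ^ m) ≈⟨ solve 2 (λ C z → (C :- z) :- (con (+ 1) :- z) := C :- con (+ 1)) refl _ _ ⟩
    c ^ m - 1# ∎)

  -- The part of h that stays invertible at every power of q, because a and b are indeterminates.
  regular : Carrier → Carrier
  regular z = linearPair a z * linearPair b z

  h : Carrier → Carrier
  h = factor a b

  -- `proper` expresses that the roots of Φ are primitive: Φ divides (1 - q^m) / (1 - q^g) for every
  -- proper divisor g of m, a quotient congruent to m / g modulo 1 - q^g.
  record CyclotomicFactor (m : ℕ) (Φ : Carrier) : Set where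
    field
      cofactor : Carrier
      1-q^m≈ : 1# - q ^ m ≈ Φ * cofactor
      proper : ∀ g t → g ℕ.* t ≡ m → 0 < g → 1 < t → ∃ λ T → 1# - q ^ m ≈ (1# - q ^ g) * (Φ * T)

  module _ {m′ : ℕ} {Φ : Carrier} (cyc : CyclotomicFactor (suc m′) Φ) where
    open CyclotomicFactor cyc
    private
      m = suc m′

    Comax-regular : ∀ i → Comax (regular (q ^ i)) Φ
    Comax-regular i = Comax-divisorʳ 1-q^m≈ (Comax-*
      (Comax-* (Comax-1-cq^ m i (Const-1-a^ m′)) (Comax-c-q^ m i (Const-a^-1 m′)))
      (Comax-* (Comax-1-cq^ m i (Const-1-b^ m′)) (Comax-c-q^ m i (Const-b^-1 m′))))

    Comax-q : Comax q Φ
    Comax-q = Comax-divisorʳ 1-q^m≈ (q ^ m′ , 1# , nat 1 , Const-nat 0 ,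
      solve 2 (λ q x → x :* q :+ con (+ 1) :* (con (+ 1) :- q :* x) := con (+ 1)) refl q (q ^ m′))

    Comax-q-number : ∀ y → Comax (sum ((q ^ m) ^_) (suc y)) Φ
    Comax-q-number y = let B , e = sum-mod-1-x (q ^ m) (suc y) in Comax-divisorʳ 1-q^m≈
      (1# , - B , nat (suc y) , Const-nat y , trans (+-congʳ (trans (*-identityˡ _) e))
        (solve 3 (λ n z B → n :+ z :* B :+ :- B :* z := n) refl _ _ B))

    private
      bézout : ∀ i x y → gcd m i ℕ.+ y ℕ.* i ≡ x ℕ.* m →
        1# - q ^ gcd m i ≈ sum ((q ^ m) ^_) x * (1# - q ^ m) + - (q ^ gcd m i * sum ((q ^ i) ^_) y) * (1# - q ^ i)
      bézout i x y e = sym (begin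
        sum ((q ^ m) ^_) x * (1# - q ^ m) + - (G * sum ((q ^ i) ^_) y) * (1# - q ^ i)
          ≈⟨ solve 5 (λ s z G t w → s :* z :+ :- (G :* t) :* w := z :* s :- G :* (w :* t)) refl _ _ _ _ _ ⟩
        (1# - q ^ m) * sum ((q ^ m) ^_) x - G * ((1# - q ^ i) * sum ((q ^ i) ^_) y)
          ≈⟨ +-cong (geometric _ x) (-‿cong (*-congˡ (geometric _ y))) ⟩
        (1# - (q ^ m) ^ x) - G * (1# - (q ^ i) ^ y) ≈⟨ +-congʳ (+-congˡ (-‿cong (begin
          (q ^ m) ^ x ≈⟨ ^-assocʳ q m x ⟩
          q ^ (m ℕ.* x) ≈⟨ ^-congʳ q (≡.trans (ℕP.*-comm m x) (≡.sym e)) ⟩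
          q ^ (gcd m i ℕ.+ y ℕ.* i) ≈⟨ ^-homo-* q (gcd m i) (y ℕ.* i) ⟩
          G * q ^ (y ℕ.* i) ≈⟨ *-congˡ (trans (^-congʳ q (ℕP.*-comm y i)) (sym (^-assocʳ q i y))) ⟩
          G * (q ^ i) ^ y ∎))) ⟩
        (1# - G * (q ^ i) ^ y) - G * (1# - (q ^ i) ^ y) ≈⟨ solve 2 (λ G z → (con (+ 1) :- G :* z) :- G :* (con (+ 1) :- z) := con (+ 1) :- G) refl _ _ ⟩
        1# - G ∎)
        where G = q ^ gcd m i

      bézout′ : ∀ i x y → gcd m i ℕ.+ x ℕ.* m ≡ y ℕ.* i →
        1# - q ^ gcd m i ≈ - (q ^ gcd m i * sum ((q ^ m) ^_) x) * (1# - q ^ m) + sum ((q ^ i) ^_) y * (1# - q ^ i)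
      bézout′ i x y e = sym (begin
        - (G * sum ((q ^ m) ^_) x) * (1# - q ^ m) + sum ((q ^ i) ^_) y * (1# - q ^ i)
          ≈⟨ solve 5 (λ s z G t w → :- (G :* t) :* w :+ s :* z := z :* s :- G :* (w :* t)) refl _ _ _ _ _ ⟩
        (1# - q ^ i) * sum ((q ^ i) ^_) y - G * ((1# - q ^ m) * sum ((q ^ m) ^_) x)
          ≈⟨ +-cong (geometric _ y) (-‿cong (*-congˡ (geometric _ x))) ⟩
        (1# - (q ^ i) ^ y) - G * (1# - (q ^ m) ^ x) ≈⟨ +-congʳ (+-congˡ (-‿cong (begin
          (q ^ i) ^ y ≈⟨ ^-assocʳ q i y ⟩
          q ^ (i ℕ.* y) ≈⟨ ^-congʳ q (≡.trans (ℕP.*-comm i y) (≡.sym e)) ⟩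
          q ^ (gcd m i ℕ.+ x ℕ.* m) ≈⟨ ^-homo-* q (gcd m i) (x ℕ.* m) ⟩
          G * q ^ (x ℕ.* m) ≈⟨ *-congˡ (trans (^-congʳ q (ℕP.*-comm x m)) (sym (^-assocʳ q m x))) ⟩
          G * (q ^ m) ^ x ∎))) ⟩
        (1# - G * (q ^ m) ^ x) - G * (1# - (q ^ m) ^ x) ≈⟨ solve 2 (λ G z → (con (+ 1) :- G :* z) :- G :* (con (+ 1) :- z) := con (+ 1) :- G) refl _ _ ⟩
        1# - G ∎)
        where G = q ^ gcd m i

      -- The Euclidean algorithm on exponents carries over to binomials; Bézout over ℕ comes with
      -- either sign, hence the two cases.
      gcd-combination : ∀ i → ∃ λ α → ∃ λ β → 1# - q ^ gcd m i ≈ α * (1# - q ^ m) + β * (1# - q ^ i)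
      gcd-combination i with Bézout.identity (gcd-GCD m i)
      ... | Bézout.+- x y e = _ , _ , bézout i x y e
      ... | Bézout.-+ x y e = _ , _ , bézout′ i x y e

      -- nat t ≈ Φ T − (1 − q^g) B, where Φ T = (1 − q^m) / (1 − q^g) and 1 − q^g is a combination of 1 − q^m and 1 − q^i.
      comax-from-gcd : ∀ i g t → g ℕ.* suc t ≡ m → 0 < g → 1 < suc t →
        (∃ λ α → ∃ λ β → 1# - q ^ g ≈ α * (1# - q ^ m) + β * (1# - q ^ i)) → Comax (1# - q ^ i) Φ
      comax-from-gcd i g t gt≡m 0<g 1<t (α , β , e) = - (B * β) , T - B * (α * cofactor) , nat (suc t) , Const-nat t , (begin
        - (B * β) * (1# - q ^ i) + (T - B * (α * cofactor)) * Φ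
          ≈⟨ solve 7 (λ B β y T α c Φ → :- (B :* β) :* y :+ (T :- B :* (α :* c)) :* Φ := Φ :* T :- B :* (α :* (Φ :* c) :+ β :* y)) refl B β (1# - q ^ i) T α cofactor Φ ⟩
        Φ * T - B * (α * (Φ * cofactor) + β * (1# - q ^ i)) ≈⟨ +-congˡ (-‿cong (*-congˡ (trans (+-congʳ (*-congˡ (sym 1-q^m≈))) (sym e)))) ⟩
        Φ * T - B * (1# - q ^ g) ≈⟨ +-congʳ (trans (sym E≈ΦT) (proj₂ B-eq)) ⟩
        nat (suc t) + (1# - q ^ g) * B - B * (1# - q ^ g) ≈⟨ solve 3 (λ n z B → n :+ z :* B :- B :* z := n) refl _ _ B ⟩
        nat (suc t) ∎)
        where
        B-eq = sum-mod-1-x (q ^ g) (suc t)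
        T-eq = proper g (suc t) gt≡m 0<g 1<t
        B T : Carrier
        B = proj₁ B-eq
        T = proj₁ T-eq
        E≈ΦT : sum ((q ^ g) ^_) (suc t) ≈ Φ * T
        E≈ΦT = 1-q^-cancel g 0<g (trans (geometric _ (suc t)) (trans (+-congˡ (-‿cong (trans (^-assocʳ q g (suc t)) (^-congʳ q gt≡m)))) (proj₂ T-eq)))

      comax-from-quotient : ∀ i → ¬ m ∣ i → ∀ t → m ≡ t ℕ.* gcd m i → Comax (1# - q ^ i) Φ
      comax-from-quotient i m∤i zero ()
      comax-from-quotient i m∤i (suc zero) e =
        contradiction (≡.subst (_∣ i) (≡.sym (≡.trans e (ℕP.*-identityˡ _))) (gcd[m,n]∣n m i)) m∤i
      comax-from-quotient i m∤i (suc (suc t)) e =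
        comax-from-gcd i (gcd m i) (suc t) gt≡m (ℕP.n≢0⇒n>0 g≢0) (s≤s (s≤s z≤n)) (gcd-combination i)
        where
        gt≡m : gcd m i ℕ.* suc (suc t) ≡ m
        gt≡m = ≡.trans (ℕP.*-comm (gcd m i) _) (≡.sym e)
        g≢0 : ¬ gcd m i ≡ 0
        g≢0 g≡0 = ℕP.0≢1+n (≡.trans (≡.cong (ℕ._* suc (suc t)) (≡.sym g≡0)) gt≡m)

    Comax-1-q^ : ∀ i → ¬ m ∣ i → Comax (1# - q ^ i) Φ
    Comax-1-q^ i m∤i = comax-from-quotient i m∤i (_∣_.quotient (gcd[m,n]∣m m i)) (_∣_.equality (gcd[m,n]∣m m i))

    Comax-h : ∀ i → ¬ m ∣ i → Comax (h (q ^ i)) Φ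
    Comax-h i m∤i = Comax-* (Comax-regular i)
      (Comax-* (Comax-resp (+-congˡ (-‿cong (sym (*-identityˡ _)))) (Comax-1-q^ i m∤i)) (Comax-1-q^ i m∤i))

-- Blocks of consecutive terms, evaluated in a localization

module Summation (R : CommutativeRing 0ℓ 0ℓ) (ground : Ground R) (d : ℕ) (3≤d : 3 ≤ d) where
  open RingTools R
  open CyclotomicFactors R ground public

  -- Pochhammer products with the powers of a and b cleared. Sums are accumulated without reduction,
  -- as `sumF` does, so that the two differ by a common factor only.
  upper lower termNum termDen sumNum sumDen : ℕ → Carrier
  upper = prod λ j → h (q ^ suc (d ℕ.* j))
  lower = prod λ j → h (q ^ (d ℕ.* suc j))
  termNum k = (1# - q ^ (2 ℕ.* d ℕ.* k ℕ.+ 1)) * upper k * q ^ ((2 ℕ.* d ∸ 3) ℕ.* k)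
  termDen k = (1# - q) * lower k
  sumNum zero = 0#
  sumNum (suc k) = sumNum k * termDen k + termNum k * sumDen k
  sumDen zero = 1#
  sumDen (suc k) = sumDen k * termDen k

  Comax-^ : ∀ {x P} → Comax x P → ∀ n → Comax (x ^ n) P
  Comax-^ C zero = Comax-const (Const-nat 0)
  Comax-^ C (suc n) = Comax-* C (Comax-^ C n)

  module Local {P : Carrier} (evaluation : Evaluation P) where
    open Evaluation evaluation public
    open A using () renaming (_≈_ to _≃_; _*_ to _⊠_; trans to ≃-trans; sym to ≃-sym; refl to ≃-refl; *-cong to ⊠-cong)
    module FA = Factors A

    ι-sub : ∀ x y → ι (x - y) ≃ ι x A.- ι y
    ι-sub x y = ≃-trans (ι-+ x (- y)) (A.+-congˡ (ι-neg y))

    ι-^ : ∀ x n → ι x A.^ n ≃ ι (x ^ n)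
    ι-^ x zero = ≃-sym ι-1
    ι-^ x (suc n) = ≃-trans (A.*-congˡ (ι-^ x n)) (≃-sym (ι-* x (x ^ n)))

    ι-linearPair : ∀ c z → ι (linearPair c z) ≃ FA.linearPair (ι c) (ι z)
    ι-linearPair c z = ≃-trans (ι-* _ _) (⊠-cong (≃-trans (ι-sub _ _) (A.+-cong ι-1 (A.-‿cong (ι-* c z)))) (ι-sub c z))

    hA : A.Carrier → A.Carrier
    hA = FA.factor (ι a) (ι b)

    hA-cong : ∀ {x y} → x ≃ y → hA x ≃ hA y
    hA-cong = FA.factor-cong ≃-refl ≃-refl

    ι-h : ∀ z → ι (h z) ≃ hA (ι z)
    ι-h z = ≃-trans (ι-* _ _) (⊠-cong (≃-trans (ι-* _ _) (⊠-cong (ι-linearPair a z) (ι-linearPair b z)))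
      (≃-trans (ι-linearPair 1# z) (FA.linearPair-cong ι-1 ≃-refl)))

    2-Unit : A.Unit (A.1# A.+ A.1#)
    2-Unit = A.Unit-resp (≃-trans (ι-+ 1# 1#) (A.+-cong ι-1 ι-1)) (ι-Unit (Comax-const (Const-nat 1)))

    E : ℕ → A.Carrier
    E k = ι (q ^ k)

    E-cong : ∀ {i j} → i ≡ j → E i ≃ E j
    E-cong ≡.refl = ≃-refl

    E-+ : ∀ i j → E (i ℕ.+ j) ≃ E i ⊠ E j
    E-+ i j = ≃-trans (ι-cong (^-homo-* q i j)) (ι-* _ _)

    E-* : ∀ i j → E i A.^ j ≃ E (i ℕ.* j)
    E-* i j = ≃-trans (ι-^ _ j) (ι-cong (^-assocʳ q i j))

    E-suc : ∀ i → E (suc i) ≃ ι q ⊠ E i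
    E-suc i = ι-* q (q ^ i)

    Q : A.Carrier
    Q = E d

    -- `initial` and `sum-start` are what the preceding blocks hand over: a value for the quotient
    -- of products at index s, and the vanishing of the sum so far.
    record Block (m s : ℕ) : Set where
      field
        comax-q : Comax q P
        comax-1-q : Comax (1# - q) P
        comax-h : ∀ i → 0 < i → i < m → Comax (h (q ^ (d ℕ.* (i ℕ.+ s)))) P
        q^ds≃1 : E (d ℕ.* s) ≃ A.1#
        M : ℕ
        M<m : M < m
        h-vanish : hA (E (suc (d ℕ.* M))) ≃ A.0#
        initial : A.Carrier
        initial-rep : Represents (upper s) (lower s) initial
        sum-start : Represents (sumNum s) (sumDen s) A.0#

      E-Q : ∀ i → E (d ℕ.* (i ℕ.+ s)) ≃ Q A.^ i
      E-Q i = ≃-trans (E-cong (ℕP.*-distribˡ-+ d i s)) (≃-trans (E-+ (d ℕ.* i) (d ℕ.* s))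
        (≃-trans (⊠-cong (≃-sym (E-* d i)) q^ds≃1) (A.*-identityʳ _)))

      ratio : ∀ r → Comax (h (q ^ (d ℕ.* (suc r ℕ.+ s)))) P → A.Carrier
      ratio r C = ι (h (q ^ suc (d ℕ.* (r ℕ.+ s)))) ⊠ proj₁ (ι-Unit C)

      ratio-rep : ∀ r C → Represents (h (q ^ suc (d ℕ.* (r ℕ.+ s)))) (h (q ^ (d ℕ.* (suc r ℕ.+ s)))) (ratio r C)
      ratio-rep r C = Represents-resp (*-identityʳ _) (*-identityˡ _) ≃-refl (Represents-* (Represents-ι _) (Represents-inverse C))

      β-step : ∀ r → Dec (suc r < m) → A.Carrier → A.Carrier
      β-step r (yes r<m) x = x ⊠ ratio r (comax-h (suc r) ℕ.z<s r<m)
      -- A default value: past the block the next denominator need not be invertible.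
      β-step r (no _) x = x

      β : ℕ → A.Carrier
      β zero = initial
      β (suc r) = β-step r (suc r ℕP.<? m) (β r)

      β-step-ratio : ∀ r dec x → suc r < m →
        β-step r dec x ⊠ ι (h (q ^ (d ℕ.* (suc r ℕ.+ s)))) ≃ ι (h (q ^ suc (d ℕ.* (r ℕ.+ s)))) ⊠ x
      β-step-ratio r (yes r<m) x _ = ≃-trans (A.solve 4 (λ x u i l → x A.:* (u A.:* i) A.:* l A.:= u A.:* x A.:* (l A.:* i)) ≃-refl x _ _ _)
        (≃-trans (A.*-congˡ (proj₂ (ι-Unit (comax-h (suc r) ℕ.z<s r<m)))) (A.*-identityʳ _))
      β-step-ratio r (no r≮m) x r<m = contradiction r<m r≮m

      β-step-rep : ∀ r dec x → suc r < m → Represents (upper (r ℕ.+ s)) (lower (r ℕ.+ s)) x →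
        Represents (upper (suc r ℕ.+ s)) (lower (suc r ℕ.+ s)) (β-step r dec x)
      β-step-rep r (no r≮m) x r<m _ = contradiction r<m r≮m
      β-step-rep r (yes r<m) x _ rep = Represents-* rep (ratio-rep r (comax-h (suc r) ℕ.z<s r<m))

      β-rep : ∀ r → r < m → Represents (upper (r ℕ.+ s)) (lower (r ℕ.+ s)) (β r)
      β-rep zero _ = initial-rep
      β-rep (suc r) r<m = β-step-rep r (suc r ℕP.<? m) (β r) r<m (β-rep r (ℕP.<-trans (ℕP.n<1+n r) r<m))

      weight : ℕ → A.Carrier
      weight r = E ((2 ℕ.* d ∸ 3) ℕ.* (r ℕ.+ s))

      w : ℕ → A.Carrier
      w r = weight r ⊠ β r

      g : A.Carrier
      g = E (2 ℕ.* d ∸ 3)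

      weight-step : ∀ r → weight (suc r) ≃ g ⊠ weight r
      weight-step r = ≃-trans (E-cong (ℕP.*-suc (2 ℕ.* d ∸ 3) (r ℕ.+ s))) (E-+ (2 ℕ.* d ∸ 3) _)

      w-step : ∀ r → suc r < m → w (suc r) ⊠ hA (Q A.^ suc r) ≃ g ⊠ hA (ι q ⊠ Q A.^ r) ⊠ w r
      w-step r r<m = ≃-trans (⊠-cong (A.*-congʳ (weight-step r)) (≃-trans (hA-cong (≃-sym (E-Q (suc r)))) (≃-sym (ι-h _))))
        (≃-trans (A.solve 4 (λ g x y z → (g A.:* x A.:* y) A.:* z A.:= g A.:* x A.:* (y A.:* z)) ≃-refl g (weight r) (β (suc r)) _)
        (≃-trans (A.*-congˡ (β-step-ratio r (suc r ℕP.<? m) (β r) r<m))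
        (≃-trans (A.*-congˡ (A.*-congʳ (≃-trans (ι-h _) (hA-cong (≃-trans (E-suc (d ℕ.* (r ℕ.+ s))) (A.*-congˡ (E-Q r)))))))
        (A.solve 4 (λ g x z y → g A.:* x A.:* (z A.:* y) A.:= g A.:* z A.:* (x A.:* y)) ≃-refl g (weight r) _ (β r)))))

      -- The bound on d ensures that the truncated subtraction `2 ℕ.* d ∸ 3` is exact.
      gq³≃Q² : g ⊠ (ι q) A.^ 3 ≃ Q A.^ 2
      gq³≃Q² = ≃-trans (A.*-congˡ (ι-^ q 3)) (≃-trans (≃-sym (E-+ (2 ℕ.* d ∸ 3) 3))
        (≃-trans (E-cong (≡.trans (ℕP.m∸n+n≡m (ℕP.≤-trans 3≤d (ℕP.m≤m+n d _))) (ℕP.*-comm 2 d))) (≃-sym (E-* d 2))))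

      v-Unit : A.Unit (E (suc (d ℕ.* M)))
      v-Unit = ι-Unit (Comax-^ comax-q (suc (d ℕ.* M)))

      h-Unit : ∀ i → 0 < i → i < m → A.Unit (hA (Q A.^ i))
      h-Unit i 0<i i<m = A.Unit-resp (≃-trans (ι-h _) (hA-cong (E-Q i))) (ι-Unit (comax-h i 0<i i<m))

      series : WellPoised.Series A
      series = record
        { q = ι q ; Q = Q ; g = g ; v = E (suc (d ℕ.* M)) ; v⁻ = proj₁ v-Unit ; h = hA
        ; reflective = FA.factor-reflective (ι a) (ι b) ; M = M ; m = m ; M<m = M<m
        ; qQ^M≈v = ≃-trans (A.*-congˡ (E-* d M)) (≃-sym (E-suc (d ℕ.* M)))
        ; vv⁻≈1 = proj₂ v-Unit ; gq³≈Q² = gq³≃Q²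
        ; Q-Unit = ι-Unit (Comax-^ comax-q d)
        ; h-Unit = h-Unit
        ; h-v-vanish = h-vanish ; w = w ; w-step = w-step }

      term : ℕ → A.Carrier
      term = WellPoised.Series.term series

      inv : A.Carrier
      inv = proj₁ (ι-Unit comax-1-q)

      τ : ℕ → A.Carrier
      τ r = ι (1# - q ^ (2 ℕ.* d ℕ.* (r ℕ.+ s) ℕ.+ 1)) ⊠ β r ⊠ weight r ⊠ inv

      τ-rep : ∀ r → r < m → Represents (termNum (r ℕ.+ s)) (termDen (r ℕ.+ s)) (τ r)
      τ-rep r r<m = Represents-resp (*-identityʳ _)
        (solve 2 (λ L o → ((con (+ 1) :* L) :* con (+ 1)) :* o := o :* L) refl _ _) ≃-refl
        (Represents-* (Represents-* (Represents-* (Represents-ι _) (β-rep r r<m)) (Represents-ι _)) (Represents-inverse comax-1-q))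

      τ≃ : ∀ r → τ r ≃ inv ⊠ term r
      τ≃ r = ≃-trans (A.*-congʳ (A.*-congʳ (A.*-congʳ (≃-trans (ι-sub _ _) (A.+-cong ι-1 (A.-‿cong
        (≃-trans (E-cong exponent) (≃-trans (E-suc (k ℕ.+ k)) (A.*-congˡ (≃-trans (E-+ k k) (⊠-cong (E-Q r) (E-Q r))))))))))))
        (A.solve 4 (λ u y p i → u A.:* y A.:* p A.:* i A.:= i A.:* (u A.:* (p A.:* y))) ≃-refl _ _ _ _)
        where
        k = d ℕ.* (r ℕ.+ s)
        exponent : 2 ℕ.* d ℕ.* (r ℕ.+ s) ℕ.+ 1 ≡ suc (d ℕ.* (r ℕ.+ s) ℕ.+ d ℕ.* (r ℕ.+ s))
        exponent = ≡.trans (ℕP.+-comm _ 1) (≡.cong suc (≡.trans (≡.cong (ℕ._* (r ℕ.+ s)) (≡.cong (d ℕ.+_) (ℕP.+-identityʳ d))) (ℕP.*-distribʳ-+ (r ℕ.+ s) d d)))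

      partial-sum : ∀ r → r ≤ m → Represents (sumNum (r ℕ.+ s)) (sumDen (r ℕ.+ s)) (inv ⊠ A.sum term r)
      partial-sum zero _ = Represents-resp refl refl (≃-sym (A.zeroʳ inv)) sum-start
      partial-sum (suc r) r<m = Represents-resp refl refl (≃-trans (A.+-congˡ (τ≃ r)) (≃-sym (A.distribˡ inv _ _)))
        (Represents-+ (partial-sum r (ℕP.<⇒≤ r<m)) (τ-rep r r<m))

      block-sum : A.sum term m ≃ A.0# → Represents (sumNum (m ℕ.+ s)) (sumDen (m ℕ.+ s)) A.0#
      block-sum e = Represents-resp refl refl (≃-trans (A.*-congˡ e) (A.zeroʳ inv)) (partial-sum m ℕP.≤-refl)

-- Vanishing modulo Φ_m for all blocks and modulo Φ_n² for one block

negative-inverse : ∀ m′ d → Coprime (suc m′) d → ∃ λ M → M < suc m′ × suc m′ ∣ suc (d ℕ.* M)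
negative-inverse m′ d coprime = let y , m∣ = unreduced (coprime-Bézout coprime) in
  y % m , m%n<n y m , ∣m+n∣m⇒∣n (≡.subst (m ∣_) (reduce y) m∣) (n∣m*n (d ℕ.* (y / m)))
  where
  m = suc m′
  open +-*-Solver
  reduce : ∀ y → suc (d ℕ.* y) ≡ d ℕ.* (y / m) ℕ.* m ℕ.+ suc (d ℕ.* (y % m))
  reduce y = ≡.trans (≡.cong (λ z → suc (d ℕ.* z)) (m≡m%n+[m/n]*n y m))
    (solve 4 (λ d r k m → con 1 :+ d :* (r :+ k :* m) := d :* k :* m :+ (con 1 :+ d :* r)) ≡.refl d (y % m) (y / m) m)
  unreduced : Bézout.Identity 1 m d → ∃ λ y → m ∣ suc (d ℕ.* y)
  unreduced (Bézout.+- x y e) = y , divides x (≡.trans (≡.cong suc (ℕP.*-comm d y)) e)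
  -- Here y is an inverse of d modulo m, and m′ = m - 1 supplies the sign -1.
  unreduced (Bézout.-+ x y e) = m′ ℕ.* y , divides (suc (m′ ℕ.* x)) (≡.trans
    (solve 3 (λ d k y → con 1 :+ d :* (k :* y) := con 1 :+ k :* (y :* d)) ≡.refl d m′ y)
    (≡.trans (≡.cong (λ z → suc (m′ ℕ.* z)) (≡.sym e))
    (solve 2 (λ k x → con 1 :+ k :* (con 1 :+ x :* (con 1 :+ k)) := (con 1 :+ k :* x) :* (con 1 :+ k)) ≡.refl m′ x)))

module Vanishing (R : CommutativeRing 0ℓ 0ℓ) (ground : Ground R) (d : ℕ) (3≤d : 3 ≤ d) where
  open RingTools R
  open Summation R ground d 3≤d public

  1-q^*≈ : ∀ m k → 1# - q ^ (m ℕ.* k) ≈ (1# - q ^ m) * sum ((q ^ m) ^_) k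
  1-q^*≈ m k = trans (+-congˡ (-‿cong (sym (^-assocʳ q m k)))) (1-x^n≈ (q ^ m) k)

  0<d : 0 < d
  0<d = ℕP.≤-trans (s≤s z≤n) 3≤d

  module _ {m′ : ℕ} (0<m′ : 0 < m′) (coprime : Coprime (suc m′) d) {Φ : Carrier} (cyc : CyclotomicFactor (suc m′) Φ) where
    open CyclotomicFactor cyc
    private
      m = suc m′

    m∤1 : ¬ m ∣ 1
    m∤1 m∣1 = ℕP.<⇒≱ (s≤s 0<m′) (∣⇒≤ m∣1)

    comax-1-q : Comax (1# - q) Φ
    comax-1-q = Comax-resp (+-congˡ (-‿cong (*-identityʳ q))) (Comax-1-q^ cyc 1 m∤1)

    m∤d*i : ∀ i → 0 < i → i < m → ¬ m ∣ d ℕ.* i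
    m∤d*i (suc i) _ i<m m∣di = ℕP.<⇒≱ i<m (∣⇒≤ (coprime-divisor coprime m∣di))

    module AtΦ (ev : Evaluation Φ) where
      open Local ev

      E-multiple : ∀ {k} → m ∣ k → E k A.≈ A.1#
      E-multiple {k} (divides t k≡tm) = A.sym (A.x-y≈0⇒x≈y (A.trans (A.sym (A.trans (ι-sub 1# (q ^ k)) (A.+-congʳ ι-1)))
        (A.trans (ι-cong (trans (+-congˡ (-‿cong (^-congʳ q (≡.trans k≡tm (ℕP.*-comm t m))))) (trans (1-q^*≈ m t)
        (trans (*-congʳ 1-q^m≈) (*-assoc _ _ _))))) (ι-0 _))))

      m∤shifted : ∀ l i → 0 < i → i < m → ¬ m ∣ d ℕ.* (i ℕ.+ l ℕ.* m)
      m∤shifted l i 0<i i<m m∣ = m∤d*i i 0<i i<m (∣m+n∣m⇒∣n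
        (≡.subst (m ∣_) (≡.trans (ℕP.*-distribˡ-+ d i (l ℕ.* m)) (ℕP.+-comm (d ℕ.* i) _)) m∣) (∣n⇒∣m*n d (n∣m*n l)))

      M : ℕ
      M = proj₁ (negative-inverse m′ d coprime)

      M<m : M < m
      M<m = proj₁ (proj₂ (negative-inverse m′ d coprime))

      m∣1+dM : m ∣ suc (d ℕ.* M)
      m∣1+dM = proj₂ (proj₂ (negative-inverse m′ d coprime))

      -- Exactly one factor of each of the two products is not invertible modulo Φ;
      -- both contain (1 − q^m)², which cancels.
      module NextBlock (l : ℕ) where
        s = l ℕ.* m
        K = (1# - q ^ m) * (1# - q ^ m)

        linearPair-1 : ∀ k → linearPair 1# (q ^ (m ℕ.* k)) ≈ K * (sum ((q ^ m) ^_) k * sum ((q ^ m) ^_) k)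
        linearPair-1 k = trans (*-cong (trans (+-congˡ (-‿cong (*-identityˡ _))) (1-q^*≈ m k)) (1-q^*≈ m k))
          (solve 2 (λ y σ → (y :* σ) :* (y :* σ) := (y :* y) :* (σ :* σ)) refl _ _)

        x : ℕ
        x = _∣_.quotient m∣1+dM ℕ.+ d ℕ.* l

        y : ℕ
        y = d ℕ.* suc l

        singular-upper : suc (d ℕ.* (s ℕ.+ M)) ≡ m ℕ.* x
        singular-upper = ≡.trans (N.solve 4 (λ d l m M → N.con 1 N.:+ d N.:* (l N.:* m N.:+ M) N.:= (N.con 1 N.:+ d N.:* M) N.:+ d N.:* l N.:* m) ≡.refl d l m M)
          (≡.trans (≡.cong (ℕ._+ d ℕ.* l ℕ.* m) (_∣_.equality m∣1+dM))
          (N.solve 3 (λ k m z → k N.:* m N.:+ z N.:* m N.:= m N.:* (k N.:+ z)) ≡.refl (_∣_.quotient m∣1+dM) m (d ℕ.* l)))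
          where module N = +-*-Solver

        singular-lower : d ℕ.* suc (s ℕ.+ m′) ≡ m ℕ.* y
        singular-lower = N.solve 3 (λ d l k → d N.:* (N.con 1 N.:+ (l N.:* (N.con 1 N.:+ k) N.:+ k)) N.:= (N.con 1 N.:+ k) N.:* (d N.:* (N.con 1 N.:+ l))) ≡.refl d l m′
          where module N = +-*-Solver

        upper-rest : ∃ λ c → prod (λ i → h (q ^ suc (d ℕ.* (s ℕ.+ i)))) m ≈ h (q ^ suc (d ℕ.* (s ℕ.+ M))) * c
        upper-rest = factor-of-prod _ M<m

        u v : Carrier
        u = regular (q ^ (m ℕ.* x)) * (sum ((q ^ m) ^_) x * sum ((q ^ m) ^_) x) * proj₁ upper-rest
        v = prod (λ i → h (q ^ (d ℕ.* suc (s ℕ.+ i)))) m′ * (regular (q ^ (m ℕ.* y)) * (sum ((q ^ m) ^_) y * sum ((q ^ m) ^_) y))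

        upper≈ : upper (m ℕ.+ s) ≈ K * (upper s * u)
        upper≈ = begin
          upper (m ℕ.+ s) ≡⟨ ≡.cong upper (ℕP.+-comm m s) ⟩
          upper (s ℕ.+ m) ≈⟨ prod-split _ s m ⟩
          upper s * prod (λ i → h (q ^ suc (d ℕ.* (s ℕ.+ i)))) m ≈⟨ *-congˡ (proj₂ upper-rest) ⟩
          upper s * (h (q ^ suc (d ℕ.* (s ℕ.+ M))) * proj₁ upper-rest)
            ≈⟨ *-congˡ (*-congʳ (trans (factor-cong refl refl (^-congʳ q singular-upper)) (*-congˡ (linearPair-1 x)))) ⟩
          upper s * (regular (q ^ (m ℕ.* x)) * (K * (sum ((q ^ m) ^_) x * sum ((q ^ m) ^_) x)) * proj₁ upper-rest)
            ≈⟨ solve 5 (λ U r K σ c → U :* (r :* (K :* σ) :* c) := K :* (U :* (r :* σ :* c))) refl _ _ K _ _ ⟩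
          K * (upper s * u) ∎

        lower≈ : lower (m ℕ.+ s) ≈ K * (lower s * v)
        lower≈ = begin
          lower (m ℕ.+ s) ≡⟨ ≡.cong lower (ℕP.+-comm m s) ⟩
          lower (s ℕ.+ m) ≈⟨ prod-split _ s m ⟩
          lower s * (prod (λ i → h (q ^ (d ℕ.* suc (s ℕ.+ i)))) m′ * h (q ^ (d ℕ.* suc (s ℕ.+ m′))))
            ≈⟨ *-congˡ (*-congˡ (trans (factor-cong refl refl (^-congʳ q singular-lower)) (*-congˡ (linearPair-1 y)))) ⟩
          lower s * (prod (λ i → h (q ^ (d ℕ.* suc (s ℕ.+ i)))) m′ * (regular (q ^ (m ℕ.* y)) * (K * (sum ((q ^ m) ^_) y * sum ((q ^ m) ^_) y))))
            ≈⟨ solve 5 (λ L p r K σ → L :* (p :* (r :* (K :* σ))) := K :* (L :* (p :* (r :* σ)))) refl _ _ _ K _ ⟩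
          K * (lower s * v) ∎

        comax-prod : ∀ k → k ≤ m′ → Comax (prod (λ i → h (q ^ (d ℕ.* suc (s ℕ.+ i)))) k) Φ
        comax-prod zero _ = Comax-const (Const-nat 0)
        comax-prod (suc k) k<m′ = Comax-* (comax-prod k (ℕP.<⇒≤ k<m′)) (Comax-h cyc _ λ m∣ →
          m∤shifted l (suc k) ℕ.z<s (s≤s k<m′) (≡.subst (λ z → m ∣ d ℕ.* suc z) (ℕP.+-comm s k) m∣))

        comax-σ : ∀ k → 0 < k → Comax (sum ((q ^ m) ^_) k) Φ
        comax-σ (suc k) _ = Comax-q-number cyc k

        0<y : 0 < y
        0<y = ℕP.*-mono-< {0} {d} {0} {suc l} 0<d ℕ.z<s

        comax-v : Comax v Φ
        comax-v = Comax-* (comax-prod m′ ℕP.≤-refl) (Comax-* (Comax-regular cyc (m ℕ.* y)) (Comax-* (comax-σ y 0<y) (comax-σ y 0<y)))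

        next-rep : ∀ {z} → Represents (upper s) (lower s) z → ∃ (Represents (upper (m ℕ.+ s)) (lower (m ℕ.+ s)))
        next-rep rep = _ , Represents-resp (sym upper≈) (sym lower≈) A.refl
          (Represents-scale K (Represents-* rep (Represents-resp (*-identityʳ u) (*-identityˡ v) A.refl
            (Represents-* (Represents-ι u) (Represents-inverse comax-v)))))

      -- The step of the weight across a block boundary has a lower factor that vanishes modulo Φ,
      -- so the recurrence cannot simply continue; the quotient of products at the boundary is
      -- carried along instead.
      blocks : ∀ l → ∃ (Represents (upper (l ℕ.* m)) (lower (l ℕ.* m))) × Represents (sumNum (l ℕ.* m)) (sumDen (l ℕ.* m)) A.0#
      blocks zero = (ι 1# , Represents-ι 1#) , Represents-0
      blocks (suc l) with blocks l
      ... | (z , rep) , sum-rep = NextBlock.next-rep l rep , Block.block-sum block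
              (WellPoised.Series.sum-term≈0 (Block.series block) (E-multiple m∣1+dM) 2-Unit)
        where
        block : Block m (l ℕ.* m)
        block = record
          { comax-q = Comax-q cyc ; comax-1-q = comax-1-q
          ; comax-h = λ i 0<i i<m → Comax-h cyc _ (m∤shifted l i 0<i i<m)
          ; q^ds≃1 = E-multiple (∣n⇒∣m*n d (n∣m*n l))
          ; M = M ; M<m = M<m ; h-vanish = FA.factor-1 (ι a) (ι b) (E-multiple m∣1+dM)
          ; initial = z ; initial-rep = rep ; sum-start = sum-rep }

      multiple-Φ : ∀ l → Multiple (sumNum (l ℕ.* m)) (sumDen (l ℕ.* m)) Φ
      multiple-Φ l = Represents-0⇒Multiple (proj₂ (blocks l))

    module AtΦ² (ev : Evaluation (Φ * Φ)) (s₀ : ℕ) (td≡1+m : suc s₀ ℕ.* d ≡ suc m) where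
      open Local ev

      -- The decisive use of d ≥ 3: from 3 t ≤ d t = m + 1 all exponents of P stay below m in
      -- absolute value.
      3s₀+2≤m : suc (suc (3 ℕ.* s₀)) ≤ m
      3s₀+2≤m = ℕP.≤-pred (≡.subst₂ _≤_ (N.solve 1 (λ s → (N.con 1 N.:+ s) N.:* N.con 3 N.:= N.con 3 N.:+ N.con 3 N.:* s) ≡.refl s₀) td≡1+m (ℕP.*-monoʳ-≤ (suc s₀) 3≤d))
        where module N = +-*-Solver

      t≤m : suc s₀ ≤ m
      t≤m = ℕP.≤-trans (s≤s (ℕP.≤-trans (ℕP.m≤m+n s₀ _) (ℕP.n≤1+n _))) 3s₀+2≤m

      M : ℕ
      M = m ∸ suc s₀

      M+t≡m : M ℕ.+ suc s₀ ≡ m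
      M+t≡m = ℕP.m∸n+n≡m t≤m

      M<m : M < m
      M<m = ≡.subst (M <_) M+t≡m (ℕP.m<m+n M ℕ.z<s)

      -- Since M = m - t, d m = d M + d t = m + (1 + d M).
      m∣1+dM : m ∣ suc (d ℕ.* M)
      m∣1+dM = ∣m+n∣m⇒∣n (≡.subst (m ∣_) dm≡ (n∣m*n d)) ∣-refl
        where
        dm≡ : d ℕ.* m ≡ m ℕ.+ suc (d ℕ.* M)
        dm≡ = ≡.trans (≡.cong (d ℕ.*_) (≡.sym M+t≡m)) (≡.trans (ℕP.*-distribˡ-+ d M (suc s₀))
          (≡.trans (≡.cong (d ℕ.* M ℕ.+_) (≡.trans (ℕP.*-comm d (suc s₀)) td≡1+m))
          (≡.trans (ℕP.+-suc (d ℕ.* M) m) (≡.trans (≡.cong suc (ℕP.+-comm (d ℕ.* M) m)) (≡.sym (ℕP.+-suc m _))))))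

      -- 1 - q^m rather than Φ itself: it divides each 1 - q^(m k) with an explicit quotient, and
      -- its square is still a multiple of Φ².
      π : A.Carrier
      π = ι (1# - q ^ m)

      π²≈0 : π A.* π A.≈ A.0#
      π²≈0 = A.trans (A.sym (ι-* _ _)) (A.trans (ι-cong (trans (*-cong 1-q^m≈ 1-q^m≈)
        (solve 2 (λ Φ c → (Φ :* c) :* (Φ :* c) := (Φ :* Φ) :* (c :* c)) refl Φ cofactor))) (ι-0 _))

      open SquareZero A using (module Congruence; SecondOrder)
      open Congruence π π²≈0

      E-multiple : ∀ {k} → m ∣ k → E k ≋ A.1#
      E-multiple {k} (divides t k≡tm) = ≋-sym (ι σ , A.trans (A.sym (A.trans (ι-sub 1# (q ^ k)) (A.+-congʳ ι-1)))
        (A.trans (ι-cong (trans (+-congˡ (-‿cong (^-congʳ q (≡.trans k≡tm (ℕP.*-comm t m))))) (1-q^*≈ m t))) (ι-* _ _)))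
        where σ = sum ((q ^ m) ^_) t

      Comax-square : ∀ {x} → Comax x Φ → Comax x (Φ * Φ)
      Comax-square C = Comax-*ʳ C C

      block : Block m 0
      block = record
        { comax-q = Comax-square (Comax-q cyc) ; comax-1-q = Comax-square comax-1-q
        ; comax-h = λ i 0<i i<m → Comax-square (Comax-h cyc _ λ m∣ → m∤d*i i 0<i i<m (≡.subst (λ z → m ∣ d ℕ.* z) (ℕP.+-identityʳ i) m∣))
        ; q^ds≃1 = A.trans (E-cong (ℕP.*-zeroʳ d)) ι-1
        ; M = M ; M<m = M<m ; h-vanish = FA.factor-double-zero π²≈0 (ι a) (ι b) (E-multiple m∣1+dM)
        ; initial = ι 1# ; initial-rep = Represents-ι 1# ; sum-start = Represents-0 }

      Q-inverse : A.Unit Q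
      Q-inverse = ι-Unit (Comax-^ (Comax-square (Comax-q cyc)) d)

      secondOrder : SecondOrder (Block.series block)
      secondOrder = record
        { π = π ; π²≈0 = π²≈0 ; s₀ = s₀ ; M+s₀+1≡m = M+t≡m ; e<m = 3s₀+2≤m ; 2-Unit = 2-Unit
        ; Q⁻ = proj₁ Q-inverse ; QQ⁻≈1 = proj₂ Q-inverse
        ; v≋1 = E-multiple m∣1+dM
        ; Q^m≋1 = ≋-trans (≈⇒≋ (E-* d m)) (E-multiple (n∣m*n d))
        ; Q^t≋q = ≋-trans (≈⇒≋ (A.trans (E-* d (suc s₀)) (A.trans (E-cong (≡.trans (ℕP.*-comm d (suc s₀)) td≡1+m)) (E-suc m))))
            (≋-trans (*-≋ (≈⇒≋ A.refl) (E-multiple ∣-refl)) (≈⇒≋ (A.*-identityʳ _)))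
        ; 1-Q^-Unit = λ i 0<i i<m → A.Unit-resp (A.trans (ι-sub 1# (q ^ (d ℕ.* i))) (A.+-cong ι-1 (A.-‿cong (A.sym (E-* d i)))))
            (ι-Unit (Comax-square (Comax-1-q^ cyc (d ℕ.* i) (m∤d*i i 0<i i<m))))
        ; h-≋ = FA.factor-≋ π²≈0 (ι a) (ι b)
        ; h-cross = FA.factor-cross π²≈0 (ι a) (ι b)
        ; h-double-zero = FA.factor-double-zero π²≈0 (ι a) (ι b)
        ; h-poly = λ c → FA.factor-poly (ι a) (ι b) c }

      multiple-Φ² : Multiple (sumNum m) (sumDen m) (Φ * Φ)
      multiple-Φ² = Represents-0⇒Multiple (≡.subst (λ k → Represents (sumNum k) (sumDen k) A.0#) (ℕP.+-identityʳ m)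
        (Block.block-sum block (SecondOrder.sum-term≈0-mod-square secondOrder)))

    multiple-Φ : ∀ l → Multiple (sumNum (l ℕ.* m)) (sumDen (l ℕ.* m)) Φ
    multiple-Φ = AtΦ.multiple-Φ (evaluation (Const-nat 0) Φ)

    multiple-Φ² : d ∣ suc m → Multiple (sumNum m) (sumDen m) (Φ * Φ)
    multiple-Φ² (divides (suc s₀) e) = AtΦ².multiple-Φ² (evaluation (Const-nat 0) (Φ * Φ)) s₀ (≡.sym e)

-- Chinese remaindering over the cyclotomic factors of [n]

module CyclotomicProduct (R : CommutativeRing 0ℓ 0ℓ) (ground : Ground R) (d : ℕ) (3≤d : 3 ≤ d)
  (Φ : ℕ → CommutativeRing.Carrier R) where
  open RingTools R
  open Vanishing R ground d 3≤d public

  select : ∀ {P : Set} → Dec P → Carrier → Carrier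
  select (yes _) x = x
  select (no _) x = 1#

  divisorProduct : ℕ → ℕ → Carrier
  divisorProduct m = prod λ i → select (suc i ∣? m) (Φ (suc i))

  select-yes : ∀ {P : Set} (dec : Dec P) {x} → P → select dec x ≈ x
  select-yes (yes _) p = refl
  select-yes (no ¬p) p = contradiction p ¬p

  select-no : ∀ {P : Set} (dec : Dec P) {x} → ¬ P → select dec x ≈ 1#
  select-no (yes p) ¬p = contradiction p ¬p
  select-no (no _) ¬p = refl

  select-⇒ : ∀ {P P′ : Set} (dec : Dec P) (dec′ : Dec P′) {x} → (P → P′) → ∃ λ T → select dec′ x ≈ select dec x * T
  select-⇒ (yes p) dec′ f = 1# , trans (select-yes dec′ (f p)) (sym (*-identityʳ _))
  select-⇒ (no _) dec′ f = _ , sym (*-identityˡ _)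

  divisorProduct-∣ : ∀ {g m} → g ∣ m → ∀ k → ∃ λ T → divisorProduct m k ≈ divisorProduct g k * T
  divisorProduct-∣ g∣m zero = 1# , sym (*-identityʳ _)
  divisorProduct-∣ {g} {m} g∣m (suc k) =
    let T , e = divisorProduct-∣ g∣m k ; T′ , e′ = select-⇒ (suc k ∣? g) (suc k ∣? m) (λ k∣g → ∣-trans k∣g g∣m) in
    T * T′ , trans (*-cong e e′) (solve 4 (λ x y z t → (x :* y) :* (z :* t) := (x :* z) :* (y :* t)) refl _ _ _ _)

  divisorProduct-stable : ∀ g o → divisorProduct (suc g) (suc g ℕ.+ o) ≈ divisorProduct (suc g) (suc g)
  divisorProduct-stable g zero = reflexive (≡.cong (divisorProduct (suc g)) (ℕP.+-identityʳ (suc g)))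
  divisorProduct-stable g (suc o) = trans (reflexive (≡.cong (divisorProduct (suc g)) (ℕP.+-suc (suc g) o)))
    (trans (*-cong (divisorProduct-stable g o) (select-no (suc (suc g ℕ.+ o) ∣? suc g) λ div →
      ℕP.<⇒≱ (s≤s (ℕP.m≤m+n (suc g) o)) (∣⇒≤ div))) (*-identityʳ _))

  module _ (n : ℕ) (cyclotomic : ∀ m → 1 ≤ m → m ≤ n → divisorProduct m m ≈ q ^ m - 1#) where

    top-factor : ∀ m′ → suc m′ ≤ n → q ^ suc m′ - 1# ≈ divisorProduct (suc m′) m′ * Φ (suc m′)
    top-factor m′ m≤n = trans (sym (cyclotomic (suc m′) (s≤s z≤n) m≤n)) (*-congˡ (select-yes (suc m′ ∣? suc m′) ∣-refl))

    cyclotomicFactor : ∀ m′ → suc m′ ≤ n → CyclotomicFactor (suc m′) (Φ (suc m′))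
    cyclotomicFactor m′ m≤n = record
      { cofactor = - divisorProduct m m′
      ; 1-q^m≈ = trans (solve 1 (λ x → con (+ 1) :- x := :- (x :- con (+ 1))) refl _) (trans (-‿cong (top-factor m′ m≤n))
          (solve 2 (λ x y → :- (x :* y) := y :* :- x) refl _ _))
      ; proper = proper }
      where
      m = suc m′
      -- Every divisor of g is a divisor of m below m, so the product over the divisors of m other
      -- than m contains q^g - 1, next to the factor Φ m.
      proper : ∀ g t → g ℕ.* t ≡ m → 0 < g → 1 < t → ∃ λ T → 1# - q ^ m ≈ (1# - q ^ g) * (Φ m * T)
      proper (suc g′) t gt≡m _ 1<t = T , (begin
        1# - q ^ m ≈⟨ solve 1 (λ x → con (+ 1) :- x := :- (x :- con (+ 1))) refl _ ⟩
        - (q ^ m - 1#) ≈⟨ -‿cong (trans (top-factor m′ m≤n) (*-congʳ (trans eT (*-congʳ g-product)))) ⟩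
        - ((q ^ g - 1#) * T * Φ m) ≈⟨ solve 3 (λ x y z → :- ((x :- con (+ 1)) :* y :* z) := (con (+ 1) :- x) :* (z :* y)) refl _ _ _ ⟩
        (1# - q ^ g) * (Φ m * T) ∎)
        where
        g = suc g′
        g∣m : g ∣ m
        g∣m = divides t (≡.trans (≡.sym gt≡m) (ℕP.*-comm g t))
        g<m : g < m
        g<m = ≡.subst₂ _<_ (ℕP.*-identityʳ g) gt≡m (ℕP.*-monoʳ-< g 1<t)
        T = proj₁ (divisorProduct-∣ g∣m m′)
        eT = proj₂ (divisorProduct-∣ g∣m m′)
        o-eq = ℕP.m≤n⇒∃[o]m+o≡n (ℕP.≤-pred g<m)
        g-product : divisorProduct g m′ ≈ q ^ g - 1#
        g-product = trans (reflexive (≡.cong (divisorProduct g) (≡.sym (proj₂ o-eq)))) (trans (divisorProduct-stable g′ (proj₁ o-eq))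
          (cyclotomic g (s≤s z≤n) (ℕP.≤-trans (ℕP.<⇒≤ g<m) m≤n)))

    -- The index starts at 2: Φ 1 = q - 1 is left out, as in [n].
    properProduct : ℕ → Carrier
    properProduct = prod λ i → select (suc (suc i) ∣? n) (Φ (suc (suc i)))

    -- The factor of smaller index i + 1 divides 1 - q^(i+1), and j + 1 cannot divide the smaller
    -- number i + 1.
    comax-Φ : ∀ i j → i < j → suc j ≤ n → Comax (Φ (suc i)) (Φ (suc j))
    comax-Φ i j i<j j<n = Comax-divisorˡ (CyclotomicFactor.1-q^m≈ (cyclotomicFactor i (ℕP.≤-trans (s≤s (ℕP.<⇒≤ i<j)) j<n)))
      (Comax-1-q^ (cyclotomicFactor j j<n) (suc i) λ j∣i → ℕP.<⇒≱ (s≤s i<j) (∣⇒≤ j∣i))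

    comax-select : ∀ {Q : Set} (dec : Dec Q) {x P} → Comax x P → Comax (select dec x) P
    comax-select (yes _) C = C
    comax-select (no _) C = Comax-const (Const-nat 0)

    comax-properProduct : ∀ e j → e ≤ j → suc (suc j) ≤ n → Comax (properProduct e) (Φ (suc (suc j)))
    comax-properProduct zero j _ _ = Comax-const (Const-nat 0)
    comax-properProduct (suc e) j e<j j<n = Comax-* (comax-properProduct e j (ℕP.<⇒≤ e<j) j<n)
      (comax-select (suc (suc e) ∣? n) (comax-Φ (suc e) (suc j) (s≤s e<j) j<n))

    Multiple-select : ∀ {N D P x} {Q : Set} (dec : Dec Q) → Comax P x → Multiple N D P → (Q → Multiple N D x) → Multiple N D (P * select dec x)
    Multiple-select {N} {D} (yes p) C M f = Multiple-* N D C M (f p)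
    Multiple-select {N} {D} (no _) C M f = Multiple-resp N D (sym (*-identityʳ _)) M

    multiple-properProduct : ∀ {N D} e → suc e ≤ n → (∀ i → i < e → suc (suc i) ∣ n → Multiple N D (Φ (suc (suc i)))) →
      Multiple N D (properProduct e)
    multiple-properProduct {N} {D} zero _ _ = D , (0# , 1# , 1# , Const-nat 0 , solve 1 (λ D → con (+ 0) :* D :+ con (+ 1) :* con (+ 1) := con (+ 1)) refl D) ,
      N , solve 2 (λ N D → N :* D := con (+ 1) :* N :* D) refl N D
    multiple-properProduct (suc e) e<n f = Multiple-select (suc (suc e) ∣? n) (comax-properProduct e e ℕP.≤-refl e<n)
      (multiple-properProduct e (ℕP.<⇒≤ e<n) λ i i<e → f i (ℕP.m<n⇒m<1+n i<e)) (f e ℕP.≤-refl)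

    Φ₁≈ : 1 ≤ n → Φ 1 ≈ q - 1#
    Φ₁≈ 1≤n = begin
      Φ 1 ≈⟨ *-identityˡ _ ⟨
      1# * Φ 1 ≈⟨ top-factor 0 1≤n ⟨
      q * 1# - 1# ≈⟨ +-congʳ (*-identityʳ q) ⟩
      q - 1# ∎

    divisorProduct-properProduct : ∀ e → suc e ≤ n → divisorProduct n (suc e) ≈ (q - 1#) * properProduct e
    divisorProduct-properProduct zero 1≤n = trans (*-identityˡ _) (trans (select-yes (1 ∣? n) (1∣ n)) (trans (Φ₁≈ 1≤n) (sym (*-identityʳ _))))
    divisorProduct-properProduct (suc e) e<n = trans (*-congʳ (divisorProduct-properProduct e (ℕP.<⇒≤ e<n))) (*-assoc _ _ _)

  module Main (n′ : ℕ) (coprime : ∀ m → m ∣ suc n′ → Coprime m d)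
    (cyclotomic : ∀ m → 1 ≤ m → m ≤ suc n′ → divisorProduct m m ≈ q ^ m - 1#) where
    private
      n = suc n′

    bracket≈properProduct : sum (q ^_) n ≈ properProduct n cyclotomic n′
    bracket≈properProduct = 1-q^-cancel 1 ℕ.z<s (trans (*-congʳ (+-congˡ (-‿cong (*-identityʳ q)))) (begin
      (1# - q) * sum (q ^_) n ≈⟨ geometric q n ⟩
      1# - q ^ n ≈⟨ solve 1 (λ x → con (+ 1) :- x := :- (x :- con (+ 1))) refl _ ⟩
      - (q ^ n - 1#) ≈⟨ -‿cong (trans (sym (cyclotomic n (s≤s z≤n) ℕP.≤-refl)) (divisorProduct-properProduct n cyclotomic n′ ℕP.≤-refl)) ⟩
      - ((q - 1#) * properProduct n cyclotomic n′) ≈⟨ solve 2 (λ q p → :- ((q :- con (+ 1)) :* p) := (con (+ 1) :- q :* con (+ 1)) :* p) refl _ _ ⟩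
      (1# - q ^ 1) * properProduct n cyclotomic n′ ∎))

    multiple-divisor : ∀ i → suc (suc i) ≤ n → suc (suc i) ∣ n → Multiple (sumNum n) (sumDen n) (Φ (suc (suc i)))
    multiple-divisor i i<n i∣n@(divides l n≡lm) = ≡.subst (λ k → Multiple (sumNum k) (sumDen k) (Φ (suc (suc i)))) (≡.sym n≡lm)
      (multiple-Φ ℕ.z<s (coprime _ i∣n) (cyclotomicFactor n cyclotomic (suc i) i<n) l)

    multiple-bracket : Multiple (sumNum n) (sumDen n) (sum (q ^_) n)
    multiple-bracket = Multiple-resp _ _ (sym bracket≈properProduct) (multiple-properProduct n cyclotomic n′ ℕP.≤-refl
      λ i i<n′ i∣n → multiple-divisor i (s≤s i<n′) i∣n)

  -- `Multiple-*` combines comaximal factors only, so the last factor Φ n of [n] is replaced by Φ n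
  -- * Φ n before the final combination.
  multiple-bracket-Φ : ∀ n″ (coprime : ∀ m → m ∣ suc (suc n″) → Coprime m d)
    (cyclotomic : ∀ m → 1 ≤ m → m ≤ suc (suc n″) → divisorProduct m m ≈ q ^ m - 1#) → d ∣ suc (suc (suc n″)) →
    Multiple (sumNum (suc (suc n″))) (sumDen (suc (suc n″))) (sum (q ^_) (suc (suc n″)) * Φ (suc (suc n″)))
  multiple-bracket-Φ n″ coprime cyclotomic d∣1+n = Multiple-resp _ _ (begin
      properProduct n cyclotomic n″ * (Φ n * Φ n) ≈⟨ *-assoc _ _ _ ⟨
      properProduct n cyclotomic n″ * Φ n * Φ n ≈⟨ *-congʳ (*-congˡ (select-yes (n ∣? n) ∣-refl)) ⟨
      properProduct n cyclotomic (suc n″) * Φ n ≈⟨ *-congʳ (Main.bracket≈properProduct (suc n″) coprime cyclotomic) ⟨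
      sum (q ^_) n * Φ n ∎)
    (Multiple-* _ _ (Comax-*ʳ C C)
      (multiple-properProduct n cyclotomic n″ (ℕP.n≤1+n _) λ i i<n″ i∣n →
        Main.multiple-divisor (suc n″) coprime cyclotomic i (s≤s (ℕP.m<n⇒m<1+n i<n″)) i∣n)
      (multiple-Φ² ℕ.z<s (coprime n ∣-refl) (cyclotomicFactor n cyclotomic (suc n″) ℕP.≤-refl) d∣1+n))
    where
    n = suc (suc n″)
    C : Comax (properProduct n cyclotomic n″) (Φ n)
    C = comax-properProduct n cyclotomic n″ n″ ℕP.≤-refl ℕP.≤-refl

-- Formal power series over a commutative ring

module PowerSeries (R : CommutativeRing 0ℓ 0ℓ) where
  open RingTools R

  Series : Set
  Series = ℕ → Carrier

  tail : Series → Series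
  tail f n = f (suc n)

  _≈ₛ_ : Series → Series → Set
  f ≈ₛ g = ∀ n → f n ≈ g n

  -- Convolution by recursion on the index, which suits inductions; `⋆-convolution` recovers the
  -- usual sum.
  _⋆_ : Series → Series → Series
  (f ⋆ g) zero = f 0 * g 0
  (f ⋆ g) (suc n) = f 0 * g (suc n) + (tail f ⋆ g) n

  const : Carrier → Series
  const c zero = c
  const c (suc n) = 0#

  ⋆-cong : ∀ {f f′ g g′} → f ≈ₛ f′ → g ≈ₛ g′ → (f ⋆ g) ≈ₛ (f′ ⋆ g′)
  ⋆-cong e e′ zero = *-cong (e 0) (e′ 0)
  ⋆-cong e e′ (suc n) = +-cong (*-cong (e 0) (e′ (suc n))) (⋆-cong (λ i → e (suc i)) e′ n)

  ⋆-distribʳ : ∀ f g h → ((λ n → g n + h n) ⋆ f) ≈ₛ (λ n → (g ⋆ f) n + (h ⋆ f) n)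
  ⋆-distribʳ f g h zero = distribʳ _ _ _
  ⋆-distribʳ f g h (suc n) = trans (+-congˡ (⋆-distribʳ f (tail g) (tail h) n))
    (solve 5 (λ g h f x y → (g :+ h) :* f :+ (x :+ y) := (g :* f :+ x) :+ (h :* f :+ y)) refl _ _ _ _ _)

  ⋆-scale : ∀ c f g → ((λ n → c * f n) ⋆ g) ≈ₛ (λ n → c * (f ⋆ g) n)
  ⋆-scale c f g zero = *-assoc _ _ _
  ⋆-scale c f g (suc n) = trans (+-cong (*-assoc _ _ _) (⋆-scale c (tail f) g n)) (sym (distribˡ _ _ _))

  -- The mirror image of the defining recursion, needed for commutativity.
  ⋆-sucʳ : ∀ f g n → (f ⋆ g) (suc n) ≈ (f ⋆ tail g) n + f (suc n) * g 0
  ⋆-sucʳ f g zero = refl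
  ⋆-sucʳ f g (suc n) = trans (+-congˡ (⋆-sucʳ (tail f) g n)) (sym (+-assoc _ _ _))

  ⋆-comm : ∀ f g → (f ⋆ g) ≈ₛ (g ⋆ f)
  ⋆-comm f g zero = *-comm _ _
  ⋆-comm f g (suc n) = trans (+-congˡ (⋆-comm (tail f) g n))
    (trans (+-comm _ _) (trans (+-congˡ (*-comm _ _)) (sym (⋆-sucʳ g f n))))

  ⋆-assoc : ∀ f g h → ((f ⋆ g) ⋆ h) ≈ₛ (f ⋆ (g ⋆ h))
  ⋆-assoc f g h zero = *-assoc _ _ _
  ⋆-assoc f g h (suc n) = begin
    f 0 * g 0 * h (suc n) + ((λ i → f 0 * g (suc i) + (tail f ⋆ g) i) ⋆ h) n
      ≈⟨ +-congˡ (trans (⋆-distribʳ h (λ i → f 0 * g (suc i)) (tail f ⋆ g) n) (+-cong (⋆-scale (f 0) (tail g) h n) (⋆-assoc (tail f) g h n))) ⟩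
    f 0 * g 0 * h (suc n) + (f 0 * (tail g ⋆ h) n + (tail f ⋆ (g ⋆ h)) n)
      ≈⟨ solve 5 (λ f g h x y → f :* g :* h :+ (f :* x :+ y) := f :* (g :* h :+ x) :+ y) refl _ _ _ _ _ ⟩
    f 0 * (g 0 * h (suc n) + (tail g ⋆ h) n) + (tail f ⋆ (g ⋆ h)) n ∎

  ⋆-zeroˡ : ∀ f g → (∀ n → f n ≈ 0#) → ∀ n → (f ⋆ g) n ≈ 0#
  ⋆-zeroˡ f g e zero = trans (*-congʳ (e 0)) (zeroˡ _)
  ⋆-zeroˡ f g e (suc n) = trans (+-cong (trans (*-congʳ (e 0)) (zeroˡ _)) (⋆-zeroˡ (tail f) g (λ i → e (suc i)) n)) (+-identityˡ 0#)

  ⋆-identityˡ : ∀ f → (const 1# ⋆ f) ≈ₛ f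
  ⋆-identityˡ f zero = *-identityˡ _
  ⋆-identityˡ f (suc n) = trans (+-cong (*-identityˡ _) (⋆-zeroˡ _ f (λ _ → refl) n)) (+-identityʳ _)

  sumUpTo : ℕ → (ℕ → Carrier) → Carrier
  sumUpTo zero f = f 0
  sumUpTo (suc n) f = sumUpTo n f + f (suc n)

  sumUpTo-first : ∀ n f → sumUpTo (suc n) f ≈ f 0 + sumUpTo n (λ i → f (suc i))
  sumUpTo-first zero f = refl
  sumUpTo-first (suc n) f = trans (+-congʳ (sumUpTo-first n f)) (+-assoc _ _ _)

  ⋆-convolution : ∀ f g n → (f ⋆ g) n ≈ sumUpTo n (λ i → f i * g (n ∸ i))
  ⋆-convolution f g zero = refl
  ⋆-convolution f g (suc n) = trans (+-congˡ (⋆-convolution (tail f) g n)) (sym (sumUpTo-first n _))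

  powerSeriesRing : CommutativeRing 0ℓ 0ℓ
  powerSeriesRing = record
    { Carrier = Series ; _≈_ = _≈ₛ_ ; _+_ = λ f g n → f n + g n ; _*_ = _⋆_ ; -_ = λ f n → - f n
    ; 0# = λ _ → 0# ; 1# = const 1#
    ; isCommutativeRing = record
      { isRing = record
        { +-isAbelianGroup = record
          { isGroup = record
            { isMonoid = record
              { isSemigroup = record
                { isMagma = record
                  { isEquivalence = record { refl = λ _ → refl ; sym = λ e n → sym (e n) ; trans = λ e e′ n → trans (e n) (e′ n) }
                  ; ∙-cong = λ e e′ n → +-cong (e n) (e′ n) }
                ; assoc = λ f g h n → +-assoc _ _ _ }
              ; identity = (λ f n → +-identityˡ _) , (λ f n → +-identityʳ _) }
            ; inverse = (λ f n → -‿inverseˡ _) , (λ f n → -‿inverseʳ _)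
            ; ⁻¹-cong = λ e n → -‿cong (e n) }
          ; comm = λ f g n → +-comm _ _ }
        ; *-cong = ⋆-cong
        ; *-assoc = ⋆-assoc
        ; *-identity = ⋆-identityˡ , λ f n → trans (⋆-comm f _ n) (⋆-identityˡ f n)
        ; distrib = (λ f g h n → trans (⋆-comm f _ n) (trans (⋆-distribʳ f g h n) (+-cong (⋆-comm g f n) (⋆-comm h f n)))) , ⋆-distribʳ
        }
      ; *-comm = ⋆-comm
      }
    }

-- Polynomials in a, b, q inside the iterated power series ring

open import Defs

module PS₁ = PowerSeries ℤP.+-*-commutativeRing
module PS₂ = PowerSeries PS₁.powerSeriesRing
module PS₃ = PowerSeries PS₂.powerSeriesRing

infix 4 _≐_

-- _≈_ unfolds to a product of coefficient equations; the wrapper keeps both sides inferable.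
record _≐_ (p r : Poly) : Set where
  constructor ≐-intro
  field ≐-elim : p ≈ r
open _≐_ public

sumTo≡ : ∀ n f → sumTo n f ≡ PS₁.sumUpTo n f
sumTo≡ zero f = ≡.refl
sumTo≡ (suc n) f = ≡.cong (ℤ._+ f (suc n)) (sumTo≡ n f)

sumTo-cong : ∀ n {f g : ℕ → ℤ} → (∀ i → f i ≡ g i) → sumTo n f ≡ sumTo n g
sumTo-cong zero e = e 0
sumTo-cong (suc n) e = ≡.cong₂ ℤ._+_ (sumTo-cong n e) (e (suc n))

sumUpTo₂-apply : ∀ n f k → PS₂.sumUpTo n f k ≡ sumTo n (λ i → f i k)
sumUpTo₂-apply zero f k = ≡.refl
sumUpTo₂-apply (suc n) f k = ≡.cong (ℤ._+ f (suc n) k) (sumUpTo₂-apply n f k)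

sumUpTo₃-apply : ∀ n f j k → PS₃.sumUpTo n f j k ≡ sumTo n (λ i → f i j k)
sumUpTo₃-apply zero f j k = ≡.refl
sumUpTo₃-apply (suc n) f j k = ≡.cong (ℤ._+ f (suc n) j k) (sumUpTo₃-apply n f j k)

coeff-⊗ : ∀ p r i j k → coeff (p ⊗ r) i j k ≡ PS₃._⋆_ (coeff p) (coeff r) i j k
coeff-⊗ p r i j k = ≡.sym (≡.trans (PS₃.⋆-convolution (coeff p) (coeff r) i j k)
  (≡.trans (sumUpTo₃-apply i _ j k) (sumTo-cong i λ i′ →
  ≡.trans (PS₂.⋆-convolution (coeff p i′) (coeff r (i ∸ i′)) j k) (≡.trans (sumUpTo₂-apply j _ k) (sumTo-cong j λ j′ →
  ≡.trans (PS₁.⋆-convolution (coeff p i′ j′) (coeff r (i ∸ i′) (j ∸ j′)) k) (≡.sym (sumTo≡ k _)))))))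

coeff-𝟘 : ∀ i j k → coeff 𝟘 i j k ≡ 0ℤ
coeff-𝟘 zero zero zero = ≡.refl
coeff-𝟘 zero zero (suc k) = ≡.refl
coeff-𝟘 zero (suc j) k = ≡.refl
coeff-𝟘 (suc i) j k = ≡.refl

coeff-𝟙 : ∀ i j k → coeff 𝟙 i j k ≡ CommutativeRing.1# PS₃.powerSeriesRing i j k
coeff-𝟙 zero zero zero = ≡.refl
coeff-𝟙 zero zero (suc k) = ≡.refl
coeff-𝟙 zero (suc j) k = ≡.refl
coeff-𝟙 (suc i) j k = ≡.refl

polyRawRing : RawRing 0ℓ 0ℓ
polyRawRing = record { Carrier = Poly ; _≈_ = _≐_ ; _+_ = _⊕_ ; _*_ = _⊗_ ; -_ = ⊝_ ; 0# = 𝟘 ; 1# = 𝟙 }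

open RingMorphisms polyRawRing (CommutativeRing.rawRing PS₃.powerSeriesRing)

-- Equality of polynomials means equality of coefficients, so injectivity is immediate and the ring
-- laws are pulled back from power series.
coeff-isMonomorphism : IsRingMonomorphism coeff
coeff-isMonomorphism = record
  { isRingHomomorphism = record
    { isSemiringHomomorphism = record
      { isNearSemiringHomomorphism = record
        { +-isMonoidHomomorphism = record
          { isMagmaHomomorphism = record
            { isRelHomomorphism = record { cong = ≐-elim }
            ; homo = λ p r i j k → ≡.refl }
          ; ε-homo = coeff-𝟘 }
        ; *-homo = coeff-⊗ }
      ; 1#-homo = coeff-𝟙 }
    ; -‿homo = λ p i j k → ≡.refl }
  ; injective = ≐-intro }

polyRing : CommutativeRing 0ℓ 0ℓ
polyRing = record { isCommutativeRing = RingMonomorphism.isCommutativeRing coeff-isMonomorphism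
  (CommutativeRing.isCommutativeRing PS₃.powerSeriesRing) }

open RingTools polyRing hiding (_≈_; zero) renaming (con to :con)

-- Constants in a and b, cancellation of 1 - q^g, and degree in q

sumTo-0 : ∀ n {f : ℕ → ℤ} → (∀ i → f i ≡ 0ℤ) → sumTo n f ≡ 0ℤ
sumTo-0 zero e = e 0
sumTo-0 (suc n) e = ≡.cong₂ ℤ._+_ (sumTo-0 n e) (e (suc n))

sumTo-head : ∀ n {f : ℕ → ℤ} → (∀ i → f (suc i) ≡ 0ℤ) → sumTo n f ≡ f 0
sumTo-head zero e = ≡.refl
sumTo-head (suc n) e = ≡.trans (≡.cong₂ ℤ._+_ (sumTo-head n e) (e n)) (ℤP.+-identityʳ _)

sumTo-first : ∀ n (f : ℕ → ℤ) → sumTo (suc n) f ≡ f 0 ℤ.+ sumTo n (λ i → f (suc i))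
sumTo-first zero f = ≡.refl
sumTo-first (suc n) f = ≡.trans (≡.cong (ℤ._+ f (suc (suc n))) (sumTo-first n f)) (ℤP.+-assoc (f 0) _ _)

0*≡0 : ∀ {x y : ℤ} → x ≡ 0ℤ → x ℤ.* y ≡ 0ℤ
0*≡0 {y = y} e = ≡.trans (≡.cong (ℤ._* y) e) (ℤP.*-zeroˡ y)

*0≡0 : ∀ {x y : ℤ} → y ≡ 0ℤ → x ℤ.* y ≡ 0ℤ
*0≡0 {x = x} e = ≡.trans (≡.cong (x ℤ.*_) e) (ℤP.*-zeroʳ x)

coeff-⊗-0 : ∀ p r k → (∀ i j i′ j′ k′ → coeff p i j k′ ℤ.* coeff r i′ j′ (k ∸ k′) ≡ 0ℤ) → ∀ i j → coeff (p ⊗ r) i j k ≡ 0ℤ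
coeff-⊗-0 p r k e i j = sumTo-0 i λ i′ → sumTo-0 j λ j′ → sumTo-0 k λ k′ → e i′ j′ _ _ k′

FreeOfQ-⊗ : ∀ p r → FreeOfQ p → FreeOfQ r → FreeOfQ (p ⊗ r)
FreeOfQ-⊗ p r fp fr i j k k≢0 = coeff-⊗-0 p r k product i j
  where
  product : ∀ i j i′ j′ k′ → coeff p i j k′ ℤ.* coeff r i′ j′ (k ∸ k′) ≡ 0ℤ
  product i j i′ j′ zero = *0≡0 {coeff p i j 0} (fr i′ j′ k k≢0)
  product i j i′ j′ (suc k′) = 0*≡0 (fp i j (suc k′) λ ())

FreeOfQ-⊕ : ∀ p r → FreeOfQ p → FreeOfQ r → FreeOfQ (p ⊕ r)
FreeOfQ-⊕ p r fp fr i j k k≢0 = ≡.cong₂ ℤ._+_ (fp i j k k≢0) (fr i j k k≢0)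

FreeOfQ-⊝ : ∀ p → FreeOfQ p → FreeOfQ (⊝ p)
FreeOfQ-⊝ p fp i j k k≢0 = ≡.cong ℤ.-_ (fp i j k k≢0)

FreeOfQ-con : ∀ c → FreeOfQ (con c)
FreeOfQ-con c i j zero k≢0 = contradiction ≡.refl k≢0
FreeOfQ-con c zero zero (suc k) _ = ≡.refl
FreeOfQ-con c zero (suc j) (suc k) _ = ≡.refl
FreeOfQ-con c (suc i) j (suc k) _ = ≡.refl

FreeOfQ-𝕒 : FreeOfQ 𝕒
FreeOfQ-𝕒 i j zero k≢0 = contradiction ≡.refl k≢0
FreeOfQ-𝕒 zero j (suc k) _ = ≡.refl
FreeOfQ-𝕒 (suc zero) zero (suc k) _ = ≡.refl
FreeOfQ-𝕒 (suc zero) (suc j) (suc k) _ = ≡.refl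
FreeOfQ-𝕒 (suc (suc i)) j (suc k) _ = ≡.refl

FreeOfQ-𝕓 : FreeOfQ 𝕓
FreeOfQ-𝕓 i j zero k≢0 = contradiction ≡.refl k≢0
FreeOfQ-𝕓 zero zero (suc k) _ = ≡.refl
FreeOfQ-𝕓 zero (suc zero) (suc k) _ = ≡.refl
FreeOfQ-𝕓 zero (suc (suc j)) (suc k) _ = ≡.refl
FreeOfQ-𝕓 (suc i) j (suc k) _ = ≡.refl

FreeOfQ-^ : ∀ p → FreeOfQ p → ∀ n → FreeOfQ (p ^ n)
FreeOfQ-^ p fp zero = FreeOfQ-con 1ℤ
FreeOfQ-^ p fp (suc n) = FreeOfQ-⊗ p (p ^ n) fp (FreeOfQ-^ p fp n)

FreeOfQ-nat : ∀ n → FreeOfQ (nat n)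
FreeOfQ-nat zero = FreeOfQ-con 0ℤ
FreeOfQ-nat (suc zero) = FreeOfQ-con 1ℤ
FreeOfQ-nat (suc (suc n)) = FreeOfQ-⊕ 𝟙 (nat (suc n)) (FreeOfQ-con 1ℤ) (FreeOfQ-nat (suc n))

coeff₀ : Poly → ℤ
coeff₀ p = coeff p 0 0 0

coeff₀-nat : ∀ n → coeff₀ (nat n) ≡ + n
coeff₀-nat zero = ≡.refl
coeff₀-nat (suc zero) = ≡.refl
coeff₀-nat (suc (suc n)) = ≡.cong (λ y → 1ℤ ℤ.+ y) (coeff₀-nat (suc n))

coeff₀-1-x : ∀ {x} → coeff₀ x ≡ 0ℤ → coeff₀ (𝟙 - x) ≡ 1ℤ
coeff₀-1-x e = ≡.cong (λ y → 1ℤ ℤ.- y) e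

coeff₀-x-1 : ∀ {x} → coeff₀ x ≡ 0ℤ → coeff₀ (x - 𝟙) ≡ ℤ.- 1ℤ
coeff₀-x-1 e = ≡.cong (λ y → y ℤ.- 1ℤ) e

-- Nonvanishing is strengthened to a nonzero constant coefficient. All Bézout constants, built from
-- positive integers and ±(1 - a^n), ±(1 - b^n), have one, and closure under products reduces to ℤ
-- being a domain.
record Constant (c : Poly) : Set where
  field
    free : FreeOfQ c
    nonzero : coeff₀ c ≢ 0ℤ
open Constant

Constant-⊗ : ∀ {p r} → Constant p → Constant r → Constant (p ⊗ r)
Constant-⊗ {p} {r} cp cr = record { free = FreeOfQ-⊗ p r (free cp) (free cr)
  ; nonzero = λ e → [ nonzero cp , nonzero cr ]′ (ℤP.i*j≡0⇒i≡0∨j≡0 (coeff₀ p) e) }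

Constant-1-x^ : ∀ x → FreeOfQ x → coeff₀ x ≡ 0ℤ → ∀ n → Constant (𝟙 - x ^ suc n)
Constant-1-x^ x f e n = record
  { free = FreeOfQ-⊕ 𝟙 (⊝ (x ^ suc n)) (FreeOfQ-con 1ℤ) (FreeOfQ-⊝ (x ^ suc n) (FreeOfQ-^ x f (suc n)))
  ; nonzero = λ e′ → contradiction (≡.trans (≡.sym (coeff₀-1-x {x ^ suc n} (0*≡0 {coeff₀ x} {coeff₀ (x ^ n)} e))) e′) λ () }

Constant-x^-1 : ∀ x → FreeOfQ x → coeff₀ x ≡ 0ℤ → ∀ n → Constant (x ^ suc n - 𝟙)
Constant-x^-1 x f e n = record
  { free = FreeOfQ-⊕ (x ^ suc n) (⊝ 𝟙) (FreeOfQ-^ x f (suc n)) (FreeOfQ-⊝ 𝟙 (FreeOfQ-con 1ℤ))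
  ; nonzero = λ e′ → contradiction (≡.trans (≡.sym (coeff₀-x-1 {x ^ suc n} (0*≡0 {coeff₀ x} {coeff₀ (x ^ n)} e))) e′) λ () }

coeff-𝕢⊗ : ∀ p i j k → coeff (𝕢 ⊗ p) i j k ≡ sumTo k λ k′ → coeff 𝕢 0 0 k′ ℤ.* coeff p i j (k ∸ k′)
coeff-𝕢⊗ p i j k = ≡.trans (sumTo-head i λ _ → sumTo-0 j λ _ → sumTo-0 k λ _ → ≡.refl)
  (sumTo-head j λ _ → sumTo-0 k λ _ → ≡.refl)

coeff-𝕢⊗-zero : ∀ p i j → coeff (𝕢 ⊗ p) i j 0 ≡ 0ℤ
coeff-𝕢⊗-zero p i j = coeff-𝕢⊗ p i j 0

coeff-𝕢⊗-suc : ∀ p i j k → coeff (𝕢 ⊗ p) i j (suc k) ≡ coeff p i j k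
coeff-𝕢⊗-suc p i j k = ≡.trans (coeff-𝕢⊗ p i j (suc k)) (≡.trans (sumTo-first k terms) (≡.trans (ℤP.+-identityˡ _)
  (≡.trans (sumTo-head k {λ k′ → terms (suc k′)} λ _ → ≡.refl) (ℤP.*-identityˡ (coeff p i j k)))))
  where
  terms : ℕ → ℤ
  terms k′ = coeff 𝕢 0 0 k′ ℤ.* coeff p i j (suc k ∸ k′)

coeff-𝕢^-low : ∀ g p i j k → k < g → coeff (𝕢 ^ g ⊗ p) i j k ≡ 0ℤ
coeff-𝕢^-low (suc g) p i j zero _ = ≡.trans (≐-elim (*-assoc 𝕢 (𝕢 ^ g) p) i j 0) (coeff-𝕢⊗-zero (𝕢 ^ g ⊗ p) i j)
coeff-𝕢^-low (suc g) p i j (suc k) (s≤s k<g) = ≡.trans (≐-elim (*-assoc 𝕢 (𝕢 ^ g) p) i j (suc k))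
  (≡.trans (coeff-𝕢⊗-suc (𝕢 ^ g ⊗ p) i j k) (coeff-𝕢^-low g p i j k k<g))

coeff-𝕢^-high : ∀ g p i j k → coeff (𝕢 ^ g ⊗ p) i j (g ℕ.+ k) ≡ coeff p i j k
coeff-𝕢^-high zero p i j k = ≐-elim (*-identityˡ p) i j k
coeff-𝕢^-high (suc g) p i j k = ≡.trans (≐-elim (*-assoc 𝕢 (𝕢 ^ g) p) i j (suc (g ℕ.+ k)))
  (≡.trans (coeff-𝕢⊗-suc (𝕢 ^ g ⊗ p) i j (g ℕ.+ k)) (coeff-𝕢^-high g p i j k))

-- Coefficients below q^g vanish, and any other equals the one g places lower; since g > 0 the
-- descent ends.
𝕢^-fixed⇒0 : ∀ g → 0 < g → ∀ z → z ≐ 𝕢 ^ g ⊗ z → z ≐ 𝟘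
𝕢^-fixed⇒0 g 0<g z e = ≐-intro λ i j k → ≡.trans (bounded i j (suc k) k ℕP.≤-refl) (≡.sym (coeff-𝟘 i j k))
  where
  bounded : ∀ i j N k → k < N → coeff z i j k ≡ 0ℤ
  bounded i j (suc N) k k<N with k ℕP.<? g
  ... | yes k<g = ≡.trans (≐-elim e i j k) (coeff-𝕢^-low g z i j k k<g)
  ... | no k≮g with ℕP.m≤n⇒∃[o]m+o≡n (ℕP.≮⇒≥ k≮g)
  ...   | o , ≡.refl = ≡.trans (≐-elim e i j (g ℕ.+ o)) (≡.trans (coeff-𝕢^-high g z i j o)
            (bounded i j N o (ℕP.≤-trans (ℕP.+-monoˡ-≤ o 0<g) (ℕP.≤-pred k<N))))

1-𝕢^-cancel : ∀ g → 0 < g → ∀ {x y} → (𝟙 - 𝕢 ^ g) * x ≐ (𝟙 - 𝕢 ^ g) * y → x ≐ y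
1-𝕢^-cancel g 0<g {x} {y} e = x-y≈0⇒x≈y (𝕢^-fixed⇒0 g 0<g (x - y) (fixed e))
  where
  fixed : ∀ {x y t} → (1# - t) * x ≐ (1# - t) * y → x - y ≐ t * (x - y)
  fixed {x} {y} {t} e = multiple⇒≈ {c = 1#} e (solve 3 (λ x y t → (x :- y) :- t :* (x :- y)
    := :con (+ 1) :* ((:con (+ 1) :- t) :* x :- (:con (+ 1) :- t) :* y)) refl x y t)

ground : Ground polyRing
ground = record
  { q = 𝕢 ; a = 𝕒 ; b = 𝕓 ; Const = Constant ; Const-* = Constant-⊗
  ; Const-nat = λ n → record { free = FreeOfQ-nat (suc n) ; nonzero = λ e → contradiction (≡.trans (≡.sym (coeff₀-nat (suc n))) e) λ () }
  ; Const-1-a^ = Constant-1-x^ 𝕒 FreeOfQ-𝕒 ≡.refl ; Const-a^-1 = Constant-x^-1 𝕒 FreeOfQ-𝕒 ≡.refl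
  ; Const-1-b^ = Constant-1-x^ 𝕓 FreeOfQ-𝕓 ≡.refl ; Const-b^-1 = Constant-x^-1 𝕓 FreeOfQ-𝕓 ≡.refl
  ; 1-q^-cancel = 1-𝕢^-cancel }

-- A bound on the q-degree read off the syntax, crude on sums; it is there to show that only
-- finitely many powers of q occur.
degree : Poly → ℕ
degree (con _) = 0
degree 𝕒 = 0
degree 𝕓 = 0
degree 𝕢 = 1
degree (p ⊕ r) = degree p ℕ.+ degree r
degree (p ⊗ r) = degree p ℕ.+ degree r
degree (⊝ p) = degree p

coeff-beyond-degree : ∀ p i j k → degree p < k → coeff p i j k ≡ 0ℤ
coeff-beyond-degree (con c) i j k d<k = FreeOfQ-con c i j k (ℕP.m<n⇒n≢0 d<k)
coeff-beyond-degree 𝕒 i j k d<k = FreeOfQ-𝕒 i j k (ℕP.m<n⇒n≢0 d<k)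
coeff-beyond-degree 𝕓 i j k d<k = FreeOfQ-𝕓 i j k (ℕP.m<n⇒n≢0 d<k)
coeff-beyond-degree 𝕢 zero zero (suc (suc k)) _ = ≡.refl
coeff-beyond-degree 𝕢 zero (suc j) (suc (suc k)) _ = ≡.refl
coeff-beyond-degree 𝕢 (suc i) j (suc (suc k)) _ = ≡.refl
coeff-beyond-degree 𝕢 _ _ (suc zero) (s≤s ())
coeff-beyond-degree (p ⊕ r) i j k d<k = ≡.cong₂ ℤ._+_
  (coeff-beyond-degree p i j k (ℕP.≤-<-trans (ℕP.m≤m+n _ _) d<k)) (coeff-beyond-degree r i j k (ℕP.≤-<-trans (ℕP.m≤n+m _ (degree p)) d<k))
coeff-beyond-degree (⊝ p) i j k d<k = ≡.cong ℤ.-_ (coeff-beyond-degree p i j k d<k)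
coeff-beyond-degree (p ⊗ r) i j k d<k = coeff-⊗-0 p r k product i j
  where
  product : ∀ i j i′ j′ k′ → coeff p i j k′ ℤ.* coeff r i′ j′ (k ∸ k′) ≡ 0ℤ
  product i j i′ j′ k′ with degree p ℕP.<? k′
  ... | yes d<k′ = 0*≡0 (coeff-beyond-degree p i j k′ d<k′)
  ... | no d≮k′ = *0≡0 {coeff p i j k′} (coeff-beyond-degree r i′ j′ (k ∸ k′)
        (ℕP.m+n≤o⇒m≤o∸n (suc (degree r)) (ℕP.≤-trans (s≤s (ℕP.≤-trans (ℕP.+-monoʳ-≤ (degree r) (ℕP.≮⇒≥ d≮k′)) (ℕP.≤-reflexive (ℕP.+-comm (degree r) _)))) d<k)))

bracket : ℕ → Poly
bracket = sum (𝕢 ^_)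

-- (1 − q^n) V ≈ (1 − q) c makes the coefficients of V periodic from c ≢ 0 on.
bracket-not-constant : ∀ n V c → 2 ≤ n → Constant c → ¬ V * bracket n ≐ c
bracket-not-constant n V c 2≤n C e = nonzero C (≡.trans (≡.sym (periodic (suc (degree V)))) (coeff-beyond-degree V 0 0 _
  (ℕP.≤-trans (ℕP.m≤m*n (suc (degree V)) n {{ℕ.>-nonZero (ℕP.≤-trans (s≤s z≤n) 2≤n)}}) ℕP.≤-refl)))
  where
  relation : V ≐ 𝕢 ^ n * V + (c - 𝕢 * c)
  relation = multiple₂⇒≈ {c = 1# - 𝕢} {c′ = - V} e (geometric 𝕢 n) (solve 5 (λ V q c B t →
    V :- (t :* V :+ (c :- q :* c)) := (:con (+ 1) :- q) :* (V :* B :- c) :+ :- V :* ((:con (+ 1) :- q) :* B :- (:con (+ 1) :- t)))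
    refl V 𝕢 c (bracket n) (𝕢 ^ n))
  periodic : ∀ j → coeff V 0 0 (j ℕ.* n) ≡ coeff₀ c
  periodic zero = ≡.trans (≐-elim relation 0 0 0) (≡.trans
    (≡.cong₂ ℤ._+_ (coeff-𝕢^-low n V 0 0 0 (ℕP.≤-trans (s≤s z≤n) 2≤n)) (≡.cong (λ z → coeff₀ c ℤ.- z) (coeff-𝕢⊗-zero c 0 0)))
    (≡.trans (ℤP.+-identityˡ _) (ℤP.+-identityʳ _)))
  periodic (suc j) = ≡.trans (≐-elim relation 0 0 (n ℕ.+ j ℕ.* n)) (≡.trans
    (≡.cong₂ ℤ._+_ (≡.trans (coeff-𝕢^-high n V 0 0 (j ℕ.* n)) (periodic j)) (vanish (n ℕ.+ j ℕ.* n) (ℕP.≤-trans 2≤n (ℕP.m≤m+n n _))))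
    (ℤP.+-identityʳ _))
    where
    vanish : ∀ k → 2 ≤ k → coeff (c - 𝕢 * c) 0 0 k ≡ 0ℤ
    vanish (suc (suc k)) _ = ≡.cong₂ (λ x y → x ℤ.- y) (free C 0 0 _ λ ()) (≡.trans (coeff-𝕢⊗-suc c 0 0 (suc k)) (free C 0 0 _ λ ()))
    vanish (suc zero) (s≤s ())

-- Numerators and denominators of the given fractions

pow≡^ : ∀ p n → pow p n ≡ p ^ n
pow≡^ p zero = ≡.refl
pow≡^ p (suc n) = ≡.cong (p ⊗_) (pow≡^ p n)

pow≐^ : ∀ p n → pow p n ≐ p ^ n
pow≐^ p n = reflexive (pow≡^ p n)

qintPoly≐bracket : ∀ n → qintPoly n ≐ bracket n
qintPoly≐bracket zero = refl
qintPoly≐bracket (suc n) = +-cong (qintPoly≐bracket n) (pow≐^ 𝕢 n)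

prod-* : ∀ f g k → prod f k * prod g k ≐ prod (λ j → f j * g j) k
prod-* f g zero = *-identityˡ 1#
prod-* f g (suc k) = trans (solve 4 (λ x a y b → (x :* a) :* (y :* b) := (x :* y) :* (a :* b)) refl (prod f k) (f k) (prod g k) (g k))
  (*-congʳ (prod-* f g k))

poch-num : ∀ x y d k → num (poch (x // y) d k) ≐ prod (λ j → y - x * 𝕢 ^ (d ℕ.* j)) k
poch-num x y d zero = refl
poch-num x y d (suc k) = *-cong (poch-num x y d k) (trans
  (solve 3 (λ x y p → :con (+ 1) :* (y :* :con (+ 1)) :+ :- (x :* p :* :con (+ 1)) := y :- x :* p) refl x y (pow 𝕢 (d ℕ.* k)))
  (+-congˡ (-‿cong (*-congˡ (pow≐^ 𝕢 (d ℕ.* k))))))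

poch-den : ∀ x y d k → den (poch (x // y) d k) ≐ prod (λ _ → y) k
poch-den x y d zero = refl
poch-den x y d (suc k) = *-cong (poch-den x y d k)
  (solve 1 (λ y → :con (+ 1) :* (y :* :con (+ 1)) := y) refl y)

-- The six Pochhammer arguments a p, p / a, b p, p / b, p, p, each given as numerator and
-- denominator.
product₆ : (Poly → Poly → Poly) → Poly → Poly
product₆ f p = f (𝕒 ⊗ p) 𝟙 * f p 𝕒 * f (𝕓 ⊗ p) 𝟙 * f p 𝕓 * f p 𝟙 * f p 𝟙

module Fractions (d : ℕ) (3≤d : 3 ≤ d) where
  open Vanishing polyRing ground d 3≤d using (h; upper; lower; termNum; termDen; sumNum; sumDen)

  product₆-prod : ∀ (f : ℕ → Poly → Poly → Poly) (F : Poly → Poly → Poly) k p →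
    (∀ x y → F x y ≐ prod (λ j → f j x y) k) → product₆ F p ≐ prod (λ j → product₆ (f j) p) k
  product₆-prod f F k p e = trans
    (*-cong (*-cong (*-cong (*-cong (*-cong (e _ _) (e _ _)) (e _ _)) (e _ _)) (e _ _)) (e _ _))
    (trans (*-congʳ (*-congʳ (*-congʳ (*-congʳ (prod-* _ _ k))))) (trans (*-congʳ (*-congʳ (*-congʳ (prod-* _ _ k))))
    (trans (*-congʳ (*-congʳ (prod-* _ _ k))) (trans (*-congʳ (prod-* _ _ k)) (prod-* _ _ k)))))

  product₆-h : ∀ p t → product₆ (λ x y → y - x * t) p ≐ h (p * t)
  product₆-h p t = solve 4 (λ a b p t →
    (:con (+ 1) :- (a :* p) :* t) :* (a :- p :* t) :* (:con (+ 1) :- (b :* p) :* t) :* (b :- p :* t) :* (:con (+ 1) :- p :* t) :* (:con (+ 1) :- p :* t)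
    := (:con (+ 1) :- a :* (p :* t)) :* (a :- p :* t) :* ((:con (+ 1) :- b :* (p :* t)) :* (b :- p :* t))
      :* ((:con (+ 1) :- :con (+ 1) :* (p :* t)) :* (:con (+ 1) :- p :* t))) refl 𝕒 𝕓 p t

  h-cong : ∀ {x y} → x ≐ y → h x ≐ h y
  h-cong = Factors.factor-cong polyRing refl refl

  -- The power (a b)^k from the arguments p / a and p / b. It is the same for p = q and p = q^d, so
  -- it occurs both above and below in the summand.
  scale : ℕ → Poly
  scale k = prod (λ _ → product₆ (λ _ y → y) 𝟙) k

  upper≐ : ∀ k → product₆ (λ x y → num (poch (x // y) d k)) 𝕢 ≐ upper k
  upper≐ k = trans (product₆-prod (λ j x y → y - x * 𝕢 ^ (d ℕ.* j)) _ k 𝕢 (λ x y → poch-num x y d k))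
    (prod-cong k λ j _ → product₆-h 𝕢 (𝕢 ^ (d ℕ.* j)))

  lower≐ : ∀ k → product₆ (λ x y → num (poch (x // y) d k)) (qd d) ≐ lower k
  lower≐ k = trans (product₆-prod (λ j x y → y - x * 𝕢 ^ (d ℕ.* j)) _ k (qd d) (λ x y → poch-num x y d k))
    (prod-cong k λ j _ → trans (product₆-h (qd d) (𝕢 ^ (d ℕ.* j))) (h-cong (trans (*-congʳ (pow≐^ 𝕢 d))
      (trans (sym (^-homo-* 𝕢 d (d ℕ.* j))) (^-congʳ 𝕢 (≡.sym (ℕP.*-suc d j)))))))

  den≐scale : ∀ p k → product₆ (λ x y → den (poch (x // y) d k)) p ≐ scale k
  den≐scale p k = product₆-prod (λ _ _ y → y) _ k p (λ x y → poch-den x y d k)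

  summand-num : ∀ k → num (summand d k) ≐ scale k * termNum k
  summand-num k = trans (*-cong (*-cong (+-congˡ (-‿cong (pow≐^ 𝕢 _))) (*-cong (upper≐ k) (den≐scale (qd d) k))) (pow≐^ 𝕢 _))
    (solve 4 (λ x u s p → x :* (u :* s) :* p := s :* (x :* u :* p)) refl _ (upper k) (scale k) _)

  summand-den : ∀ k → den (summand d k) ≐ scale k * termDen k
  summand-den k = trans (*-congʳ (*-congˡ (*-cong (den≐scale 𝕢 k) (lower≐ k))))
    (solve 3 (λ x s l → x :* (s :* l) :* :con (+ 1) := s :* (x :* l)) refl _ (scale k) (lower k))

  sum-scaled : ∀ n → ∃ λ c → (num (sumF n (summand d)) ≐ c * sumNum n) × (den (sumF n (summand d)) ≐ c * sumDen n)
  sum-scaled zero = 𝟙 , sym (*-identityˡ _) , sym (*-identityˡ _)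
  sum-scaled (suc n) = c * scale n ,
    trans (+-cong (*-cong e (summand-den n)) (*-cong (summand-num n) f))
      (solve 6 (λ c s N D t u → (c :* N) :* (s :* u) :+ (s :* t) :* (c :* D) := (c :* s) :* (N :* u :+ t :* D)) refl
        c (scale n) (sumNum n) (sumDen n) (termNum n) (termDen n)) ,
    trans (*-cong f (summand-den n))
      (solve 4 (λ c s D u → (c :* D) :* (s :* u) := (c :* s) :* (D :* u)) refl c (scale n) (sumDen n) (termDen n))
    where
    c = proj₁ (sum-scaled n)
    e = proj₁ (proj₂ (sum-scaled n))
    f = proj₂ (proj₂ (sum-scaled n))

-- The local function of prodDiv cannot be named; abstracting suc m lets unification supply it to prodDiv-step.
module _ (d : ℕ) (3≤d : 3 ≤ d) (F : ℕ → Poly) where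
  open CyclotomicProduct polyRing ground d 3≤d F using (divisorProduct)
  mutual
    prodDiv≐divisorProduct : ∀ m → prodDiv m F ≐ divisorProduct m m
    prodDiv≐divisorProduct zero = refl
    prodDiv≐divisorProduct (suc m) with suc m ∣? suc m
    ... | no ¬div = contradiction ∣-refl ¬div
    ... | yes _ with suc m
    ...   | N = *-congʳ (prodDiv-step N m)

    prodDiv-step : ∀ N e → _ ≐ divisorProduct N e
    prodDiv-step N zero = refl
    prodDiv-step N (suc e) with suc e ∣? N
    ... | yes _ = *-congʳ (prodDiv-step N e)
    ... | no _ = trans (prodDiv-step N e) (sym (*-identityʳ _))

-- From comaximal multiples to the congruence of the theorem

module Conclusion (n d : ℕ) (3≤d : 3 ≤ d) where
  open Vanishing polyRing ground d 3≤d using (Comax; Multiple; Multiple-resp; sumNum; sumDen)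
  open Fractions d 3≤d

  private
    N D : Poly
    N = sumNum n
    D = sumDen n

  numerator-equation : ∀ {P D₁ M} → N * D₁ ≐ P * M * D → num (S n d -F zeroF) * D₁ ≐ P * M * den (S n d -F zeroF)
  numerator-equation {P} {D₁} {M} e = let c , eN , eD = sum-scaled n in begin
    (num (S n d) * 1# - 0# * den (S n d)) * D₁ ≈⟨ solve 3 (λ x y D₁ → (x :* :con (+ 1) :- :con (+ 0) :* y) :* D₁ := x :* D₁) refl _ _ D₁ ⟩
    num (S n d) * D₁ ≈⟨ *-congʳ eN ⟩
    c * N * D₁ ≈⟨ *-assoc c N D₁ ⟩
    c * (N * D₁) ≈⟨ *-congˡ e ⟩
    c * (P * M * D) ≈⟨ solve 4 (λ c P M D → c :* (P :* M :* D) := P :* M :* (c :* D :* :con (+ 1))) refl c P M D ⟩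
    P * M * (c * D * 1#) ≈⟨ *-congˡ (*-congʳ eD) ⟨
    P * M * (den (S n d) * 1#) ∎

  constant-nonzero : ∀ {c} → Constant c → ¬ (c ≈ 𝟘)
  constant-nonzero C e = Constant.nonzero C (e 0 0 0)

  -- `Comax` does not itself say that D₁ is nonzero. If D₁ were 0, the Bézout identity would make
  -- [n] divide a nonzero constant, impossible for n ≥ 2; hence n = 1 is treated apart.
  congruence : ∀ {P X} → 2 ≤ n → P ≐ bracket n * X → Multiple N D P → S n d ≡F zeroF mod P
  congruence {P} {X} 2≤n P≐ (D₁ , (U , V , c , C , e) , M , f) = M , D₁ , U , V , c ,
    (λ D₁≈0 → bracket-not-constant n (V * X) c 2≤n C (begin
      V * X * bracket n ≈⟨ solve 4 (λ U V X B → V :* X :* B := U :* :con (+ 0) :+ V :* (B :* X)) refl U V X (bracket n) ⟩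
      U * 0# + V * (bracket n * X) ≈⟨ +-cong (*-congˡ (≐-intro D₁≈0)) (*-congˡ P≐) ⟨
      U * D₁ + V * P ≈⟨ e ⟩
      c ∎)) ,
    ≐-elim (numerator-equation {P} {D₁} {M} f) , Constant.free C , constant-nonzero C , ≐-elim e

-- Here [1] = 1 and the sum is its only term, which equals 1; this gives the witness M = 1, and 0 ·
-- 1 + 1 · [1] = 1 is the Bézout identity.
S₁-congruence : ∀ d → 3 ≤ d → S 1 d ≡F zeroF mod qintPoly 1
S₁-congruence d 3≤d = 𝟙 , 𝟙 , 𝟘 , 𝟙 , 𝟙 , (λ e → contradiction (e 0 0 0) λ ()) ,
  ≐-elim (Conclusion.numerator-equation 1 d 3≤d {qintPoly 1} {𝟙} {𝟙} (trans
    (*-congʳ (+-congˡ (*-congʳ (*-cong (*-congʳ (+-congˡ (-‿cong (^-congʳ 𝕢 {2 ℕ.* d ℕ.* 0 ℕ.+ 1} {1} (≡.cong (ℕ._+ 1) (ℕP.*-zeroʳ (2 ℕ.* d)))))))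
      (^-congʳ 𝕢 {(2 ℕ.* d ∸ 3) ℕ.* 0} {0} (ℕP.*-zeroʳ (2 ℕ.* d ∸ 3)))))))
    (solve 1 (λ q →
      (:con (+ 0) :* ((:con (+ 1) :- q) :* :con (+ 1)) :+ (:con (+ 1) :- q :* :con (+ 1)) :* :con (+ 1) :* :con (+ 1) :* :con (+ 1)) :* :con (+ 1)
      := (:con (+ 0) :+ :con (+ 1)) :* :con (+ 1) :* (:con (+ 1) :* ((:con (+ 1) :- q) :* :con (+ 1)))) refl 𝕢))) ,
  FreeOfQ-con 1ℤ , (λ e → contradiction (e 0 0 0) λ ()) ,
  ≐-elim (solve 0 (:con (+ 0) :* :con (+ 1) :+ :con (+ 1) :* (:con (+ 0) :+ :con (+ 1)) := :con (+ 1)) refl)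

theorem1p1 : (n d : ℕ) → 1 ≤ n → 3 ≤ d → gcd n d ≡ 1 →
    (Φ : ℕ → Poly) → IsCyclotomicUpTo n Φ →
    (d ∣ suc n → S n d ≡F zeroF mod (qintPoly n ⊗ Φ n)) ×
    (¬ (d ∣ suc n) → S n d ≡F zeroF mod qintPoly n)
theorem1p1 (suc zero) d _ 3≤d _ Φ _ =
  (λ d∣2 → contradiction (∣⇒≤ d∣2) (ℕP.<⇒≱ 3≤d)) , λ _ → S₁-congruence d 3≤d
theorem1p1 (suc (suc n″)) d _ 3≤d gcd≡1 Φ isCyclotomic =
  (λ d∣1+n → congruence (s≤s (s≤s z≤n)) (*-congʳ (qintPoly≐bracket n))
    (Multiple-resp _ _ (*-congʳ (sym (qintPoly≐bracket n))) (multiple-bracket-Φ n″ coprime cyclotomic d∣1+n))) ,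
  λ _ → congruence (s≤s (s≤s z≤n)) (trans (qintPoly≐bracket n) (sym (*-identityʳ _)))
    (Multiple-resp _ _ (sym (qintPoly≐bracket n)) (Main.multiple-bracket (suc n″) coprime cyclotomic))
  where
  n = suc (suc n″)
  open CyclotomicProduct polyRing ground d 3≤d Φ
  open Conclusion n d 3≤d using (congruence)
  coprime : ∀ m → m ∣ n → Coprime m d
  coprime m m∣n (i∣m , i∣d) = gcd≡1⇒coprime gcd≡1 (∣-trans i∣m m∣n , i∣d)
  cyclotomic : ∀ m → 1 ≤ m → m ≤ n → divisorProduct m m ≐ 𝕢 ^ m - 1#
  cyclotomic m 1≤m m≤n = trans (sym (prodDiv≐divisorProduct d 3≤d Φ m))
    (trans (≐-intro (isCyclotomic m 1≤m m≤n)) (+-congʳ (pow≐^ 𝕢 m)))
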